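{- Let $\varepsilon \in (0,1)$ and let $G \sim G\left(n, \frac{1+\varepsilon}{n}\right)$. Then with high probability (i.e. with probability tending to $1$ as $n\to\infty$), $\mathrm{Dist}_{\mathrm{BP}}(G) = \Theta(\varepsilon^3)\, n$; that is, there are absolute constants $0<c_1\le c_2$ such that w.h.p. $c_1\varepsilon^3 n \le \mathrm{Dist}_{\mathrm{BP}}(G)\le c_2\varepsilon^3 n$.
   Context: $G(n,p)$ is the binomial random graph on $n$ labeled vertices in which each of the $\binom n2$ possible edges is present independently with probability $p$. For a graph $G$, $\mathrm{Dist}_{\mathrm{BP}}(G)$ (the distance of $G$ from bipartiteness) is the minimum number of edges whose removal makes $G$ bipartite; equivalently $\mathrm{Dist}_{\mathrm{BP}}(G)=|E(G)|-\mathrm{MAXCUT}(G)$, where $\mathrm{MAXCUT}(G)$ is the maximum number of edges crossing a bipartition of $V(G)$.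
   Formalization: The parameter ε ranges over the rational numbers in (0,1) instead of all real numbers in (0,1); the absolute constants are rational and still uniform in ε. -}

module Defs where

open import Data.Bool using (Bool; true; false; _xor_; if_then_else_)
open import Data.Nat as ℕ using (ℕ; zero; suc; _⊔_; _∸_)
open import Data.Nat.Properties using (_<?_)
open import Data.Fin using (Fin; toℕ)
open import Data.List using (List; []; _∷_; map; filter; concatMap; allFin; length; foldr; zip)
open import Data.Vec using (Vec; []; _∷_; lookup; toList)
open import Data.Product using (_×_; _,_; proj₁; proj₂)
open import Data.Integer using (+_)
open import Data.Rational using (ℚ; _+_; _*_; _-_; _/_; 0ℚ; 1ℚ)
open import Relation.Nullary using (does)

toℚ : ℕ → ℚ
toℚ n = + n / 1

pairs : (n : ℕ) → List (Fin n × Fin n)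
pairs n = concatMap (λ j → map (λ i → (i , j)) (filter (λ i → toℕ i <? toℕ j) (allFin n))) (allFin n)

-- A (simple, labeled) graph on Fin n: one Boolean per potential edge (edge present or not).
Graph : ℕ → Set
Graph n = Vec Bool (length (pairs n))

edges : {n : ℕ} → Graph n → List (Fin n × Fin n)
edges {n} g = map proj₁ (filter (λ e → Data.Bool._≟_ (proj₂ e) true) (zip (pairs n) (toList g)))

countTrue : List Bool → ℕ
countTrue [] = 0
countTrue (true ∷ bs) = suc (countTrue bs)
countTrue (false ∷ bs) = countTrue bs

cutSize : {n : ℕ} → Graph n → (Fin n → Bool) → ℕ
cutSize {n} g σ = countTrue (map (λ e → σ (proj₁ e) xor σ (proj₂ e)) (edges {n} g))

allVecs : (n : ℕ) → List (Vec Bool n)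
allVecs zero = [] ∷ []
allVecs (suc n) = concatMap (λ v → (true ∷ v) ∷ (false ∷ v) ∷ []) (allVecs n)

maxCut : {n : ℕ} → Graph n → ℕ
maxCut {n} g = foldr _⊔_ 0 (map (λ v → cutSize {n} g (lookup v)) (allVecs n))

distBP : {n : ℕ} → Graph n → ℕ
distBP {n} g = length (edges {n} g) ∸ maxCut {n} g

probBits : ℚ → (m : ℕ) → (Vec Bool m → Bool) → ℚ
probBits p zero P = if P [] then 1ℚ else 0ℚ
probBits p (suc m) P = p * probBits p m (λ v → P (true ∷ v)) + (1ℚ - p) * probBits p m (λ v → P (false ∷ v))

probGnp : (n : ℕ) → ℚ → (Graph n → Bool) → ℚ
probGnp n p P = probBits p (length (pairs n)) P

-- Edge probability (1 + ε) / n  (n = 0 gives 0; irrelevant since there are no potential edges).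
pEdge : ℚ → ℕ → ℚ
pEdge ε zero = 0ℚ
pEdge ε (suc k) = (1ℚ + ε) * (+ 1 / suc k)

-- Toggling an edge changes the distance D by at most one, so D has variance O(n) by Efron–Stein, and by Chebyshev it is enough that E D ≍ ε³ n.
--
-- Upper bound. A new edge increases D only if its ends are already connected. Hence, by a discrete Russo formula, raising the density
-- from (1 + ε²)/n to (1 + ε)/n increases E D by at most ε/n times the expected number of connected pairs. Exploring components vertex by
-- vertex shows that a vertex lies in a large component with probability O(ε), and the number of such vertices is concentrated, so there are
-- O(ε² n²) connected pairs; the same bound at density (1 + ε²)/n shows that E D is only O(ε⁴ n) there.
--
-- Lower bound. At density (1 + ε/2)/n, with high probability at least ε n/16 vertices lie in components of size at least 2K, where K ≍ ε⁻².
-- A spanning forest is cut into edge-disjoint subtrees which carry disjoint blocks of K to 2K vertices. A 2-colouring that violates fewer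
-- than c ε³ n forest edges spoils few blocks, and on every other block it is known up to one bit, so 3^J partial colourings of the J blocks
-- account for all of them. Each partial colouring makes a constant fraction of the pairs of coloured vertices monochromatic, so sprinkling the
-- remaining edges of density ε/(2n) violates enough edges, with a failure probability that beats 3^J once K is a large multiple of ε⁻².
module Submission where

open import Defs
open import Data.Bool using (Bool; true; false; if_then_else_; not; _∧_; _∨_; _xor_)
import Data.Bool.Properties as 𝔹ₚ
open import Data.Nat using (ℕ; zero; suc; z≤n; s≤s; _≥_; ⌊_/2⌋)
import Data.Nat as ℕ
import Data.Nat.Properties as ℕₚ
import Data.Nat.Tactic.RingSolver as ℕ-Solver
open import Data.Fin as Fin using (Fin; zero; suc; toℕ; fromℕ<; punchIn; punchOut)
import Data.Fin.Properties as Finₚ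
open import Data.Vec as Vec using (Vec; []; _∷_; lookup; _[_]≔_; zipWith; tabulate; toList; replicate)
import Data.Vec.Properties as Vecₚ
open import Data.Maybe as Maybe using (Maybe; just; nothing; is-just)
open import Data.List as List using (List; []; _∷_; length; map; foldr; filter; zip; concatMap; allFin; _++_)
import Data.List.Properties as Listₚ
open import Data.List.Membership.Propositional using (_∈_; _∉_)
open import Data.List.Membership.Propositional.Properties using (∈-concatMap⁺; ∈-map⁺; ∈-++⁺ˡ; ∈-++⁻; ∈-tabulate⁺)
open import Data.List.Relation.Unary.Any as Any using (here; there)
open import Data.List.Relation.Unary.All as All using (All; []; _∷_)
import Data.List.Relation.Unary.All.Properties as Allₚ
open import Data.List.Relation.Unary.AllPairs using ([]; _∷_)
open import Data.List.Relation.Unary.Unique.Propositional using (Unique)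
open import Data.List.Relation.Unary.Unique.Propositional.Properties using (tabulate⁺)
open import Data.List.Relation.Binary.Permutation.Propositional using (_↭_; prep; ↭-sym; ↭-trans; ↭-reflexive; ↭⇒↭ₛ)
open import Data.List.Relation.Binary.Permutation.Propositional.Properties using (shift; ++⁺ˡ; ∈-resp-↭)
import Data.List.Relation.Binary.Permutation.Setoid.Properties as ↭ₛ
open import Data.Product using (∃; ∃₂; _×_; _,_; proj₁; proj₂)
open import Data.Sum using (_⊎_; inj₁; inj₂)
open import Data.Empty using (⊥-elim)
open import Function using (_∘_)
open import Relation.Nullary using (does; yes; no; ¬_; Dec)
open import Relation.Nullary.Decidable using (dec-true; dec-false; _×-dec_; ¬?)
open import Relation.Unary using (Decidable)
open import Relation.Binary.Definitions using (tri<; tri≈; tri>)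
open import Relation.Binary.PropositionalEquality using (_≡_; _≢_; refl; sym; trans; cong; cong₂; subst; subst₂; setoid)
open import Algebra.Properties.CommutativeMonoid.Sum ℕₚ.+-0-commutativeMonoid using (sum; ∑-comm; ∑-distrib-+; sum-cong-≗)

-- Why the upper bound starts at density `(1 + ε²)/n`: interpolating from density 0 would multiply
-- the `O(ε² n²)` connected pairs by `(1 + ε)/n` and lose a factor `ε`. The value at the new
-- starting point comes from the same bound on connected pairs, read at `ε²` in place of `ε`, so the
-- critical graph needs no analysis of its own. Why `K` is of order `ε⁻²`: the covered vertices, of
-- order `ε n`, span order `ε² n²` monochromatic pairs, so the sprinkling misses nearly all of them
-- only with probability `exp(-Ω(ε³ n))`. There are at most `O(ε n / K)` blocks, and three states
-- per block are affordable once `K` is a large multiple of `ε⁻²`. All `2^n` colourings would be too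
-- many. All quantities are rational. Neither exponentials nor the survival probability of a
-- branching process is at hand. A guessed survival probability `h` is tested through a potential,
-- powers of `1 - a` are handled by polynomial inequalities, and the exact mean of `½` to the number
-- of hits replaces a Chernoff bound. Paths never occur: components are handled through functions
-- that are constant along edges.

module Combinatorics where
  open import Data.Nat using (_+_; _*_; _∸_; _⊔_; _≤_; _<_)
  open import Data.Nat.Properties

  -- Counting, components and violated edges

  does-true : ∀ {P : Set} (d : Dec P) → does d ≡ true → P
  does-true (yes p) refl = p

  does-false : ∀ {P : Set} (d : Dec P) → does d ≡ false → ¬ P
  does-false (no ¬p) refl = ¬p

  bit : Bool → ℕ
  bit true = 1
  bit false = 0

  sum-mono : ∀ {n} {f g : Fin n → ℕ} → (∀ i → f i ≤ g i) → sum f ≤ sum g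
  sum-mono {zero} h = z≤n
  sum-mono {suc n} h = +-mono-≤ (h zero) (sum-mono (h ∘ suc))

  sum-≤ : ∀ {n} (f : Fin n → ℕ) c → (∀ i → f i ≤ c) → sum f ≤ n * c
  sum-≤ {zero} f c h = z≤n
  sum-≤ {suc n} f c h = +-mono-≤ (h zero) (sum-≤ (f ∘ suc) c (h ∘ suc))

  bit-mono : ∀ {a b} → (a ≡ true → b ≡ true) → bit a ≤ bit b
  bit-mono {false} h = z≤n
  bit-mono {true} h rewrite h refl = ≤-refl

  bit-∨ : ∀ a b → bit (a ∨ b) ≤ bit a + bit b
  bit-∨ true b = s≤s z≤n
  bit-∨ false b = ≤-refl

  sum-zero : ∀ {n} {f : Fin n → ℕ} → (∀ i → f i ≡ 0) → sum f ≡ 0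
  sum-zero {zero} h = refl
  sum-zero {suc n} h = cong₂ _+_ (h zero) (sum-zero (h ∘ suc))

  sum-single : ∀ {n} (f : Fin n → ℕ) i → f i ≤ sum f
  sum-single f zero = m≤m+n _ _
  sum-single f (suc i) = ≤-trans (sum-single (f ∘ suc) i) (m≤n+m _ _)

  sum-*ʳ : ∀ {n} (f : Fin n → ℕ) c → sum f * c ≡ sum (λ i → f i * c)
  sum-*ʳ {zero} f c = refl
  sum-*ʳ {suc n} f c = trans (*-distribʳ-+ c (f zero) _) (cong (f zero * c +_) (sum-*ʳ (f ∘ suc) c))

  opaque
    count : ∀ {n} → (Fin n → Bool) → ℕ
    count P = sum (λ i → bit (P i))

    count-def : ∀ {n} (P : Fin n → Bool) → count P ≡ sum (λ i → bit (P i))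
    count-def P = refl

    count-suc : ∀ {n} (P : Fin (suc n) → Bool) → count P ≡ bit (P zero) + count (P ∘ suc)
    count-suc P = refl

    count-mono : ∀ {n} {P Q : Fin n → Bool} → (∀ i → P i ≡ true → Q i ≡ true) → count P ≤ count Q
    count-mono h = sum-mono λ i → bit-mono (h i)

    count-cong : ∀ {n} {P Q : Fin n → Bool} → (∀ i → P i ≡ Q i) → count P ≡ count Q
    count-cong h = sum-cong-≗ λ i → cong bit (h i)

    count-∨ : ∀ {n} (P Q : Fin n → Bool) → count (λ i → P i ∨ Q i) ≤ count P + count Q
    count-∨ P Q = ≤-trans (sum-mono λ i → bit-∨ (P i) (Q i)) (≤-reflexive (∑-distrib-+ (bit ∘ P) (bit ∘ Q)))

    count-≤ : ∀ {n} (P : Fin n → Bool) → count P ≤ n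
    count-≤ {n} P = ≤-trans (sum-≤ (bit ∘ P) 1 (λ i → bit-mono {P i} {true} (λ _ → refl))) (≤-reflexive (*-identityʳ n))

    count-none : ∀ {n} {P : Fin n → Bool} → (∀ i → P i ≡ false) → count P ≡ 0
    count-none {P = P} h = sum-zero {f = bit ∘ P} λ i → cong bit (h i)

    count-single : ∀ {n} {P : Fin n → Bool} i → P i ≡ true → 1 ≤ count P
    count-single {P = P} i h = ≤-trans (≤-reflexive (sym (cong bit h))) (sum-single (bit ∘ P) i)

    count-strict : ∀ {n} {P Q : Fin n → Bool} i → P i ≡ false → Q i ≡ true → (∀ i → P i ≡ true → Q i ≡ true) → suc (count P) ≤ count Q
    count-strict {P = P} {Q} zero p q h rewrite p | q = s≤s (count-mono (h ∘ suc))
    count-strict {suc n} {P} {Q} (suc i) p q h = ≤-trans (≤-reflexive (sym (+-suc (bit (P zero)) _))) (+-mono-≤ (bit-mono (h zero)) (count-strict i p q (h ∘ suc)))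

  opaque
    leb : ℕ → ℕ → Bool
    leb a b = does (a ≤? b)

    leb⇒≤ : ∀ {a b} → leb a b ≡ true → a ≤ b
    leb⇒≤ {a} {b} = does-true (a ≤? b)

    ≤⇒leb : ∀ {a b} → a ≤ b → leb a b ≡ true
    ≤⇒leb {a} {b} = dec-true (a ≤? b)

    leb⇒> : ∀ {a b} → leb a b ≡ false → b < a
    leb⇒> {a} {b} h = ≰⇒> (does-false (a ≤? b) h)

    <⇒leb : ∀ {a b} → b < a → leb a b ≡ false
    <⇒leb {a} {b} h = dec-false (a ≤? b) (<⇒≱ h)

  _==_ : ∀ {n} → Fin n → Fin n → Bool
  i == j = does (i Finₚ.≟ j)

  ==⇒≡ : ∀ {n} {i j : Fin n} → (i == j) ≡ true → i ≡ j
  ==⇒≡ {i = i} {j} = does-true (i Finₚ.≟ j)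

  ≡⇒== : ∀ {n} {i j : Fin n} → i ≡ j → (i == j) ≡ true
  ≡⇒== {i = i} {j} = dec-true (i Finₚ.≟ j)

  ≢⇒== : ∀ {n} {i j : Fin n} → i ≢ j → (i == j) ≡ false
  ≢⇒== {i = i} {j} = dec-false (i Finₚ.≟ j)

  count-eq : ∀ {n} (i : Fin n) → count (λ j → i == j) ≡ 1
  count-eq {suc n} zero = trans (count-suc (λ j → zero == j)) (cong suc (count-none {n} {λ j → zero == suc j} (λ _ → refl)))
  count-eq {suc n} (suc i) = trans (count-suc (λ j → suc i == j)) (count-eq i)

  _⊑_ : ∀ {m} → Vec Bool m → Vec Bool m → Set
  x ⊑ y = ∀ k → lookup x k ≡ true → lookup y k ≡ true

  false⊑ : ∀ {m} (x : Vec Bool m) k → (x [ k ]≔ false) ⊑ x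
  false⊑ x k j h with j Finₚ.≟ k
  ... | no j≢k = trans (sym (Vecₚ.lookup∘update′ j≢k x false)) h
  ... | yes refl with trans (sym h) (Vecₚ.lookup∘update k x false)
  ...   | ()

  ⊑true : ∀ {m} (x : Vec Bool m) k → x ⊑ (x [ k ]≔ true)
  ⊑true x k j h with j Finₚ.≟ k
  ... | no j≢k = trans (Vecₚ.lookup∘update′ j≢k x true) h
  ... | yes refl = Vecₚ.lookup∘update k x true

  false⊑true : ∀ {m} (x : Vec Bool m) k → (x [ k ]≔ false) ⊑ (x [ k ]≔ true)
  false⊑true x k j h = ⊑true x k j (false⊑ x k j h)

  module Multigraph {n : ℕ} where

    Ends : ℕ → Set
    Ends m = Fin m → Fin n × Fin n

    agree : (Fin n → Bool) → Fin n × Fin n → Bool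
    agree σ (i , j) = not (σ i xor σ j)

    -- The edges that the bipartition `σ` leaves inside a colour class. Deleting them makes the
    -- graph bipartite, so the distance is the minimum of `viol` over all `σ`.
    viol : ∀ {m} → Ends m → Vec Bool m → (Fin n → Bool) → ℕ
    viol ends x σ = count (λ k → lookup x k ∧ agree σ (ends k))

    Respects : ∀ {m} → Ends m → Vec Bool m → {A : Set} → (Fin n → A) → Set
    Respects ends x φ = ∀ k → lookup x k ≡ true → φ (proj₁ (ends k)) ≡ φ (proj₂ (ends k))

    relabel : (Fin n → Fin n) → Fin n × Fin n → Fin n → Fin n
    relabel ℓ (i , j) w = if ℓ w == ℓ i then ℓ j else ℓ w

    -- Union–find: lab is constant on each connected component and takes its value inside it.
    lab : ∀ {m} → Ends m → Vec Bool m → Fin n → Fin n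
    lab ends [] = λ w → w
    lab ends (b ∷ x) = if b then relabel (lab (ends ∘ suc) x) (ends zero) else lab (ends ∘ suc) x

    relabel-cong : ∀ ℓ e {u v} → ℓ u ≡ ℓ v → relabel ℓ e u ≡ relabel ℓ e v
    relabel-cong ℓ (i , j) h rewrite h = refl

    relabel-joins : ∀ ℓ e → relabel ℓ e (proj₁ e) ≡ relabel ℓ e (proj₂ e)
    relabel-joins ℓ (i , j) with ℓ j == ℓ i
    ... | true  rewrite ≡⇒== {i = ℓ i} refl = refl
    ... | false rewrite ≡⇒== {i = ℓ i} refl = refl

    lab-respects : ∀ {m} (ends : Ends m) x → Respects ends x (lab ends x)
    lab-respects ends (true ∷ x) zero h = relabel-joins (lab (ends ∘ suc) x) (ends zero)
    lab-respects ends (true ∷ x) (suc k) h = relabel-cong (lab (ends ∘ suc) x) (ends zero) (lab-respects (ends ∘ suc) x k h)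
    lab-respects ends (false ∷ x) (suc k) h = lab-respects (ends ∘ suc) x k h

    -- Quantifying over every `φ` that is constant along present edges expresses that the label of
    -- `w` lies in the component of `w`. In the merging case `φ` is carried from the new label
    -- across the two ends of the added edge and back to `w`.
    lab-inside : ∀ {m} (ends : Ends m) x {A : Set} (φ : Fin n → A) → Respects ends x φ → ∀ w → φ (lab ends x w) ≡ φ w
    lab-inside ends [] φ h w = refl
    lab-inside ends (false ∷ x) φ h w = lab-inside (ends ∘ suc) x φ (h ∘ suc) w
    lab-inside ends (true ∷ x) φ h w with lab (ends ∘ suc) x w Finₚ.≟ lab (ends ∘ suc) x (proj₁ (ends zero))
    ... | no _ = lab-inside (ends ∘ suc) x φ (h ∘ suc) w
    ... | yes eq = trans (IH (proj₂ (ends zero))) (trans (sym (h zero refl)) (trans (sym (IH (proj₁ (ends zero)))) (trans (cong φ (sym eq)) (IH w))))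
      where IH = lab-inside (ends ∘ suc) x φ (h ∘ suc)

    -- Connectedness is the least equivalence relation containing the edges. Later, vertices are
    -- separated by exhibiting an invariant `φ` that tells them apart.
    lab-least : ∀ {m} (ends : Ends m) x {A : Set} (φ : Fin n → A) → Respects ends x φ → ∀ {u v} → lab ends x u ≡ lab ends x v → φ u ≡ φ v
    lab-least ends x φ h {u} {v} eq = trans (sym (lab-inside ends x φ h u)) (trans (cong φ eq) (lab-inside ends x φ h v))

    lab-idem : ∀ {m} (ends : Ends m) x w → lab ends x (lab ends x w) ≡ lab ends x w
    lab-idem ends x w = lab-inside ends x (lab ends x) (lab-respects ends x) w

    lab-mono : ∀ {m} (ends : Ends m) x y → x ⊑ y → ∀ {u v} → lab ends x u ≡ lab ends x v → lab ends y u ≡ lab ends y v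
    lab-mono ends x y x⊑y {u} {v} = lab-least ends x (lab ends y) λ k h → lab-respects ends y k (x⊑y k h)

    conn : ∀ {m} → Ends m → Vec Bool m → Fin n → Fin n → Bool
    conn ends x u v = lab ends x u == lab ends x v

    size : ∀ {m} → Ends m → Vec Bool m → Fin n → ℕ
    size ends x v = count (λ w → conn ends x w v)

    big : ∀ {m} → Ends m → ℕ → Vec Bool m → Fin n → Bool
    big ends L x v = leb L (size ends x v)

    #big : ∀ {m} → Ends m → ℕ → Vec Bool m → ℕ
    #big ends L x = count (big ends L x)

    #conn : ∀ {m} → Ends m → Vec Bool m → ℕ
    #conn ends x = sum (λ u → size ends x u)

    size-cong : ∀ {m} (ends : Ends m) x {u v} → lab ends x u ≡ lab ends x v → size ends x u ≡ size ends x v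
    size-cong ends x h rewrite h = refl

    size-mono : ∀ {m} (ends : Ends m) x y → x ⊑ y → ∀ v → size ends x v ≤ size ends y v
    size-mono ends x y x⊑y v = count-mono λ w h → ≡⇒== (lab-mono ends x y x⊑y (==⇒≡ h))

    big-mono : ∀ {m} (ends : Ends m) L x y → x ⊑ y → ∀ v → big ends L x v ≡ true → big ends L y v ≡ true
    big-mono ends L x y x⊑y v h = ≤⇒leb (≤-trans (leb⇒≤ h) (size-mono ends x y x⊑y v))

    -- All vertices of a large component are counted by `#big`, so such a component has at most
    -- `#big` vertices; any other vertex is connected to fewer than `L`. The second moment of `#big`
    -- therefore controls the connected pairs.
    #conn-≤ : ∀ {m} (ends : Ends m) L x → #conn ends x ≤ #big ends L x * #big ends L x + n * L
    #conn-≤ ends L x = ≤-trans (sum-mono pointwise) (≤-trans (≤-reflexive (∑-distrib-+ (λ u → bit (B u) * X) (λ _ → L)))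
      (+-mono-≤ (≤-reflexive (sym (trans (cong (_* X) (count-def B)) (sum-*ʳ (bit ∘ B) X)))) (sum-≤ {n} (λ _ → L) L (λ _ → ≤-refl))))
      where
      B = big ends L x
      X = #big ends L x
      pointwise : ∀ u → size ends x u ≤ bit (B u) * X + L
      pointwise u with leb L (size ends x u) in eq
      ... | true = ≤-trans (count-mono λ w e → trans (cong (leb L) (size-cong ends x (==⇒≡ e))) eq)
                     (≤-trans (≤-reflexive (sym (+-identityʳ X))) (m≤m+n (X + 0) L))
      ... | false = <⇒≤ (leb⇒> eq)

    module Toggle {m} (ends : Ends m) (x : Vec Bool m) (k : Fin m) where
      x₀ = x [ k ]≔ false
      x₁ = x [ k ]≔ true
      ℓ₀ = lab ends x₀
      ℓ₁ = lab ends x₁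
      a = proj₁ (ends k)
      b = proj₂ (ends k)

      only-k : ∀ j → j ≢ k → lookup x₁ j ≡ true → lookup x₀ j ≡ true
      only-k j j≢k h = trans (Vecₚ.lookup∘update′ j≢k x false) (trans (sym (Vecₚ.lookup∘update′ j≢k x true)) h)

      merge-respects : Respects ends x₁ (relabel ℓ₀ (a , b))
      merge-respects j h with j Finₚ.≟ k
      ... | yes refl = relabel-joins ℓ₀ (a , b)
      ... | no j≢k = relabel-cong ℓ₀ (a , b) (lab-respects ends x₀ j (only-k j j≢k h))

      -- Only the components of the two ends can change: `relabel ℓ₀ (a , b)` is an invariant of
      -- `x₁` and differs from `ℓ₀` only on the component of `a`.
      untouched : ∀ v → ℓ₀ v ≢ ℓ₀ a → ℓ₀ v ≢ ℓ₀ b → ∀ w → ℓ₁ w ≡ ℓ₁ v → ℓ₀ w ≡ ℓ₀ v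
      untouched v v≢a v≢b w h with lab-least ends x₁ (relabel ℓ₀ (a , b)) merge-respects h
      ... | eq rewrite ≢⇒== v≢a with ℓ₀ w Finₚ.≟ ℓ₀ a
      ...   | yes _ = ⊥-elim (v≢b (sym eq))
      ...   | no _ = eq

      #big-mono : ∀ L → #big ends L x₀ ≤ #big ends L x₁
      #big-mono L = count-mono (big-mono ends L x₀ x₁ (false⊑true x k))

      -- A vertex that becomes big was in the component of `a` or of `b`, and that component had
      -- fewer than `L` vertices. This bounded increment feeds the variance bound.
      #big-Lipschitz : ∀ L → #big ends L x₁ ≤ #big ends L x₀ + (L + L)
      #big-Lipschitz L = ≤-trans (count-mono {Q = λ v → B₀ v ∨ (S a v ∨ S b v)} pointwise)
        (≤-trans (count-∨ B₀ (λ v → S a v ∨ S b v)) (+-monoʳ-≤ (count B₀) (≤-trans (count-∨ (S a) (S b)) (+-mono-≤ (small a) (small b)))))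
        where
        B₀ = big ends L x₀
        S : Fin n → Fin n → Bool
        S c v = not (B₀ c) ∧ (ℓ₀ v == ℓ₀ c)
        small : ∀ c → count (S c) ≤ L
        small c with leb L (size ends x₀ c) in eq
        ... | true = ≤-trans (≤-reflexive (count-none {n} {λ _ → false} (λ _ → refl))) z≤n
        ... | false = <⇒≤ (leb⇒> eq)
        same-size : ∀ {v c} → ℓ₀ v ≡ ℓ₀ c → B₀ v ≡ false → B₀ c ≡ false
        same-size e h = trans (cong (leb L) (size-cong ends x₀ (sym e))) h
        pointwise : ∀ v → big ends L x₁ v ≡ true → B₀ v ∨ (S a v ∨ S b v) ≡ true
        pointwise v h with B₀ v in eq
        ... | true = refl
        ... | false with ℓ₀ v Finₚ.≟ ℓ₀ a
        ...   | yes va rewrite same-size va eq = refl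
        ...   | no v≢a with ℓ₀ v Finₚ.≟ ℓ₀ b
        ...     | yes vb rewrite same-size vb eq = 𝔹ₚ.∨-zeroʳ _
        ...     | no v≢b = ⊥-elim (<⇒≱ (leb⇒> eq) (≤-trans (leb⇒≤ h) (count-mono λ w e → ≡⇒== (untouched v v≢a v≢b w (==⇒≡ e)))))

      viol-mono : ∀ σ → viol ends x₀ σ ≤ viol ends x₁ σ
      viol-mono σ = count-mono λ j → ∧-monoˡ (agree σ (ends j)) (false⊑true x k j)
        where
        ∧-monoˡ : ∀ {a b} c → (a ≡ true → b ≡ true) → a ∧ c ≡ true → b ∧ c ≡ true
        ∧-monoˡ {true} c h e rewrite h refl = e

      viol-suc : ∀ σ → viol ends x₁ σ ≤ suc (viol ends x₀ σ)
      viol-suc σ = ≤-trans (count-mono {Q = λ j → (k == j) ∨ (lookup x₀ j ∧ agree σ (ends j))} pw)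
          (≤-trans (count-∨ (λ j → k == j) (λ j → lookup x₀ j ∧ agree σ (ends j))) (≤-reflexive (cong (_+ viol ends x₀ σ) (count-eq k))))
        where
        pw : ∀ j → lookup x₁ j ∧ agree σ (ends j) ≡ true → (k == j) ∨ (lookup x₀ j ∧ agree σ (ends j)) ≡ true
        pw j h with k Finₚ.≟ j
        ... | yes _ = refl
        ... | no k≢j rewrite Vecₚ.lookup∘update′ (λ e → k≢j (sym e)) x true | Vecₚ.lookup∘update′ (λ e → k≢j (sym e)) x false = h

      viol-free : ∀ σ τ → agree τ (ends k) ≡ false → (∀ j → lookup x₀ j ≡ true → agree τ (ends j) ≡ agree σ (ends j)) → viol ends x₁ τ ≤ viol ends x₀ σ
      viol-free σ τ hk h = count-mono pw
        where
        pw : ∀ j → lookup x₁ j ∧ agree τ (ends j) ≡ true → lookup x₀ j ∧ agree σ (ends j) ≡ true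
        pw j e with j Finₚ.≟ k
        ... | yes refl rewrite hk | 𝔹ₚ.∧-zeroʳ (lookup x₁ k) with e
        ...   | ()
        pw j e | no j≢k with lookup x₁ j in eq
        ...   | true rewrite only-k j j≢k eq = trans (sym (h j (only-k j j≢k eq))) e

      -- If the ends of the new edge lie in different components, flipping one of them absorbs the edge.
      viol-toggle : ∀ σ → ∃ λ τ → viol ends x₁ τ ≤ viol ends x₀ σ + bit (conn ends x₀ a b)
      viol-toggle σ with ℓ₀ a Finₚ.≟ ℓ₀ b
      ... | yes _ = σ , ≤-trans (viol-suc σ) (≤-reflexive (+-comm 1 _))
      ... | no a≢b with agree σ (ends k) in eq
      ...   | false = σ , ≤-trans (viol-free σ σ eq (λ _ _ → refl)) (≤-reflexive (sym (+-identityʳ _)))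
      ...   | true = τ , ≤-trans (viol-free σ τ τk τj) (≤-reflexive (sym (+-identityʳ _)))
        where
        τ : Fin n → Bool
        τ w = (ℓ₀ w == ℓ₀ a) xor σ w
        τk : agree τ (ends k) ≡ false
        τk rewrite ≡⇒== {i = ℓ₀ a} refl | ≢⇒== (λ e → a≢b (sym e)) with σ a | σ b
        ... | true | true = refl
        ... | false | false = refl
        τj : ∀ j → lookup x₀ j ≡ true → agree τ (ends j) ≡ agree σ (ends j)
        τj j h rewrite lab-respects ends x₀ j h with ℓ₀ (proj₂ (ends j)) == ℓ₀ a | σ (proj₁ (ends j)) | σ (proj₂ (ends j))
        ... | true | true | true = refl
        ... | true | true | false = refl
        ... | true | false | true = refl
        ... | true | false | false = refl
        ... | false | _ | _ = refl

  open Multigraph public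

  -- Potential edges and the distance from bipartiteness

  ∧-introˡ : ∀ {a b} → a ≡ true → b ≡ true → a ∧ b ≡ true
  ∧-introˡ refl refl = refl

  ∧-elim : ∀ {a b} → a ∧ b ≡ true → a ≡ true × b ≡ true
  ∧-elim {true} {true} _ = refl , refl

  opaque
    unfolding count
    count-∃ : ∀ {n} {P : Fin n → Bool} → 1 ≤ count P → ∃ λ i → P i ≡ true
    count-∃ {suc n} {P} h with P zero in eq
    ... | true = zero , eq
    ... | false with count-∃ {n} {P ∘ suc} h
    ...   | i , e = suc i , e

  count-unique : ∀ {n} {P : Fin n → Bool} → count P ≤ 1 → ∀ {i j} → P i ≡ true → P j ≡ true → i ≡ j
  count-unique {n} {P} h {i} {j} pi pj with i Finₚ.≟ j
  ... | yes e = e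
  ... | no i≢j = ⊥-elim (<⇒≱ (s≤s (≤-refl {1})) (≤-trans (≤-trans (≤-reflexive (cong suc (sym (count-eq i))))
          (count-strict {P = i ==_} {P} j (≢⇒== i≢j) pj (λ k e → subst (λ t → P t ≡ true) (==⇒≡ e) pi))) h))

  listCount : ∀ {A : Set} → (A → Bool) → List A → ℕ
  listCount h [] = 0
  listCount h (x ∷ xs) = bit (h x) + listCount h xs

  listCount-lookup : ∀ {A : Set} (h : A → Bool) xs → count (λ k → h (List.lookup xs k)) ≡ listCount h xs
  listCount-lookup h [] = count-none {0} (λ ())
  listCount-lookup h (x ∷ xs) = trans (count-suc (λ k → h (List.lookup (x ∷ xs) k))) (cong (bit (h x) +_) (listCount-lookup h xs))

  listCount-++ : ∀ {A : Set} (h : A → Bool) xs ys → listCount h (xs ++ ys) ≡ listCount h xs + listCount h ys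
  listCount-++ h [] ys = refl
  listCount-++ h (x ∷ xs) ys = trans (cong (bit (h x) +_) (listCount-++ h xs ys)) (sym (+-assoc (bit (h x)) _ _))

  listCount-map : ∀ {A B : Set} (h : B → Bool) (f : A → B) xs → listCount h (map f xs) ≡ listCount (h ∘ f) xs
  listCount-map h f [] = refl
  listCount-map h f (x ∷ xs) = cong (bit (h (f x)) +_) (listCount-map h f xs)

  listCount-filter : ∀ {A : Set} (h : A → Bool) {P : A → Set} (P? : Decidable P) xs → listCount h (filter P? xs) ≡ listCount (λ x → does (P? x) ∧ h x) xs
  listCount-filter h P? [] = refl
  listCount-filter h P? (x ∷ xs) with does (P? x)
  ... | true = cong (bit (h x) +_) (listCount-filter h P? xs)
  ... | false = listCount-filter h P? xs

  listCount-tabulate : ∀ {A : Set} {n} (h : A → Bool) (g : Fin n → A) → listCount h (List.tabulate g) ≡ count (h ∘ g)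
  listCount-tabulate {n = zero} h g = sym (count-none {0} (λ ()))
  listCount-tabulate {n = suc n} h g = trans (cong (bit (h (g zero)) +_) (listCount-tabulate h (g ∘ suc))) (sym (count-suc (h ∘ g)))

  listCount-concatMap : ∀ {A B : Set} {n} (h : B → Bool) (f : A → List B) (g : Fin n → A) →
    listCount h (concatMap f (List.tabulate g)) ≡ sum (λ j → listCount h (f (g j)))
  listCount-concatMap {n = zero} h f g = refl
  listCount-concatMap {n = suc n} h f g = trans (listCount-++ h (f (g zero)) (concatMap f (List.tabulate (g ∘ suc))))
    (cong (listCount h (f (g zero)) +_) (listCount-concatMap h f (g ∘ suc)))

  _<ᶠ_ : ∀ {n} → Fin n → Fin n → Bool
  i <ᶠ j = does (toℕ i <? toℕ j)

  module Pairs (n : ℕ) where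
    #pairs : ℕ
    #pairs = length (pairs n)

    ends : Ends {n} #pairs
    ends = List.lookup (pairs n)

    count-pairs : ∀ (h : Fin n × Fin n → Bool) → count (h ∘ ends) ≡ sum (λ j → count (λ i → (i <ᶠ j) ∧ h (i , j)))
    count-pairs h = trans (listCount-lookup h (pairs n)) (trans (listCount-concatMap {n = n} h (λ j → map (λ i → (i , j)) (filter (λ i → toℕ i <? toℕ j) (allFin n))) (λ j → j)) (sum-cong-≗ {n} λ j →
      trans (listCount-map h (λ i → (i , j)) (filter (λ i → toℕ i <? toℕ j) (allFin n)))
        (trans (listCount-filter (λ i → h (i , j)) (λ i → toℕ i <? toℕ j) (allFin n)) (listCount-tabulate (λ i → (i <ᶠ j) ∧ h (i , j)) (λ i → i)))))

    count-pairs-≤ : ∀ (h : Fin n × Fin n → Bool) → count (h ∘ ends) ≤ sum (λ j → count (λ i → h (i , j)))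
    count-pairs-≤ h = ≤-trans (≤-reflexive (count-pairs h)) (sum-mono {n} λ j → count-mono λ i e → proj₂ (∧-elim {i <ᶠ j} e))

    #pairs-≤ : #pairs ≤ n * n
    #pairs-≤ = ≤-trans (≤-reflexive (sym (trans (count-def (λ (k : Fin #pairs) → true)) (ones #pairs))))
      (≤-trans (count-pairs-≤ (λ _ → true)) (sum-≤ {n} _ n λ j → count-≤ {n} (λ _ → true)))
      where
      ones : ∀ m → sum {m} (λ _ → 1) ≡ m
      ones zero = refl
      ones (suc m) = cong suc (ones m)

    -- An ordered pair off the diagonal is one of the two orientations of a listed pair; the
    -- diagonal accounts for the extra `n`.
    count-pairs-≥ : ∀ (h : Fin n × Fin n → Bool) → (∀ i j → h (i , j) ≡ h (j , i)) →
      sum (λ j → count (λ i → h (i , j))) ≤ count (h ∘ ends) + count (h ∘ ends) + n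
    count-pairs-≥ h h-sym = begin
      sum (λ j → count (λ i → h (i , j)))
        ≤⟨ sum-mono (λ j → ≤-trans (count-mono (split j)) (≤-trans (count-∨ (λ i → below i j ∨ above i j) (λ i → j == i))
             (+-mono-≤ (count-∨ (λ i → below i j) (λ i → above i j)) (≤-reflexive (count-eq j))))) ⟩
      sum (λ j → count (λ i → below i j) + count (λ i → above i j) + 1)
        ≡⟨ trans (∑-distrib-+ (λ j → count (λ i → below i j) + count (λ i → above i j)) (λ _ → 1))
                 (cong (_+ sum {n} (λ _ → 1)) (∑-distrib-+ (λ j → count (λ i → below i j)) (λ j → count (λ i → above i j)))) ⟩
      sum (λ j → count (λ i → below i j)) + sum (λ j → count (λ i → above i j)) + sum {n} (λ _ → 1)
        ≤⟨ +-mono-≤ (≤-reflexive (cong₂ _+_ (sym (count-pairs h)) (trans swap (sym (count-pairs h))))) (≤-trans (sum-≤ {n} (λ _ → 1) 1 (λ _ → ≤-refl)) (≤-reflexive (*-identityʳ n))) ⟩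
      count (h ∘ ends) + count (h ∘ ends) + n ∎
      where
      open ≤-Reasoning
      below above : Fin n → Fin n → Bool
      below i j = (i <ᶠ j) ∧ h (i , j)
      above i j = (j <ᶠ i) ∧ h (j , i)
      split : ∀ j i → h (i , j) ≡ true → (below i j ∨ above i j) ∨ (j == i) ≡ true
      split j i e with Finₚ.<-cmp i j
      ... | tri< i<j _ _ rewrite dec-true (toℕ i <? toℕ j) i<j | e = refl
      ... | tri≈ _ refl _ rewrite ≡⇒== {i = i} refl = 𝔹ₚ.∨-zeroʳ _
      ... | tri> _ _ j<i rewrite dec-true (toℕ j <? toℕ i) j<i | trans (h-sym j i) e = cong (_∨ (j == i)) (𝔹ₚ.∨-zeroʳ (below i j))
      swap : sum (λ j → count (λ i → above i j)) ≡ sum (λ j → count (λ i → below i j))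
      swap = trans (sum-cong-≗ λ j → count-def (λ i → above i j)) (trans (∑-comm (λ j i → bit (above i j))) (sym (sum-cong-≗ λ j → count-def (λ i → below i j))))

    is : Fin n → Fin n → Fin n × Fin n → Bool
    is a b (i , j) = (a == i) ∧ (b == j)

    is⇒≡ : ∀ {a b} e → is a b e ≡ true → e ≡ (a , b)
    is⇒≡ {a} (i , j) h with ∧-elim {a == i} h
    ... | p , q = cong₂ _,_ (sym (==⇒≡ p)) (sym (==⇒≡ q))

    ≡⇒is : ∀ {a b} e → e ≡ (a , b) → is a b e ≡ true
    ≡⇒is {a} {b} e refl = ∧-introˡ (≡⇒== {i = a} refl) (≡⇒== {i = b} refl)

    -- By counting, without looking into the nested list: the double count shows that at most one
    -- position carries a given pair of ends.
    ends-injective : ∀ {k k′} → ends k ≡ ends k′ → k ≡ k′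
    ends-injective {k} {k′} e = count-unique {P = is a b ∘ ends} (≤-trans (count-pairs-≤ (is a b)) (≤-trans (sum-mono {n} bound) (≤-reflexive (trans (sym (count-def (b ==_))) (count-eq b)))))
        (≡⇒is (ends k) refl) (≡⇒is (ends k′) (sym e))
      where
      a = proj₁ (ends k)
      b = proj₂ (ends k)
      bound : ∀ j → count (λ i → is a b (i , j)) ≤ bit (b == j)
      bound j with b == j
      ... | true = ≤-trans (count-mono {Q = a ==_} λ i e → proj₁ (∧-elim {a == i} e)) (≤-reflexive (count-eq a))
      ... | false = ≤-reflexive (count-none λ i → 𝔹ₚ.∧-zeroʳ (a == i))

    position : ∀ {i j} → i Fin.< j → ∃ λ k → ends k ≡ (i , j)
    position {i} {j} i<j with count-∃ {P = is i j ∘ ends} (≤-trans (≤-trans one (sum-single _ j)) (≤-reflexive (sym (count-pairs (is i j)))))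
      where
      one : 1 ≤ count (λ i′ → (i′ <ᶠ j) ∧ is i j (i′ , j))
      one = count-single i (∧-introˡ (dec-true (toℕ i <? toℕ j) i<j) (≡⇒is (i , j) refl))
    ... | k , e = k , is⇒≡ (ends k) e

    ends-ordered : ∀ k → proj₁ (ends k) Fin.< proj₂ (ends k)
    ends-ordered k with proj₁ (ends k) <ᶠ proj₂ (ends k) in eq
    ... | true = does-true (toℕ (proj₁ (ends k)) <? toℕ (proj₂ (ends k))) eq
    ... | false = ⊥-elim (<⇒≱ (s≤s z≤n) (≤-trans (count-single {P = unordered ∘ ends} k (cong not eq))
        (≤-trans (≤-reflexive (count-pairs unordered)) (≤-reflexive (sum-zero {n} λ j → count-none λ i → 𝔹ₚ.∧-inverseʳ (i <ᶠ j))))))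
      where
      unordered : Fin n × Fin n → Bool
      unordered (i , j) = not (i <ᶠ j)

    edge : (a b : Fin n) → a ≢ b → Fin #pairs
    edge a b a≢b with Finₚ.<-cmp a b
    ... | tri< a<b _ _ = proj₁ (position a<b)
    ... | tri≈ _ a≡b _ = ⊥-elim (a≢b a≡b)
    ... | tri> _ _ b<a = proj₁ (position b<a)

    edge-ends : ∀ a b a≢b → ends (edge a b a≢b) ≡ (a , b) ⊎ ends (edge a b a≢b) ≡ (b , a)
    edge-ends a b a≢b with Finₚ.<-cmp a b
    ... | tri< a<b _ _ = inj₁ (proj₂ (position a<b))
    ... | tri≈ _ a≡b _ = ⊥-elim (a≢b a≡b)
    ... | tri> _ _ b<a = inj₂ (proj₂ (position b<a))

    -- A present edge is either cut or monochromatic. The list `es` replaces `pairs n` so that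
    -- induction is possible.
    split-edges : ∀ (es : List (Fin n × Fin n)) (v : Vec Bool (length es)) σ → let L = map proj₁ (filter (λ e → Data.Bool._≟_ (proj₂ e) true) (zip es (toList v))) in
      length L ≡ countTrue (map (λ e → σ (proj₁ e) xor σ (proj₂ e)) L) + viol (List.lookup es) v σ
    split-edges [] [] σ = sym (count-none {0} (λ ()))
    split-edges (e ∷ es) (b ∷ v) σ = trans (head b (σ (proj₁ e) xor σ (proj₂ e)) refl)
        (cong (countTrue (map (λ e → σ (proj₁ e) xor σ (proj₂ e)) (map proj₁ (filter (λ e → Data.Bool._≟_ (proj₂ e) true) (zip (e ∷ es) (toList (b ∷ v)))))) +_)
          (sym (count-suc (λ k → lookup (b ∷ v) k ∧ agree σ (List.lookup (e ∷ es) k)))))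
      where
      V = viol (List.lookup es) v σ
      IH = split-edges es v σ
      head : ∀ b c → c ≡ σ (proj₁ e) xor σ (proj₂ e) → let L = map proj₁ (filter (λ e → Data.Bool._≟_ (proj₂ e) true) (zip (e ∷ es) (toList (b ∷ v)))) in
        length L ≡ countTrue (map (λ e → σ (proj₁ e) xor σ (proj₂ e)) L) + (bit (b ∧ not (σ (proj₁ e) xor σ (proj₂ e))) + V)
      head false c eq = IH
      head true c eq with σ (proj₁ e) xor σ (proj₂ e)
      ... | true = cong suc IH
      ... | false = trans (cong suc IH) (sym (+-suc _ V))

    cut+viol : ∀ (g : Graph n) σ → length (edges {n} g) ≡ cutSize {n} g σ + viol ends g σ
    cut+viol g σ = split-edges (pairs n) g σ

    private
      foldr-max-≥ : ∀ {A : Set} (f : A → ℕ) {x : A} xs → x ∈ xs → f x ≤ foldr _⊔_ 0 (map f xs)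
      foldr-max-≥ f (x ∷ xs) (here refl) = m≤m⊔n (f x) _
      foldr-max-≥ f (y ∷ xs) (there p) = ≤-trans (foldr-max-≥ f xs p) (m≤n⊔m (f y) _)

      foldr-max-attained : ∀ {A : Set} (f : A → ℕ) (d : A) xs → ∃ λ x → foldr _⊔_ 0 (map f xs) ≤ f x
      foldr-max-attained f d [] = d , z≤n
      foldr-max-attained f d (y ∷ xs) with foldr-max-attained f d xs | ≤-total (f y) (foldr _⊔_ 0 (map f xs))
      ... | x , h | inj₁ le = x , ≤-trans (≤-reflexive (m≤n⇒m⊔n≡n le)) h
      ... | x , h | inj₂ ge = y , ≤-reflexive (m≥n⇒m⊔n≡m ge)

      ∈-allVecs : ∀ {m} (v : Vec Bool m) → v ∈ allVecs m
      ∈-allVecs [] = here refl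
      ∈-allVecs (true ∷ v) = ∈-concatMap⁺ _ (Any.map (λ { refl → here refl }) (∈-allVecs v))
      ∈-allVecs (false ∷ v) = ∈-concatMap⁺ _ (Any.map (λ { refl → there (here refl) }) (∈-allVecs v))

    -- The number of edges minus the cut size is `viol`. Since `maxCut` ranges over vectors, `σ` is
    -- tabulated before it is compared with the maximum.
    distBP-≤ : ∀ (g : Graph n) σ → distBP {n} g ≤ viol ends g σ
    distBP-≤ g σ = ≤-trans (∸-monoʳ-≤ (length (edges {n} g)) (≤-trans (≤-reflexive same) (foldr-max-≥ (λ v → cutSize {n} g (lookup v)) (allVecs n) (∈-allVecs (tabulate σ)))))
       (≤-reflexive (trans (cong (_∸ cutSize {n} g σ) (cut+viol g σ)) (m+n∸m≡n (cutSize {n} g σ) _)))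
      where
      same : cutSize {n} g σ ≡ cutSize {n} g (lookup (tabulate σ))
      same = cong countTrue (Listₚ.map-cong (λ e → cong₂ _xor_ (sym (Vecₚ.lookup∘tabulate σ (proj₁ e))) (sym (Vecₚ.lookup∘tabulate σ (proj₂ e)))) (edges {n} g))

    distBP-attained : ∀ (g : Graph n) → ∃ λ σ → viol ends g σ ≤ distBP {n} g
    distBP-attained g with foldr-max-attained (λ v → cutSize {n} g (lookup v)) (Vec.replicate n true) (allVecs n)
    ... | v , h = lookup v , ≤-trans (≤-reflexive (sym (trans (cong (_∸ cutSize {n} g (lookup v)) (cut+viol g (lookup v))) (m+n∸m≡n (cutSize {n} g (lookup v)) _)))) (∸-monoʳ-≤ (length (edges {n} g)) h)

  -- Cutting a spanning forest into blocks

  opaque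
    _≡?_ : ℕ → ℕ → Bool
    a ≡? b = does (a ≟ b)

    ≡?⇒≡ : ∀ {a b} → (a ≡? b) ≡ true → a ≡ b
    ≡?⇒≡ {a} {b} = does-true (a ≟ b)

    ≡⇒≡? : ∀ {a b} → a ≡ b → (a ≡? b) ≡ true
    ≡⇒≡? {a} {b} = dec-true (a ≟ b)

    ≢⇒≡? : ∀ {a b} → a ≢ b → (a ≡? b) ≡ false
    ≢⇒≡? {a} {b} = dec-false (a ≟ b)

    ≡?⇒≢ : ∀ {a b} → (a ≡? b) ≡ false → a ≢ b
    ≡?⇒≢ {a} {b} = does-false (a ≟ b)

  count-partition : ∀ {n k} (P : Fin n → Bool) (f : Fin n → Fin k) → count P ≡ sum (λ w → count (λ v → P v ∧ (f v == w)))
  count-partition {n} {k} P f = trans (count-def P) (trans (sum-cong-≗ {n} row)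
      (trans (∑-comm (λ v w → bit (P v ∧ (f v == w)))) (sym (sum-cong-≗ {k} λ w → count-def (λ v → P v ∧ (f v == w))))))
    where
    row : ∀ v → bit (P v) ≡ sum (λ w → bit (P v ∧ (f v == w)))
    row v with P v
    ... | true = sym (trans (sym (count-def (λ w → f v == w))) (count-eq (f v)))
    ... | false = sym (sum-zero {k} (λ _ → refl))

  count-all : ∀ n → count {n} (λ _ → true) ≡ n
  count-all zero = count-none {0} (λ ())
  count-all (suc n) = trans (count-suc (λ _ → true)) (cong suc (count-all n))

  count-not : ∀ {n} (P : Fin n → Bool) → count P + count (λ i → not (P i)) ≡ n
  count-not {zero} P = cong₂ _+_ (count-none {0} {P} (λ ())) (count-none {0} {λ i → not (P i)} (λ ()))
  count-not {suc n} P = trans (cong₂ _+_ (count-suc P) (count-suc (λ i → not (P i)))) (lem (P zero) (count-not (P ∘ suc)))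
    where
    lem : ∀ b {x y} → x + y ≡ n → (bit b + x) + (bit (not b) + y) ≡ suc n
    lem true e = cong suc e
    lem false {x} {y} e = trans (+-suc x y) (cong suc e)

  rename : ℕ → ℕ → ℕ → ℕ
  rename a b c = if c ≡? a then b else c

  rename-hit : ∀ {a b c} → c ≡ a → rename a b c ≡ b
  rename-hit {a} {b} {c} e rewrite ≡⇒≡? e = refl

  rename-miss : ∀ {a b c} → c ≢ a → rename a b c ≡ c
  rename-miss e rewrite ≢⇒≡? e = refl

  rename⁻¹ : ∀ {a b c d} → rename a b c ≡ d → d ≢ b → c ≡ d
  rename⁻¹ {a} {b} {c} e d≢b with c ≡? a
  ... | true = ⊥-elim (d≢b (sym e))
  ... | false = e

  agree-swap : ∀ {n} (σ : Fin n → Bool) i j → agree σ (i , j) ≡ agree σ (j , i)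
  agree-swap σ i j = cong not (𝔹ₚ.xor-comm (σ i) (σ j))

  module Decomposition {n m} (ends : Ends {n} m) (x : Vec Bool m) (K : ℕ) (0<K : 1 < K) where

    ℓ = lab ends x

    seen : List (Fin n × Fin n) → Fin n → Bool
    seen [] v = ℓ v == v
    seen ((u , w) ∷ es) v = (u == v) ∨ seen es v

    Edge : Fin n → Fin n → Set
    Edge u w = ∃ λ k → lookup x k ≡ true × (ends k ≡ (u , w) ⊎ ends k ≡ (w , u))

    -- Rooted at the labels, and listed from the most recently added leaf to the oldest.
    data Forest : List (Fin n × Fin n) → Set where
      []   : Forest []
      grow : ∀ {es u w} → Forest es → seen es w ≡ true → seen es u ≡ false → Edge u w → Forest ((u , w) ∷ es)

    seen-root : ∀ es v → (ℓ v == v) ≡ true → seen es v ≡ true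
    seen-root [] v h = h
    seen-root ((u , w) ∷ es) v h rewrite seen-root es v h = 𝔹ₚ.∨-zeroʳ (u == v)

    Spanning : Set
    Spanning = ∃ λ es → Forest es × (∀ v → seen es v ≡ true)

    -- The fuel `f` bounds the number of unseen vertices, and each extension uses one up. When no
    -- present edge leaves the seen set, `seen es` is constant on components, and it holds at every
    -- root.
    spanning : ∀ f es → Forest es → count (not ∘ seen es) ≤ f → Spanning
    extend : ∀ f es → Forest es → count (not ∘ seen es) ≤ f → ∀ u w → seen es w ≡ true → seen es u ≡ false → Edge u w → Spanning

    spanning f es F h with Finₚ.any? (λ k → (lookup x k 𝔹ₚ.≟ true) ×-dec ¬? (seen es (proj₁ (ends k)) 𝔹ₚ.≟ seen es (proj₂ (ends k))))
    ... | no none = es , F , λ v → trans (sym (lab-inside ends x (seen es) respects v)) (seen-root es (ℓ v) (≡⇒== (lab-idem ends x v)))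
      where
      respects : Respects ends x (seen es)
      respects k on with seen es (proj₁ (ends k)) 𝔹ₚ.≟ seen es (proj₂ (ends k))
      ... | yes e = e
      ... | no ne = ⊥-elim (none (k , on , ne))
    ... | yes (k , on , ne) with seen es (proj₁ (ends k)) in e₁ | seen es (proj₂ (ends k)) in e₂
    ...   | true | true = ⊥-elim (ne refl)
    ...   | false | false = ⊥-elim (ne refl)
    ...   | true | false = extend f es F h (proj₂ (ends k)) (proj₁ (ends k)) e₁ e₂ (k , on , inj₂ refl)
    ...   | false | true = extend f es F h (proj₁ (ends k)) (proj₂ (ends k)) e₂ e₁ (k , on , inj₁ refl)

    extend zero es F h u w sw su e = ⊥-elim (<⇒≱ (s≤s z≤n) (≤-trans (count-single {P = not ∘ seen es} u (cong not su)) h))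
    extend (suc f) es F h u w sw su e = spanning f ((u , w) ∷ es) (grow F sw su e) (≤-pred (≤-trans (count-strict {P = not ∘ seen ((u , w) ∷ es)} {not ∘ seen es} u
        (cong (λ b → not (b ∨ seen es u)) (≡⇒== {i = u} refl)) (cong not su) (λ v q → drop (u == v) q)) h))
      where
      drop : ∀ a {b} → not (a ∨ b) ≡ true → not b ≡ true
      drop false q = q

    treeViol : (Fin n → Bool) → List (Fin n × Fin n) → ℕ
    treeViol σ = listCount (agree σ)

    seen-grow : ∀ es u w a b {r} → (seen es a ∧ seen es b) ∧ r ≡ true → (seen ((u , w) ∷ es) a ∧ seen ((u , w) ∷ es) b) ∧ r ≡ true
    seen-grow es u w a b h with ∧-elim {seen es a ∧ seen es b} h
    ... | q , r with ∧-elim {seen es a} q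
    ...   | s₁ , s₂ rewrite s₁ | s₂ = ∧-introˡ (∧-introˡ (𝔹ₚ.∨-zeroʳ (u == a)) (𝔹ₚ.∨-zeroʳ (u == b))) r

    -- Distinct forest edges have to be charged to distinct positions. Counting only positions with
    -- both ends seen ensures this: the newest edge has the end `u`, which was unseen until then.
    treeViol-≤ : ∀ σ {es} → Forest es → treeViol σ es ≤ count (λ k → (seen es (proj₁ (ends k)) ∧ seen es (proj₂ (ends k))) ∧ (lookup x k ∧ agree σ (ends k)))
    treeViol-≤ σ [] = z≤n
    treeViol-≤ σ (grow {es} {u} {w} F sw su (k , on , e)) with agree σ (u , w) in eq
    ... | true = ≤-trans (s≤s (treeViol-≤ σ F)) (count-strict {P = old} {new} k (old-k e) (∧-introˡ (new-k e) (∧-introˡ on (agree-k e))) (λ j → seen-grow es u w (proj₁ (ends j)) (proj₂ (ends j))))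
      where
      old new : _ → Bool
      old k = (seen es (proj₁ (ends k)) ∧ seen es (proj₂ (ends k))) ∧ (lookup x k ∧ agree σ (ends k))
      new k = (seen ((u , w) ∷ es) (proj₁ (ends k)) ∧ seen ((u , w) ∷ es) (proj₂ (ends k))) ∧ (lookup x k ∧ agree σ (ends k))
      old-k : ends k ≡ (u , w) ⊎ ends k ≡ (w , u) → old k ≡ false
      old-k (inj₁ e) rewrite e | su = refl
      old-k (inj₂ e) rewrite e | su | 𝔹ₚ.∧-zeroʳ (seen es w) = refl
      new-k : ends k ≡ (u , w) ⊎ ends k ≡ (w , u) → seen ((u , w) ∷ es) (proj₁ (ends k)) ∧ seen ((u , w) ∷ es) (proj₂ (ends k)) ≡ true
      new-k (inj₁ e) rewrite e | sw | ≡⇒== {i = u} refl = 𝔹ₚ.∨-zeroʳ (u == w)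
      new-k (inj₂ e) rewrite e | sw | ≡⇒== {i = u} refl | 𝔹ₚ.∨-zeroʳ (u == w) = refl
      agree-k : ends k ≡ (u , w) ⊎ ends k ≡ (w , u) → agree σ (ends k) ≡ true
      agree-k (inj₁ e) = trans (cong (agree σ) e) eq
      agree-k (inj₂ e) = trans (cong (agree σ) e) (trans (agree-swap σ w u) eq)
    ... | false = ≤-trans (treeViol-≤ σ F) (count-mono λ j → seen-grow es u w (proj₁ (ends j)) (proj₂ (ends j)))

    group : (Fin n → ℕ) → ℕ → ℕ
    group loc a = count (λ v → loc v ≡? a)

    -- loc v is the current block of v: a number w < n marks the open block hanging at the vertex w, a number n + j the j-th closed block.
    -- As long as its block is not spoiled, the colour of v is recovered from τ v and one colour per block.
    record Blocks (V : (Fin n → Bool) → ℕ) (es : List (Fin n × Fin n)) : Set where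
      field
        loc : Fin n → ℕ
        J : ℕ
        τ : Fin n → Bool
        open-small : ∀ a → a < n → group loc a < K
        closed-large : ∀ j → j < J → K ≤ group loc (n + j)
        closed-small : ∀ j → j < J → group loc (n + j) ≤ K + K
        range : ∀ v → loc v < n + J
        pending : ∀ v w → loc v ≡ toℕ w → seen es w ≡ true
        inside : ∀ v w → loc v ≡ toℕ w → ℓ v ≡ ℓ w
        colour : ∀ σ → ∃₂ λ (c : ℕ → Bool) (Bad : List ℕ) → length Bad + treeViol σ es ≤ V σ ×
          (∀ w → c (toℕ w) ≡ σ w) × (∀ v → loc v ∉ Bad → σ v ≡ τ v xor c (loc v))

    edge-ℓ : ∀ {u w} → Edge u w → ℓ u ≡ ℓ w
    edge-ℓ (k , on , inj₁ e) = subst (λ z → ℓ (proj₁ z) ≡ ℓ (proj₂ z)) e (lab-respects ends x k on)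
    edge-ℓ (k , on , inj₂ e) = sym (subst (λ z → ℓ (proj₁ z) ≡ ℓ (proj₂ z)) e (lab-respects ends x k on))

    low≢high : ∀ (w : Fin n) j → toℕ w ≢ n + j
    low≢high w j e = <⇒≱ (Finₚ.toℕ<n w) (≤-trans (m≤m+n n j) (≤-reflexive (sym e)))

    -- The leaf `u` is removed and its open block is handed to the parent `w`, where it joins the
    -- block already hanging there. Both have fewer than `K` vertices, so a union that is closed as
    -- soon as it reaches `K` stays within `K + K`.
    module Step {V es u w} (sw : seen es w ≡ true) (su : seen es u ≡ false) (e : Edge u w) (B : Blocks V ((u , w) ∷ es)) where
      open Blocks B
      U W : ℕ
      U = toℕ u
      W = toℕ w

      loc′ : Fin n → ℕ
      loc′ v = rename U W (loc v)
      τ′ : Fin n → Bool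
      τ′ v = (loc v ≡? U) xor τ v

      loc′-old : ∀ v a → loc′ v ≡ a → a ≢ W → loc v ≡ a
      loc′-old v a h a≢W = rename⁻¹ h a≢W

      group-other : ∀ a → a ≢ W → group loc′ a ≤ group loc a
      group-other a a≢W = count-mono λ v h → ≡⇒≡? (loc′-old v a (≡?⇒≡ h) a≢W)

      group-keep : ∀ a → a ≢ U → group loc a ≤ group loc′ a
      group-keep a a≢U = count-mono λ v h → ≡⇒≡? (trans (rename-miss (λ q → a≢U (trans (sym (≡?⇒≡ h)) q))) (≡?⇒≡ h))

      group-W : group loc′ W ≤ K + K
      group-W = ≤-trans (count-mono {Q = λ v → (loc v ≡? U) ∨ (loc v ≡? W)} pw) (≤-trans (count-∨ (λ v → loc v ≡? U) (λ v → loc v ≡? W))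
          (+-mono-≤ (<⇒≤ (open-small U (Finₚ.toℕ<n u))) (<⇒≤ (open-small W (Finₚ.toℕ<n w)))))
        where
        pw : ∀ v → (loc′ v ≡? W) ≡ true → (loc v ≡? U) ∨ (loc v ≡? W) ≡ true
        pw v h with loc v ≡? U
        ... | true = refl
        ... | false = h

      range′ : ∀ v → loc′ v < n + J
      range′ v with loc v ≡? U
      ... | true = ≤-trans (Finₚ.toℕ<n w) (m≤m+n n J)
      ... | false = range v

      pending′ : ∀ v z → loc′ v ≡ toℕ z → seen es z ≡ true
      pending′ v z h with loc v ≡? U in eq
      ... | true rewrite sym (Finₚ.toℕ-injective h) = sw
      ... | false with pending v z h
      ...   | q rewrite ≢⇒== {i = u} {z} (λ u≡z → ≡?⇒≢ eq (trans h (cong toℕ (sym u≡z)))) = q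

      inside′ : ∀ v z → loc′ v ≡ toℕ z → ℓ v ≡ ℓ z
      inside′ v z h with loc v ≡? U in eq
      ... | true rewrite sym (Finₚ.toℕ-injective h) = trans (inside v u (≡?⇒≡ eq)) (edge-ℓ e)
      ... | false = inside v z h

      -- If `σ` cuts the edge, then `σ u` is opposite to `σ w`, and flipping `τ` on the block of `u`
      -- refers its colours to `w`. If `σ` violates it, the merged block is declared bad, and the
      -- violated edge, which now leaves `treeViol`, pays for the new entry of `Bad`.
      colour′ : ∀ σ → ∃₂ λ (c : ℕ → Bool) (Bad : List ℕ) → length Bad + treeViol σ es ≤ V σ ×
          (∀ w → c (toℕ w) ≡ σ w) × (∀ v → loc′ v ∉ Bad → σ v ≡ τ′ v xor c (loc′ v))
      colour′ σ with colour σ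
      ... | c , Bad , len , cw , cv with agree σ (u , w) in eq
      ...   | true = c , W ∷ map (rename U W) Bad , ≤-trans (≤-reflexive (trans (cong (λ k → suc k + treeViol σ es) (Listₚ.length-map (rename U W) Bad)) (sym (+-suc (length Bad) _)))) len , cw , rule
        where
        rule : ∀ v → loc′ v ∉ W ∷ map (rename U W) Bad → σ v ≡ τ′ v xor c (loc′ v)
        rule v h with cv v (λ q → h (there (∈-map⁺ (rename U W) q)))
        ... | q with loc v ≡? U
        ...   | true = ⊥-elim (h (here refl))
        ...   | false = q
      ...   | false = c , map (rename U W) Bad , ≤-trans (≤-reflexive (cong (_+ treeViol σ es) (Listₚ.length-map (rename U W) Bad))) len , cw , rule
        where
        flip : ∀ a b c d → a ≡ b xor c → not (c xor d) ≡ false → a ≡ (true xor b) xor d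
        flip true true false true refl _ = refl
        flip true false true false refl _ = refl
        flip false true true false refl _ = refl
        flip false false false true refl _ = refl
        rule : ∀ v → loc′ v ∉ map (rename U W) Bad → σ v ≡ τ′ v xor c (loc′ v)
        rule v h with cv v (λ q → h (∈-map⁺ (rename U W) q))
        ... | q with loc v ≡? U in eqv
        ...   | false = q
        ...   | true rewrite cw w = flip (σ v) (τ v) (σ u) (σ w) (trans q (cong (τ v xor_) (trans (cong c (≡?⇒≡ eqv)) (cw u)))) eq

      loc″ : Fin n → ℕ
      loc″ v = rename W (n + J) (loc′ v)

      next : Blocks V es
      next with leb K (group loc′ W) in eq
      ... | false = record
        { loc = loc′ ; J = J ; τ = τ′
        ; open-small = λ a a<n → small a a<n
        ; closed-large = λ j j<J → ≤-trans (closed-large j j<J) (group-keep (n + j) (λ q → low≢high u j (sym q)))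
        ; closed-small = λ j j<J → ≤-trans (group-other (n + j) (λ q → low≢high w j (sym q))) (closed-small j j<J)
        ; range = range′ ; pending = pending′ ; inside = inside′ ; colour = colour′ }
        where
        small : ∀ a → a < n → group loc′ a < K
        small a a<n with a ≟ W
        ... | yes refl = leb⇒> eq
        ... | no a≢W = ≤-trans (s≤s (group-other a a≢W)) (open-small a a<n)
      ... | true = record
        { loc = loc″ ; J = suc J ; τ = τ′
        ; open-small = small
        ; closed-large = large
        ; closed-small = upper
        ; range = range″ ; pending = λ v z h → pending′ v z (old v z h) ; inside = λ v z h → inside′ v z (old v z h) ; colour = colour″ }
        where
        old : ∀ v (z : Fin n) → loc″ v ≡ toℕ z → loc′ v ≡ toℕ z
        old v z h = rename⁻¹ h (low≢high z J)
        small : ∀ a → a < n → group loc″ a < K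
        small a a<n with a ≟ W
        -- Everything that hung at `W` has moved to the closed block, so the open block there starts
        -- again empty.
        ... | yes refl = ≤-trans (s≤s (≤-reflexive (count-none none))) (<⇒≤ 0<K)
          where
          none : ∀ v → (loc″ v ≡? W) ≡ false
          none v with loc′ v ≡? W in eq′
          ... | true = ≢⇒≡? (λ q → low≢high w J (sym q))
          ... | false = eq′
        ... | no a≢W = ≤-trans (s≤s (≤-trans (count-mono λ v h → ≡⇒≡? (rename⁻¹ (≡?⇒≡ h) (λ q → <⇒≱ a<n (≤-trans (m≤m+n n J) (≤-reflexive (sym q)))))) (group-other a a≢W))) (open-small a a<n)
        closed-old : ∀ j → j < J → group loc″ (n + j) ≤ group loc (n + j)
        closed-old j j<J = ≤-trans (count-mono λ v h → ≡⇒≡? (rename⁻¹ (≡?⇒≡ h) (λ q → <⇒≢ j<J (+-cancelˡ-≡ n j J q)))) (group-other (n + j) (λ q → low≢high w j (sym q)))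
        closed-keep : ∀ j → group loc (n + j) ≤ group loc″ (n + j)
        closed-keep j = ≤-trans (group-keep (n + j) (λ q → low≢high u j (sym q))) (count-mono λ v h → ≡⇒≡? (trans (rename-miss (λ q → low≢high w j (trans (sym q) (≡?⇒≡ h)))) (≡?⇒≡ h)))
        new-≤ : group loc″ (n + J) ≤ group loc′ W
        new-≤ = count-mono pw
          where
          pw : ∀ v → (loc″ v ≡? (n + J)) ≡ true → (loc′ v ≡? W) ≡ true
          pw v h with loc′ v ≡? W
          ... | true = refl
          ... | false = ⊥-elim (<⇒≢ (range′ v) (≡?⇒≡ h))
        new-≥ : group loc′ W ≤ group loc″ (n + J)
        new-≥ = count-mono λ v h → ≡⇒≡? (rename-hit (≡?⇒≡ h))
        large : ∀ j → j < suc J → K ≤ group loc″ (n + j)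
        large j j<sJ with j ≟ J
        ... | yes refl = ≤-trans (leb⇒≤ eq) new-≥
        ... | no j≢J = ≤-trans (closed-large j (≤∧≢⇒< (≤-pred j<sJ) j≢J)) (closed-keep j)
        upper : ∀ j → j < suc J → group loc″ (n + j) ≤ K + K
        upper j j<sJ with j ≟ J
        ... | yes refl = ≤-trans new-≤ group-W
        ... | no j≢J = let j<J = ≤∧≢⇒< (≤-pred j<sJ) j≢J in ≤-trans (closed-old j j<J) (closed-small j j<J)
        range″ : ∀ v → loc″ v < n + suc J
        range″ v with loc′ v ≡? W
        ... | true = ≤-reflexive (sym (+-suc n J))
        ... | false = ≤-trans (range′ v) (+-monoʳ-≤ n (n≤1+n J))
        colour″ : ∀ σ → ∃₂ λ (c : ℕ → Bool) (Bad : List ℕ) → length Bad + treeViol σ es ≤ V σ ×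
          (∀ w → c (toℕ w) ≡ σ w) × (∀ v → loc″ v ∉ Bad → σ v ≡ τ′ v xor c (loc″ v))
        colour″ σ with colour′ σ
        ... | c , Bad , len , cw , cv = c″ , map (rename W (n + J)) Bad , ≤-trans (≤-reflexive (cong (_+ treeViol σ es) (Listₚ.length-map (rename W (n + J)) Bad))) len , cw″ , rule
          where
          -- The closed block keeps the colour of `w` under its new number, while the index `W`
          -- still carries it as the reference for blocks that hang at `w` later.
          c″ : ℕ → Bool
          c″ a = if a ≡? (n + J) then σ w else c a
          cw″ : ∀ z → c″ (toℕ z) ≡ σ z
          cw″ z rewrite ≢⇒≡? (low≢high z J) = cw z
          rule : ∀ v → loc″ v ∉ map (rename W (n + J)) Bad → σ v ≡ τ′ v xor c″ (loc″ v)
          rule v h with cv v (λ q → h (∈-map⁺ (rename W (n + J)) q))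
          ... | q with loc′ v ≡? W in eqv
          ...   | true rewrite ≡⇒≡? {n + J} refl = trans q (cong (τ′ v xor_) (trans (cong c (≡?⇒≡ eqv)) (cw w)))
          ...   | false rewrite ≢⇒≡? (<⇒≢ (range′ v)) = q

    process : ∀ {V es} → Forest es → Blocks V es → Blocks V []
    process [] B = B
    process (grow F sw su e) B = process F (Step.next sw su e B)

    -- Singletons count as open blocks because `K` exceeds 1. The budget is the number of violated
    -- edges of the whole forest, none of it spent yet.
    initial : ∀ es → (∀ v → seen es v ≡ true) → Blocks (λ σ → treeViol σ es) es
    initial es all-seen = record
      { loc = toℕ ; J = 0 ; τ = λ _ → false
      ; open-small = λ a a<n → ≤-trans (s≤s (single a a<n)) 0<K
      ; closed-large = λ _ ()
      ; closed-small = λ _ ()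
      ; range = λ v → ≤-trans (Finₚ.toℕ<n v) (m≤m+n n 0)
      ; pending = λ v w _ → all-seen w
      ; inside = λ v w h → cong ℓ (Finₚ.toℕ-injective h)
      ; colour = λ σ → colour₀ σ }
      where
      single : ∀ a → a < n → group toℕ a ≤ 1
      single a a<n = ≤-trans (count-mono {Q = fromℕ< a<n ==_} λ v h → ≡⇒== (Finₚ.toℕ-injective (trans (Finₚ.toℕ-fromℕ< a<n) (sym (≡?⇒≡ h))))) (≤-reflexive (count-eq (fromℕ< a<n)))
      colour₀ : ∀ σ → ∃₂ λ (c : ℕ → Bool) (Bad : List ℕ) → length Bad + treeViol σ es ≤ treeViol σ es × (∀ w → c (toℕ w) ≡ σ w) × (∀ v → toℕ v ∉ Bad → σ v ≡ c (toℕ v))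
      colour₀ σ = c , [] , ≤-refl , cw , λ v _ → sym (cw v)
        where
        c : ℕ → Bool
        c a with a Data.Nat.<? n
        ... | yes a<n = σ (fromℕ< a<n)
        ... | no _ = false
        cw : ∀ w → c (toℕ w) ≡ σ w
        cw w with toℕ w Data.Nat.<? n
        ... | yes q = cong σ (Finₚ.fromℕ<-toℕ w q)
        ... | no q = ⊥-elim (q (Finₚ.toℕ<n w))

    forest : Spanning
    forest = spanning (count (not ∘ seen [])) [] [] ≤-refl

    blocks : Blocks (λ σ → treeViol σ (proj₁ forest)) []
    blocks = process (proj₁ (proj₂ forest)) (initial (proj₁ forest) (proj₂ (proj₂ forest)))

    open Blocks blocks public using (loc; J; τ)
    module B = Blocks blocks

    covered : Fin n → Bool
    covered v = leb n (loc v)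

    #covered : ℕ
    #covered = count covered

    opaque
      -- Every entry of `Bad` was paid for by its own violated forest edge, and forest edges occupy
      -- distinct positions of `x`.
      recolour : ∀ σ → ∃₂ λ (c : ℕ → Bool) (Bad : List ℕ) → length Bad ≤ viol ends x σ × (∀ v → loc v ∉ Bad → σ v ≡ τ v xor c (loc v))
      recolour σ with B.colour σ
      ... | c , Bad , len , cw , cv = c , Bad , ≤-trans (≤-trans (≤-reflexive (sym (+-identityʳ (length Bad)))) len)
              (≤-trans (treeViol-≤ σ (proj₁ (proj₂ forest))) (count-mono λ k h → proj₂ (∧-elim {seen (proj₁ forest) (proj₁ (ends k)) ∧ seen (proj₁ forest) (proj₂ (ends k))} h))) , cv

    -- Once the forest is used up, `pending` allows open blocks only at roots, and `inside`
    -- identifies the root with the label of `v`. Hence a component keeps at most one open block.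
    uncovered-root : ∀ v → covered v ≡ false → loc v ≡ toℕ (ℓ v)
    uncovered-root v h = trans (sym (Finₚ.toℕ-fromℕ< v<n)) (cong toℕ (sym (trans (B.inside v w eq) (==⇒≡ (B.pending v w eq)))))
      where
      v<n = leb⇒> h
      w = fromℕ< v<n
      eq : loc v ≡ toℕ w
      eq = sym (Finₚ.toℕ-fromℕ< v<n)

    -- A component with at least `K + K` vertices has fewer than `K` uncovered ones, so at least
    -- half of it is covered. The uncovered vertices are added twice on the left so that `pointwise`
    -- also holds for small components; after summation over labels they cancel.
    #big-≤ : #big ends (K + K) x ≤ #covered + #covered
    #big-≤ = +-cancelʳ-≤ (U + U) (#big ends (K + K) x) (#covered + #covered) (begin
      #big ends (K + K) x + (U + U)
        ≡⟨ cong₂ (λ a b → a + (b + b)) (count-partition (big ends (K + K) x) ℓ) (count-partition (not ∘ covered) ℓ) ⟩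
      sum X + (sum P + sum P)
        ≡⟨ trans (cong (sum X +_) (sym (∑-distrib-+ P P))) (sym (∑-distrib-+ X (λ w → P w + P w))) ⟩
      sum (λ w → X w + (P w + P w))
        ≤⟨ sum-mono {n} pointwise ⟩
      sum (λ w → F w + F w)
        ≡⟨ ∑-distrib-+ F F ⟩
      sum F + sum F
        ≡⟨ cong (λ k → k + k) (trans (sym (count-partition (λ _ → true) ℓ)) (trans (count-all n) (sym (count-not covered)))) ⟩
      (#covered + U) + (#covered + U)
        ≡⟨ interchange #covered U ⟩
      (#covered + #covered) + (U + U) ∎)
      where
      open ≤-Reasoning
      U = count (not ∘ covered)
      X P F : Fin n → ℕ
      X w = count (λ v → big ends (K + K) x v ∧ (ℓ v == w))
      P w = count (λ v → not (covered v) ∧ (ℓ v == w))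
      F w = count (λ v → ℓ v == w)
      interchange : ∀ a b → (a + b) + (a + b) ≡ (a + a) + (b + b)
      interchange a b = trans (+-assoc a b (a + b)) (trans (cong (a +_) (trans (sym (+-assoc b a b)) (trans (cong (_+ b) (+-comm b a)) (+-assoc a b b)))) (sym (+-assoc a a (b + b))))
      uncovered : ∀ w v → not (covered v) ∧ (ℓ v == w) ≡ true → loc v ≡ toℕ w
      uncovered w v h with ∧-elim {not (covered v)} h
      ... | q , r = trans (uncovered-root v (𝔹ₚ.not-injective q)) (cong toℕ (==⇒≡ r))
      P≤F : ∀ w → P w ≤ F w
      P≤F w = count-mono λ v h → proj₂ (∧-elim {not (covered v)} h)
      P≤K : ∀ w → P w ≤ K
      P≤K w = ≤-trans (count-mono λ v h → ≡⇒≡? (uncovered w v h)) (<⇒≤ (B.open-small (toℕ w) (Finₚ.toℕ<n w)))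
      pointwise : ∀ w → X w + (P w + P w) ≤ F w + F w
      pointwise w with leb (K + K) (F w) in eq
      ... | true = +-mono-≤ (count-mono λ v h → proj₂ (∧-elim {big ends (K + K) x v} h)) (≤-trans (+-mono-≤ (P≤K w) (P≤K w)) (leb⇒≤ eq))
      ... | false = ≤-trans (+-monoˡ-≤ (P w + P w) (≤-reflexive (count-none none))) (+-mono-≤ (P≤F w) (P≤F w))
        where
        none : ∀ v → big ends (K + K) x v ∧ (ℓ v == w) ≡ false
        none v with ℓ v Finₚ.≟ w
        ... | no _ = 𝔹ₚ.∧-zeroʳ _
        ... | yes refl = trans (𝔹ₚ.∧-identityʳ _) eq

    block-sum : #covered ≡ sum {J} (λ j → group loc (n + toℕ j))
    block-sum = trans (count-def covered) (trans (sum-cong-≗ {n} row) (trans (∑-comm (λ v (j : Fin J) → bit (loc v ≡? (n + toℕ j)))) (sum-cong-≗ {J} λ j → sym (count-def (λ v → loc v ≡? (n + toℕ j))))))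
      where
      row : ∀ v → bit (covered v) ≡ sum {J} (λ j → bit (loc v ≡? (n + toℕ j)))
      row v with leb n (loc v) in eq
      ... | false = sym (sum-zero {J} λ j → cong bit (≢⇒≡? (λ q → <⇒≱ (leb⇒> eq) (≤-trans (m≤m+n n (toℕ j)) (≤-reflexive (sym q))))))
      ... | true = sym (trans (sum-cong-≗ {J} same) (trans (sym (count-def (i ==_))) (count-eq i)))
        where
        d<J : loc v ∸ n < J
        d<J = +-cancelˡ-< n (loc v ∸ n) J (≤-trans (s≤s (≤-reflexive (m+[n∸m]≡n (leb⇒≤ eq)))) (B.range v))
        i = fromℕ< d<J
        loc≡ : loc v ≡ n + toℕ i
        loc≡ = trans (sym (m+[n∸m]≡n (leb⇒≤ eq))) (cong (n +_) (sym (Finₚ.toℕ-fromℕ< d<J)))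
        same : ∀ j → bit (loc v ≡? (n + toℕ j)) ≡ bit (i == j)
        same j with i Finₚ.≟ j
        ... | yes refl = cong bit (≡⇒≡? loc≡)
        ... | no i≢j = cong bit (≢⇒≡? (λ q → i≢j (Finₚ.toℕ-injective (+-cancelˡ-≡ n _ _ (trans (sym loc≡) q)))))

    sum-≥ : ∀ {k} (f : Fin k → ℕ) c → (∀ i → c ≤ f i) → k * c ≤ sum f
    sum-≥ {zero} f c h = z≤n
    sum-≥ {suc k} f c h = +-mono-≤ (h zero) (sum-≥ (f ∘ suc) c (h ∘ suc))

    J*K≤#covered : J * K ≤ #covered
    J*K≤#covered = ≤-trans (sum-≥ {J} _ K (λ j → B.closed-large (toℕ j) (Finₚ.toℕ<n j))) (≤-reflexive (sym block-sum))

    #covered≤2JK : #covered ≤ J * (K + K)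
    #covered≤2JK = ≤-trans (≤-reflexive block-sum) (sum-≤ {J} _ (K + K) (λ j → B.closed-small (toℕ j) (Finₚ.toℕ<n j)))

    block-≤ : ∀ a → group loc a ≤ K + K
    block-≤ a with a Data.Nat.<? n
    ... | yes a<n = ≤-trans (<⇒≤ (B.open-small a a<n)) (m≤m+n K K)
    ... | no a≮n with (a ∸ n) Data.Nat.<? J
    ...   | yes q = ≤-trans (≤-reflexive (cong (group loc) (sym (m+[n∸m]≡n (≮⇒≥ a≮n))))) (B.closed-small (a ∸ n) q)
    ...   | no q = ≤-trans (≤-reflexive (count-none λ v → ≢⇒≡? (λ e → q (+-cancelˡ-< n (a ∸ n) J (≤-trans (s≤s (≤-reflexive (trans (m+[n∸m]≡n (≮⇒≥ a≮n)) (sym e)))) (B.range v)))))) z≤n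

open Combinatorics

import Data.Integer as ℤ
import Data.Integer.Properties as ℤₚ
open import Data.Rational using (ℚ; mkℚ; toℚᵘ; _+_; _*_; _-_; -_; _/_; 1/_; _≤_; _<_; 0ℚ; 1ℚ; ½; nonNegative; positive)
open import Data.Rational.Properties as ℚₚ using (_≤?_; ≤-refl; ≤-trans; ≤-reflexive; <⇒≤; +-mono-≤)
import Data.Rational.Unnormalised as ℚᵘ
import Data.Rational.Unnormalised.Properties as ℚᵘₚ
open import Data.Rational.Solver using (module +-*-Solver)
open +-*-Solver using (solve; _:+_; _:*_; _:-_; :-_; _:=_; con)
open import Algebra.Properties.CommutativeMonoid.Sum ℚₚ.+-0-commutativeMonoid using () renaming (sum to Σ)

-- Rational arithmetic

0≤-diff : ∀ {a b} → a ≤ b → 0ℚ ≤ b - a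
0≤-diff {a} {b} a≤b = subst (_≤ b - a) (ℚₚ.+-inverseʳ a) (ℚₚ.+-monoˡ-≤ (- a) a≤b)

-- The form in which polynomial inequalities are proved below: the slack `d` is written out, its
-- sign is checked factor by factor, and the identity is left to the ring solver.
≤-by : ∀ {a b} d → 0ℚ ≤ d → b ≡ a + d → a ≤ b
≤-by {a} d 0≤d refl = subst (_≤ a + d) (ℚₚ.+-identityʳ a) (ℚₚ.+-monoʳ-≤ a 0≤d)

diff-≤ : ∀ {a b} → 0ℚ ≤ b - a → a ≤ b
diff-≤ {a} {b} h = ≤-by (b - a) h (solve 2 (λ a b → b := a :+ (b :- a)) refl a b)

0≤1 : 0ℚ ≤ 1ℚ
0≤1 = ℚₚ.nonNegative⁻¹ 1ℚ

0≤½ : 0ℚ ≤ ½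
0≤½ = ℚₚ.nonNegative⁻¹ ½

½≤1 : ½ ≤ 1ℚ
½≤1 = ≤-by ½ 0≤½ refl

0≤+ : ∀ {a b} → 0ℚ ≤ a → 0ℚ ≤ b → 0ℚ ≤ a + b
0≤+ = +-mono-≤

*-monoʳ : ∀ {a b} c → 0ℚ ≤ c → a ≤ b → c * a ≤ c * b
*-monoʳ c 0≤c = ℚₚ.*-monoˡ-≤-nonNeg c ⦃ nonNegative 0≤c ⦄

*-monoˡ : ∀ {a b} c → 0ℚ ≤ c → a ≤ b → a * c ≤ b * c
*-monoˡ c 0≤c = ℚₚ.*-monoʳ-≤-nonNeg c ⦃ nonNegative 0≤c ⦄

0≤* : ∀ {a b} → 0ℚ ≤ a → 0ℚ ≤ b → 0ℚ ≤ a * b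
0≤* {a} {b} 0≤a 0≤b = subst (_≤ a * b) (ℚₚ.*-zeroʳ a) (*-monoʳ a 0≤a 0≤b)

*-mono : ∀ {a b c d} → 0ℚ ≤ a → 0ℚ ≤ d → a ≤ b → c ≤ d → a * c ≤ b * d
*-mono {a} {b} {c} {d} 0≤a 0≤d a≤b c≤d = ≤-trans (*-monoʳ a 0≤a c≤d) (*-monoˡ d 0≤d a≤b)

*≤1 : ∀ {a b} → 0ℚ ≤ a → a ≤ 1ℚ → b ≤ 1ℚ → a * b ≤ 1ℚ
*≤1 0≤a a≤1 b≤1 = ≤-trans (*-mono 0≤a 0≤1 a≤1 b≤1) (≤-reflexive (ℚₚ.*-identityˡ 1ℚ))

*-cancelˡ : ∀ {a b} c → 0ℚ < c → c * a ≤ c * b → a ≤ b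
*-cancelˡ c 0<c = ℚₚ.*-cancelˡ-≤-pos c ⦃ positive 0<c ⦄

0<* : ∀ {a b} → 0ℚ < a → 0ℚ < b → 0ℚ < a * b
0<* {a} {b} 0<a 0<b = subst (_< a * b) (ℚₚ.*-zeroʳ a) (ℚₚ.*-monoʳ-<-pos a ⦃ positive 0<a ⦄ 0<b)

0≤² : ∀ a → 0ℚ ≤ a * a
0≤² a with ℚₚ.≤-total 0ℚ a
... | inj₁ 0≤a = 0≤* 0≤a 0≤a
... | inj₂ a≤0 = subst (0ℚ ≤_) (solve 1 (λ a → (con 0ℚ :- a) :* (con 0ℚ :- a) := a :* a) refl a) (0≤* (0≤-diff a≤0) (0≤-diff a≤0))

opaque
  ι : ℕ → ℚ
  ι = toℚ

  ι-def : ∀ n → ι n ≡ toℚ n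
  ι-def n = refl

  ι0 : ι 0 ≡ 0ℚ
  ι0 = refl

  ι1 : ι 1 ≡ 1ℚ
  ι1 = refl

  toℚᵘ-ι : ∀ n → toℚᵘ (ι n) ℚᵘ.≃ ℚᵘ.mkℚᵘ (ℤ.+ n) 0
  toℚᵘ-ι n = ℚₚ.toℚᵘ-fromℚᵘ (ℚᵘ.mkℚᵘ (ℤ.+ n) 0)

ι-+ : ∀ m n → ι (m ℕ.+ n) ≡ ι m + ι n
ι-+ m n = ℚₚ.toℚᵘ-injective (begin
  toℚᵘ (ι (m ℕ.+ n))                        ≈⟨ toℚᵘ-ι (m ℕ.+ n) ⟩
  ℚᵘ.mkℚᵘ (ℤ.+ (m ℕ.+ n)) 0                   ≈⟨ ℚᵘ.*≡* (cong (ℤ._* ℤ.+ 1) (sym (cong₂ ℤ._+_ (ℤₚ.*-identityʳ (ℤ.+ m)) (ℤₚ.*-identityʳ (ℤ.+ n))))) ⟩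
  ℚᵘ.mkℚᵘ (ℤ.+ m) 0 ℚᵘ.+ ℚᵘ.mkℚᵘ (ℤ.+ n) 0      ≈⟨ ℚᵘₚ.+-cong (ℚᵘₚ.≃-sym (toℚᵘ-ι m)) (ℚᵘₚ.≃-sym (toℚᵘ-ι n)) ⟩
  toℚᵘ (ι m) ℚᵘ.+ toℚᵘ (ι n)                ≈⟨ ℚᵘₚ.≃-sym (ℚₚ.toℚᵘ-homo-+ (ι m) (ι n)) ⟩
  toℚᵘ (ι m + ι n) ∎)
  where open ℚᵘₚ.≃-Reasoning

ι-suc : ∀ n → ι (suc n) ≡ 1ℚ + ι n
ι-suc n = trans (ι-+ 1 n) (cong (_+ ι n) ι1)

ι-* : ∀ m n → ι (m ℕ.* n) ≡ ι m * ι n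
ι-* zero n = trans ι0 (sym (trans (cong (_* ι n) ι0) (ℚₚ.*-zeroˡ (ι n))))
ι-* (suc m) n = trans (ι-+ n (m ℕ.* n)) (trans (cong (λ t → ι n + t) (ι-* m n))
  (trans (solve 2 (λ m n → n :+ m :* n := (con 1ℚ :+ m) :* n) refl (ι m) (ι n)) (cong (_* ι n) (sym (ι-suc m)))))

0≤ι : ∀ n → 0ℚ ≤ ι n
0≤ι zero = ≤-reflexive (sym ι0)
0≤ι (suc n) = subst (0ℚ ≤_) (sym (ι-suc n)) (0≤+ 0≤1 (0≤ι n))

0≤toℚ : ∀ n → 0ℚ ≤ toℚ n
0≤toℚ n = subst (0ℚ ≤_) (ι-def n) (0≤ι n)

ι-mono : ∀ {m n} → m ℕ.≤ n → ι m ≤ ι n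
ι-mono {m} {n} m≤n = ≤-by (ι (n ℕ.∸ m)) (0≤ι _) (trans (cong ι (sym (ℕₚ.m+[n∸m]≡n m≤n))) (ι-+ m (n ℕ.∸ m)))

1≤ι-suc : ∀ n → 1ℚ ≤ ι (suc n)
1≤ι-suc n = subst (_≤ ι (suc n)) ι1 (ι-mono (ℕ.s≤s ℕ.z≤n))

0<1 : 0ℚ < 1ℚ
0<1 = ℚₚ.positive⁻¹ 1ℚ

0<ι-suc : ∀ n → 0ℚ < ι (suc n)
0<ι-suc n = ℚₚ.<-≤-trans 0<1 (1≤ι-suc n)

ι-cancel : ∀ {m n} → ι m ≤ ι n → m ℕ.≤ n
ι-cancel {m} {n} h = ℕₚ.≮⇒≥ λ n<m → ℚₚ.<-irrefl refl
  (ℚₚ.<-≤-trans (subst (_< 1ℚ + ι n) (ℚₚ.+-identityˡ (ι n)) (ℚₚ.+-monoˡ-< (ι n) 0<1))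
    (≤-trans (≤-reflexive (sym (ι-suc n))) (≤-trans (ι-mono n<m) h)))

*-recip : ∀ k → ι (suc k) * (ℤ.+ 1 / suc k) ≡ 1ℚ
*-recip k = ℚₚ.toℚᵘ-injective (begin
  toℚᵘ (ι (suc k) * (ℤ.+ 1 / suc k))                     ≈⟨ ℚₚ.toℚᵘ-homo-* (ι (suc k)) (ℤ.+ 1 / suc k) ⟩
  toℚᵘ (ι (suc k)) ℚᵘ.* toℚᵘ (ℤ.+ 1 / suc k)             ≈⟨ ℚᵘₚ.*-cong (toℚᵘ-ι (suc k)) (ℚₚ.toℚᵘ-fromℚᵘ (ℚᵘ.mkℚᵘ (ℤ.+ 1) k)) ⟩
  ℚᵘ.mkℚᵘ (ℤ.+ suc k) 0 ℚᵘ.* ℚᵘ.mkℚᵘ (ℤ.+ 1) k               ≈⟨ ℚᵘ.*≡* (trans (ℤₚ.*-identityʳ _) (trans (ℤₚ.*-identityʳ (ℤ.+ suc k)) (sym (trans (ℤₚ.*-identityˡ _) (ℤₚ.*-identityˡ (ℤ.+ suc k)))))) ⟩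
  ℚᵘ.1ℚᵘ ∎)
  where open ℚᵘₚ.≃-Reasoning

0<recip : ∀ k → 0ℚ < ℤ.+ 1 / suc k
0<recip k = ℚₚ.positive⁻¹ (ℤ.+ 1 / suc k) ⦃ ℚₚ.normalize-pos 1 (suc k) ⦄

archimedean : ∀ q → ∃ λ N → q ≤ ι N
archimedean q@(mkℚ n d c) = ℤ.∣ n ∣ , ℚₚ.toℚᵘ-cancel-≤ (ℚᵘₚ.≤-trans (ℚᵘ.*≤* h) (ℚᵘₚ.≤-reflexive (ℚᵘₚ.≃-sym (toℚᵘ-ι ℤ.∣ n ∣))))
  where
  i≤ : ∀ i → i ℤ.≤ ℤ.+ ℤ.∣ i ∣
  i≤ (ℤ.+ n) = ℤₚ.≤-refl
  i≤ (ℤ.-[1+ n ]) = ℤ.-≤+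
  h : n ℤ.* ℤ.+ 1 ℤ.≤ ℤ.+ ℤ.∣ n ∣ ℤ.* ℤ.+ suc d
  h = ℤₚ.≤-trans (ℤₚ.≤-reflexive (ℤₚ.*-identityʳ n)) (ℤₚ.≤-trans (i≤ n)
        (ℤₚ.≤-trans (ℤ.+≤+ (ℕₚ.m≤m*n ℤ.∣ n ∣ (suc d))) (ℤₚ.≤-reflexive (ℤₚ.pos-* ℤ.∣ n ∣ (suc d)))))

inverse : ∀ q → 0ℚ < q → ∃ λ r → 0ℚ < r × q * r ≡ 1ℚ
inverse q 0<q = (1/ q) , ℚₚ.positive⁻¹ (1/ q) ⦃ ℚₚ.1/pos⇒pos q ⦄ , ℚₚ.*-inverseʳ q
  where instance
    _ = positive 0<q
    _ = ℚₚ.pos⇒nonZero q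

opaque
  eventually-≤ : ∀ C d → 0ℚ < d → ∃ λ N → ∀ n → n ℕ.≥ N → C ≤ d * ι n
  eventually-≤ C d 0<d with inverse d 0<d
  ... | r , 0<r , dr≡1 with archimedean (C * r)
  ... | N , h = N , λ n n≥N → ≤-trans (≤-reflexive (trans (sym (ℚₚ.*-identityʳ C)) (trans (cong (C *_) (sym dr≡1)) (solve 3 (λ C d r → C :* (d :* r) := d :* (C :* r)) refl C d r))))
      (*-monoʳ d (<⇒≤ 0<d) (≤-trans h (ι-mono n≥N)))

-- Expectation over independent bits

𝟙 : Bool → ℚ
𝟙 b = if b then 1ℚ else 0ℚ

0≤𝟙 : ∀ b → 0ℚ ≤ 𝟙 b
0≤𝟙 true = 0≤1
0≤𝟙 false = ≤-refl

𝟙≤1 : ∀ b → 𝟙 b ≤ 1ℚ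
𝟙≤1 true = ≤-refl
𝟙≤1 false = 0≤1

record IsProb (p : ℚ) : Set where
  constructor isProb
  field
    0≤p : 0ℚ ≤ p
    p≤1 : p ≤ 1ℚ

  0≤1-p : 0ℚ ≤ 1ℚ - p
  0≤1-p = 0≤-diff p≤1

open IsProb

mix : ℚ → ℚ → ℚ → ℚ
mix p a b = p * a + (1ℚ - p) * b

E : ℚ → {m : ℕ} → (Vec Bool m → ℚ) → ℚ
E p {zero} f = f []
E p {suc m} f = mix p (E p λ v → f (true ∷ v)) (E p λ v → f (false ∷ v))

probBits-E : ∀ p m P → probBits p m P ≡ E p (λ v → 𝟙 (P v))
probBits-E p zero P = refl
probBits-E p (suc m) P = cong₂ (mix p) (probBits-E p m _) (probBits-E p m _)

mix-mono : ∀ {p} → IsProb p → ∀ {a a′ b b′} → a ≤ a′ → b ≤ b′ → mix p a b ≤ mix p a′ b′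
mix-mono pr h k = +-mono-≤ (*-monoʳ _ (0≤p pr) h) (*-monoʳ _ (0≤1-p pr) k)

mix-const : ∀ p a → mix p a a ≡ a
mix-const p a = solve 2 (λ p a → p :* a :+ (con 1ℚ :- p) :* a := a) refl p a

mix-+ : ∀ p a b c d → mix p (a + b) (c + d) ≡ mix p a c + mix p b d
mix-+ = solve 5 (λ p a b c d → p :* (a :+ b) :+ (con 1ℚ :- p) :* (c :+ d) := (p :* a :+ (con 1ℚ :- p) :* c) :+ (p :* b :+ (con 1ℚ :- p) :* d)) refl

mix-* : ∀ p c a b → mix p (c * a) (c * b) ≡ c * mix p a b
mix-* = solve 4 (λ p c a b → p :* (c :* a) :+ (con 1ℚ :- p) :* (c :* b) := c :* (p :* a :+ (con 1ℚ :- p) :* b)) refl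

E-cong : ∀ p {m} {f g : Vec Bool m → ℚ} → (∀ v → f v ≡ g v) → E p f ≡ E p g
E-cong p {zero} h = h []
E-cong p {suc m} h = cong₂ (mix p) (E-cong p (λ v → h (true ∷ v))) (E-cong p (λ v → h (false ∷ v)))

E-mono : ∀ {p} → IsProb p → ∀ {m} {f g : Vec Bool m → ℚ} → (∀ v → f v ≤ g v) → E p f ≤ E p g
E-mono pr {zero} h = h []
E-mono pr {suc m} h = mix-mono pr (E-mono pr (λ v → h (true ∷ v))) (E-mono pr (λ v → h (false ∷ v)))

E-const : ∀ p m c → E p {m} (λ _ → c) ≡ c
E-const p zero c = refl
E-const p (suc m) c = trans (cong₂ (mix p) (E-const p m c) (E-const p m c)) (mix-const p c)

E-+ : ∀ p {m} (f g : Vec Bool m → ℚ) → E p (λ v → f v + g v) ≡ E p f + E p g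
E-+ p {zero} f g = refl
E-+ p {suc m} f g = trans (cong₂ (mix p) (E-+ p (λ v → f (true ∷ v)) (λ v → g (true ∷ v))) (E-+ p (λ v → f (false ∷ v)) (λ v → g (false ∷ v)))) (mix-+ p _ _ _ _)

E-* : ∀ p {m} c (f : Vec Bool m → ℚ) → E p (λ v → c * f v) ≡ c * E p f
E-* p {zero} c f = refl
E-* p {suc m} c f = trans (cong₂ (mix p) (E-* p c (λ v → f (true ∷ v))) (E-* p c (λ v → f (false ∷ v)))) (mix-* p c _ _)

E-- : ∀ p {m} (f g : Vec Bool m → ℚ) → E p (λ v → f v - g v) ≡ E p f - E p g
E-- p f g = trans (E-+ p f (λ v → - g v)) (cong (E p f +_)
  (trans (E-cong p (λ v → solve 1 (λ x → :- x := con (- 1ℚ) :* x) refl (g v)))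
         (trans (E-* p (- 1ℚ) g) (solve 1 (λ x → con (- 1ℚ) :* x := :- x) refl (E p g)))))

E-Σ : ∀ p {m} n (f : Fin n → Vec Bool m → ℚ) → E p (λ v → Σ (λ i → f i v)) ≡ Σ (λ i → E p (f i))
E-Σ p {m} zero f = E-const p m 0ℚ
E-Σ p (suc n) f = trans (E-+ p (f zero) _) (cong (E p (f zero) +_) (E-Σ p n (f ∘ suc)))

0≤E : ∀ {p} → IsProb p → ∀ {m} {f : Vec Bool m → ℚ} → (∀ v → 0ℚ ≤ f v) → 0ℚ ≤ E p f
0≤E {p} pr {m} {f} h = subst (_≤ E p f) (E-const p m 0ℚ) (E-mono pr h)

-- Conditioning on the bit `k`. Although `E` recurses in a fixed order, this lets an exploration
-- reveal the bits in an adaptive order.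
E-resample : ∀ p {m} (k : Fin m) (f : Vec Bool m → ℚ) →
  E p f ≡ mix p (E p λ v → f (v [ k ]≔ true)) (E p λ v → f (v [ k ]≔ false))
E-resample p zero f = cong₂ (mix p) (sym (mix-const p _)) (sym (mix-const p _))
E-resample p (suc k) f = trans (cong₂ (mix p) (E-resample p k _) (E-resample p k _))
  (solve 5 (λ p a b c d → p :* (p :* a :+ (con 1ℚ :- p) :* b) :+ (con 1ℚ :- p) :* (p :* c :+ (con 1ℚ :- p) :* d)
    := p :* (p :* a :+ (con 1ℚ :- p) :* c) :+ (con 1ℚ :- p) :* (p :* b :+ (con 1ℚ :- p) :* d)) refl p _ _ _ _)

Δ : ∀ {m} → (Vec Bool m → ℚ) → Fin m → Vec Bool m → ℚ
Δ f k v = f (v [ k ]≔ true) - f (v [ k ]≔ false)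

Monotone : ∀ {m} → (Vec Bool m → ℚ) → Set
Monotone {m} f = ∀ (k : Fin m) v → f (v [ k ]≔ false) ≤ f (v [ k ]≔ true)

Σ-mono : ∀ {n} {f g : Fin n → ℚ} → (∀ i → f i ≤ g i) → Σ f ≤ Σ g
Σ-mono {zero} h = ≤-refl
Σ-mono {suc n} h = +-mono-≤ (h zero) (Σ-mono (h ∘ suc))

mix-Σ : ∀ p {n} (f g : Fin n → ℚ) → mix p (Σ f) (Σ g) ≡ Σ (λ i → mix p (f i) (g i))
mix-Σ p {zero} f g = mix-const p 0ℚ
mix-Σ p {suc n} f g = trans (mix-+ p (f zero) _ (g zero) _) (cong (mix p (f zero) (g zero) +_) (mix-Σ p (f ∘ suc) (g ∘ suc)))

mix-shift : ∀ {p p′} → p′ ≤ p → ∀ {a b} → b ≤ a → mix p′ a b ≤ mix p a b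
mix-shift {p} {p′} h {a} {b} k = ≤-by ((p - p′) * (a - b)) (0≤* (0≤-diff h) (0≤-diff k))
  (solve 4 (λ p q a b → p :* a :+ (con 1ℚ :- p) :* b := (q :* a :+ (con 1ℚ :- q) :* b) :+ (p :- q) :* (a :- b)) refl p p′ a b)

-- A discrete Russo formula: the derivative of p ↦ E p f is the sum of the expected increments of f.
E-interpolate : ∀ {p p′} → IsProb p → IsProb p′ → p′ ≤ p → ∀ {m} (f : Vec Bool m → ℚ) (g : Fin m → Vec Bool m → ℚ) →
  (∀ k v → Δ f k v ≤ g k v) → (∀ k → Monotone (g k)) →
  E p f ≤ E p′ f + (p - p′) * Σ (λ k → E p (g k))
E-interpolate {p} {p′} pr pr′ p′≤p {zero} f g h mono = ≤-reflexive (solve 2 (λ a d → a := a :+ d :* con 0ℚ) refl (f []) (p - p′))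
E-interpolate {p} {p′} pr pr′ p′≤p {suc m} f g h mono = begin
  mix p e₁ e₀
    ≡⟨ solve 4 (λ p q a b → p :* a :+ (con 1ℚ :- p) :* b := (q :* a :+ (con 1ℚ :- q) :* b) :+ (p :- q) :* (a :- b)) refl p p′ e₁ e₀ ⟩
  mix p′ e₁ e₀ + (p - p′) * (e₁ - e₀)
    ≤⟨ +-mono-≤ (mix-mono pr′ (E-interpolate pr pr′ p′≤p f₁ (λ k v → g (suc k) (true ∷ v)) (λ k v → h (suc k) (true ∷ v)) (λ k j v → mono (suc k) (suc j) (true ∷ v)))
                              (E-interpolate pr pr′ p′≤p f₀ (λ k v → g (suc k) (false ∷ v)) (λ k v → h (suc k) (false ∷ v)) (λ k j v → mono (suc k) (suc j) (false ∷ v))))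
                (*-monoʳ (p - p′) 0≤d last) ⟩
  mix p′ (E p′ f₁ + (p - p′) * S₁) (E p′ f₀ + (p - p′) * S₀) + (p - p′) * E p (g zero)
    ≡⟨ solve 7 (λ q a b d s t u → q :* (a :+ d :* s) :+ (con 1ℚ :- q) :* (b :+ d :* t) :+ d :* u
         := q :* a :+ (con 1ℚ :- q) :* b :+ d :* (u :+ (q :* s :+ (con 1ℚ :- q) :* t))) refl p′ (E p′ f₁) (E p′ f₀) (p - p′) S₁ S₀ (E p (g zero)) ⟩
  mix p′ (E p′ f₁) (E p′ f₀) + (p - p′) * (E p (g zero) + mix p′ S₁ S₀)
    -- Monotonicity of the `g k` gives `S₀ ≤ S₁`, so averaging the first bit at the larger `p` can
    -- only increase the sum.
    ≤⟨ ℚₚ.+-monoʳ-≤ (mix p′ (E p′ f₁) (E p′ f₀)) (*-monoʳ (p - p′) 0≤d (ℚₚ.+-monoʳ-≤ (E p (g zero)) (≤-trans (mix-shift p′≤p (Σ-mono λ k → E-mono pr λ v → mono (suc k) zero (true ∷ v)))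
          (≤-reflexive (mix-Σ p (λ k → E p λ v → g (suc k) (true ∷ v)) (λ k → E p λ v → g (suc k) (false ∷ v))))))) ⟩
  mix p′ (E p′ f₁) (E p′ f₀) + (p - p′) * (E p (g zero) + Σ (λ k → E p (g (suc k)))) ∎
  where
  open ℚₚ.≤-Reasoning
  f₁ = λ v → f (true ∷ v)
  f₀ = λ v → f (false ∷ v)
  e₁ = E p f₁
  e₀ = E p f₀
  S₁ = Σ (λ k → E p λ v → g (suc k) (true ∷ v))
  S₀ = Σ (λ k → E p λ v → g (suc k) (false ∷ v))
  0≤d = 0≤-diff p′≤p
  last : e₁ - e₀ ≤ E p (g zero)
  last = ≤-trans (≤-reflexive (sym (E-- p f₁ f₀)))
    (≤-trans (≤-reflexive (sym (mix-const p _)))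
      (mix-mono pr (E-mono pr λ v → h zero (true ∷ v)) (E-mono pr λ v → h zero (false ∷ v))))

-- The interpolation applied to `- f`, whose increments are at most 0.
E-mono-p : ∀ {p p′} → IsProb p → IsProb p′ → p′ ≤ p → ∀ {m} (f : Vec Bool m → ℚ) → Monotone f → E p′ f ≤ E p f
E-mono-p {p} {p′} pr pr′ p′≤p {m} f mono = diff-≤ (≤-trans (0≤-diff (E-interpolate pr pr′ p′≤p (λ v → - f v) (λ _ _ → 0ℚ) dec (λ _ _ _ → ≤-refl)))
  (≤-reflexive (trans (cong₂ (λ x y → (x + (p - p′) * Σ {m} (λ _ → E p {m} (λ _ → 0ℚ))) - y) (E-neg p′) (E-neg p))
    (trans (cong (λ z → (- E p′ f + (p - p′) * z) - (- E p f)) zeroΣ)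
      (solve 3 (λ a b d → (:- a :+ d :* con 0ℚ) :- (:- b) := b :- a) refl (E p′ f) (E p f) (p - p′))))))
  where
  dec : ∀ k v → Δ (λ v → - f v) k v ≤ 0ℚ
  dec k v = ≤-by _ (0≤-diff (mono k v)) (solve 2 (λ a b → con 0ℚ := (:- a :- :- b) :+ (a :- b)) refl (f (v [ k ]≔ true)) (f (v [ k ]≔ false)))
  E-neg : ∀ q → E q (λ v → - f v) ≡ - E q f
  E-neg q = trans (E-cong q (λ v → solve 1 (λ x → :- x := con 0ℚ :- x) refl (f v))) (trans (E-- q (λ _ → 0ℚ) f)
    (trans (cong (_- E q f) (E-const q m 0ℚ)) (solve 1 (λ x → con 0ℚ :- x := :- x) refl (E q f))))
  zeroΣ : Σ {m} (λ _ → E p {m} (λ _ → 0ℚ)) ≡ 0ℚ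
  zeroΣ = go m
    where
    go : ∀ j → Σ {j} (λ _ → E p {m} (λ _ → 0ℚ)) ≡ 0ℚ
    go zero = refl
    go (suc j) = cong₂ _+_ (E-const p m 0ℚ) (go j)

-- Total variance, one bit at a time: the first bit contributes `p (1 - p) (e₁ - e₀)²`, and the
-- difference of conditional means is at most `c` in absolute value. Keeping the factor `p` matters,
-- since about `n²` bits of density about `1/n` then give a variance linear in `n`.
efron-stein : ∀ {p} → IsProb p → ∀ {m} (f : Vec Bool m → ℚ) c → (∀ k v → Δ f k v ≤ c) → (∀ k v → - c ≤ Δ f k v) →
  E p (λ v → f v * f v) ≤ E p f * E p f + ι m * (p * (c * c))
efron-stein {p} pr {zero} f c _ _ = ≤-reflexive (trans (solve 2 (λ a b → a := a :+ con 0ℚ :* b) refl (f [] * f []) (p * (c * c))) (cong (λ z → f [] * f [] + z * (p * (c * c))) (sym ι0)))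
efron-stein {p} pr {suc m} f c up lo = begin
  mix p (E p λ v → f₁ v * f₁ v) (E p λ v → f₀ v * f₀ v)
    ≤⟨ mix-mono pr (efron-stein pr f₁ c (λ k v → up (suc k) (true ∷ v)) (λ k v → lo (suc k) (true ∷ v)))
                   (efron-stein pr f₀ c (λ k v → up (suc k) (false ∷ v)) (λ k v → lo (suc k) (false ∷ v))) ⟩
  mix p (e₁ * e₁ + ι m * (p * (c * c))) (e₀ * e₀ + ι m * (p * (c * c)))
    ≤⟨ ≤-by (p * (p * (c * c) + (1ℚ - p) * ((c - (e₁ - e₀)) * ((e₁ - e₀) - - c))))
         (0≤* (0≤p pr) (0≤+ (0≤* (0≤p pr) (0≤² c)) (0≤* (0≤1-p pr) (0≤* (0≤-diff up′) (0≤-diff lo′)))))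
         (solve 5 (λ p a b c m → (p :* a :+ (con 1ℚ :- p) :* b) :* (p :* a :+ (con 1ℚ :- p) :* b) :+ (con 1ℚ :+ m) :* (p :* (c :* c))
           := (p :* (a :* a :+ m :* (p :* (c :* c))) :+ (con 1ℚ :- p) :* (b :* b :+ m :* (p :* (c :* c))))
             :+ p :* (p :* (c :* c) :+ (con 1ℚ :- p) :* ((c :- (a :- b)) :* ((a :- b) :- :- c)))) refl p e₁ e₀ c (ι m)) ⟩
  mix p e₁ e₀ * mix p e₁ e₀ + (1ℚ + ι m) * (p * (c * c))
    ≡⟨ cong (λ z → mix p e₁ e₀ * mix p e₁ e₀ + z * (p * (c * c))) (sym (ι-suc m)) ⟩
  mix p e₁ e₀ * mix p e₁ e₀ + ι (suc m) * (p * (c * c)) ∎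
  where
  open ℚₚ.≤-Reasoning
  f₁ = λ v → f (true ∷ v)
  f₀ = λ v → f (false ∷ v)
  e₁ = E p f₁
  e₀ = E p f₀
  up′ : e₁ - e₀ ≤ c
  up′ = ≤-trans (≤-reflexive (sym (E-- p f₁ f₀))) (≤-trans (E-mono pr λ v → up zero (true ∷ v)) (≤-reflexive (E-const p m c)))
  lo′ : - c ≤ e₁ - e₀
  lo′ = ≤-trans (≤-trans (≤-reflexive (sym (E-const p m (- c)))) (E-mono pr λ v → lo zero (true ∷ v))) (≤-reflexive (E-- p f₁ f₀))

-- The density of the union of two independent random edge sets of densities p and q.
_⊕_ : ℚ → ℚ → ℚ
p ⊕ q = p + q - p * q

E-⊕ : ∀ p q {m} (f : Vec Bool m → ℚ) → E (p ⊕ q) f ≡ E p (λ x → E q (λ y → f (zipWith _∨_ x y)))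
E-⊕ p q {zero} f = refl
E-⊕ p q {suc m} f = trans (cong₂ (mix (p ⊕ q)) (E-⊕ p q f₁) (E-⊕ p q f₀))
  (trans (solve 4 (λ p q a b → (p :+ q :- p :* q) :* a :+ (con 1ℚ :- (p :+ q :- p :* q)) :* b
      := p :* a :+ (con 1ℚ :- p) :* (q :* a :+ (con 1ℚ :- q) :* b)) refl p q (E p (F f₁)) (E p (F f₀)))
    (cong₂ (mix p) (sym (E-cong p (λ x → mix-const q (F f₁ x))))
      (sym (trans (E-+ p (λ x → q * F f₁ x) (λ x → (1ℚ - q) * F f₀ x)) (cong₂ _+_ (E-* p q (F f₁)) (E-* p (1ℚ - q) (F f₀)))))))
  where
  f₁ = λ v → f (true ∷ v)
  f₀ = λ v → f (false ∷ v)
  F : (Vec Bool m → ℚ) → Vec Bool m → ℚ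
  F g x = E q (λ y → g (zipWith _∨_ x y))

pow : ℚ → ℕ → ℚ
pow a zero = 1ℚ
pow a (suc n) = a * pow a n

-- Exploration of a component

pow-0≤ : ∀ {a} → 0ℚ ≤ a → ∀ n → 0ℚ ≤ pow a n
pow-0≤ 0≤a zero = 0≤1
pow-0≤ 0≤a (suc n) = 0≤* 0≤a (pow-0≤ 0≤a n)

pow-≤1 : ∀ {a} → 0ℚ ≤ a → a ≤ 1ℚ → ∀ n → pow a n ≤ 1ℚ
pow-≤1 0≤a a≤1 zero = ≤-refl
pow-≤1 {a} 0≤a a≤1 (suc n) = *≤1 0≤a a≤1 (pow-≤1 0≤a a≤1 n)

pow-+ : ∀ a m n → pow a (m ℕ.+ n) ≡ pow a m * pow a n
pow-+ a zero n = sym (ℚₚ.*-identityˡ (pow a n))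
pow-+ a (suc m) n = trans (cong (a *_) (pow-+ a m n)) (sym (ℚₚ.*-assoc a (pow a m) (pow a n)))

pow-anti : ∀ {a} → 0ℚ ≤ a → a ≤ 1ℚ → ∀ {m n} → m ℕ.≤ n → pow a n ≤ pow a m
pow-anti {a} 0≤a a≤1 {m} {n} m≤n = ≤-trans (≤-reflexive (trans (cong (pow a) (sym (ℕₚ.m+[n∸m]≡n m≤n))) (pow-+ a m (n ℕ.∸ m))))
  (≤-trans (*-monoʳ (pow a m) (pow-0≤ 0≤a m) (pow-≤1 0≤a a≤1 (n ℕ.∸ m))) (≤-reflexive (ℚₚ.*-identityʳ (pow a m))))

length-≤-count : ∀ {n} {P : Fin n → Bool} {xs} → Unique xs → All (λ i → P i ≡ true) xs → length xs ℕ.≤ count P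
length-≤-count [] [] = ℕ.z≤n
length-≤-count {P = P} {x ∷ xs} (x∉ ∷ u) (px ∷ ps) = ℕₚ.≤-trans (ℕ.s≤s (length-≤-count {P = λ i → not (x == i) ∧ P i} u (others x∉ ps)))
    (count-strict x (cong (λ b → not b ∧ P x) (≡⇒== {i = x} refl)) px (λ i e → proj₂ (∧-elim {not (x == i)} e)))
  where
  others : ∀ {ys} → All (x ≢_) ys → All (λ i → P i ≡ true) ys → All (λ i → not (x == i) ∧ P i ≡ true) ys
  others [] [] = []
  others (n ∷ ns) (q ∷ qs) = cong₂ (λ a b → not a ∧ b) (≢⇒== n) q ∷ others ns qs

memb : ∀ {n} → Fin n → List (Fin n) → Bool
memb i [] = false
memb i (x ∷ xs) = (x == i) ∨ memb i xs

memb⇒∈ : ∀ {n} {i : Fin n} xs → memb i xs ≡ true → i ∈ xs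
memb⇒∈ {i = i} (x ∷ xs) h with x Finₚ.≟ i
... | yes refl = here refl
... | no _ = there (memb⇒∈ xs h)

∈⇒memb : ∀ {n} {i : Fin n} {xs} → i ∈ xs → memb i xs ≡ true
∈⇒memb {i = i} (here refl) rewrite ≡⇒== {i = i} refl = refl
∈⇒memb {i = i} {x ∷ xs} (there p) rewrite ∈⇒memb p = 𝔹ₚ.∨-zeroʳ (x == i)

count-memb : ∀ {n} (xs : List (Fin n)) → count (λ i → memb i xs) ℕ.≤ length xs
count-memb {n} [] = ℕₚ.≤-reflexive (count-none {n} (λ _ → refl))
count-memb (x ∷ xs) = ℕₚ.≤-trans (count-∨ (x ==_) (λ i → memb i xs)) (ℕₚ.+-mono-≤ (ℕₚ.≤-reflexive (count-eq x)) (count-memb xs))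

module Exploration (n : ℕ) where
  open Pairs n

  adj : Vec Bool #pairs → Fin n → Fin n → Bool
  adj x a b with a Finₚ.≟ b
  ... | yes _ = false
  ... | no a≢b = lookup x (edge a b a≢b)

  swapped : ∀ {k k′ a b} → ends k ≡ (a , b) → ends k′ ≢ (b , a)
  swapped {k} {k′} e e′ = ℕₚ.<-asym (subst₂ Fin._<_ (cong proj₁ e) (cong proj₂ e) (ends-ordered k)) (subst₂ Fin._<_ (cong proj₁ e′) (cong proj₂ e′) (ends-ordered k′))

  Joins : Fin #pairs → Fin n → Fin n → Set
  Joins k a b = ends k ≡ (a , b) ⊎ ends k ≡ (b , a)

  joins-unique : ∀ {k k′ a b} → Joins k a b → Joins k′ a b → k ≡ k′
  joins-unique (inj₁ e) (inj₁ e′) = ends-injective (trans e (sym e′))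
  joins-unique (inj₁ e) (inj₂ e′) = ⊥-elim (swapped e e′)
  joins-unique (inj₂ e) (inj₁ e′) = ⊥-elim (swapped e′ e)
  joins-unique (inj₂ e) (inj₂ e′) = ends-injective (trans e (sym e′))

  joins-same : ∀ {k a b c d} → Joins k a b → Joins k c d → a ≡ c × b ≡ d ⊎ a ≡ d × b ≡ c
  joins-same (inj₁ e) (inj₁ e′) = let q = trans (sym e) e′ in inj₁ (cong proj₁ q , cong proj₂ q)
  joins-same (inj₁ e) (inj₂ e′) = let q = trans (sym e) e′ in inj₂ (cong proj₁ q , cong proj₂ q)
  joins-same (inj₂ e) (inj₁ e′) = let q = trans (sym e) e′ in inj₂ (cong proj₂ q , cong proj₁ q)
  joins-same (inj₂ e) (inj₂ e′) = let q = trans (sym e) e′ in inj₁ (cong proj₂ q , cong proj₁ q)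

  adj-edge : ∀ x k a b → Joins k a b → adj x a b ≡ lookup x k
  adj-edge x k a b h with a Finₚ.≟ b
  ... | no a≢b = cong (lookup x) (joins-unique {edge a b a≢b} {k} (edge-ends a b a≢b) h)
  adj-edge x k a b (inj₁ e) | yes refl = ⊥-elim (swapped e e)
  adj-edge x k a b (inj₂ e) | yes refl = ⊥-elim (swapped e e)

  adj-present : ∀ x a b → adj x a b ≡ true → ∃ λ k → Joins k a b × lookup x k ≡ true
  adj-present x a b h with a Finₚ.≟ b
  ... | no a≢b = edge a b a≢b , edge-ends a b a≢b , h

  adj-update : ∀ x k v u → v ≢ u → ends k ≡ (v , u) ⊎ ends k ≡ (u , v) → ∀ b a c → c ≢ v → (a ≡ v → u ≢ c) → adj (x [ k ]≔ b) a c ≡ adj x a c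
  adj-update x k v u v≢u kvu b a c c≢v h with a Finₚ.≟ c
  ... | yes _ = refl
  ... | no a≢c = Vecₚ.lookup∘update′ other x b
    where
    other : edge a c a≢c ≢ k
    other refl with joins-same {edge a c a≢c} (edge-ends a c a≢c) kvu
    ... | inj₁ (a≡v , c≡u) = h a≡v (sym c≡u)
    ... | inj₂ (_ , c≡v) = c≢v c≡v

  -- One pair is tested at a time: v is the vertex being processed, A the discovered vertices waiting to be processed,
  -- T the undiscovered vertices not yet tested against v and D those found not adjacent to v.
  -- The answer tells whether more than t vertices get processed.
  explore : ℕ → Vec Bool #pairs → Fin n → (A T D : List (Fin n)) → Bool
  explore t x v A (u ∷ T) D = if adj x v u then explore t x v (u ∷ A) T D else explore t x v A T (u ∷ D)
  explore zero x v A [] D = true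
  explore (suc t) x v [] [] D = false
  explore (suc t) x v (a ∷ A) [] D = explore t x a A D []

  -- No pair is tested twice. A vertex whose turn is over never returns to the lists, and while `v₀`
  -- is still current, `u₀` is no longer among the vertices to be tested; so the bit `k` is not read
  -- again.
  explore-update : ∀ x k v₀ u₀ → v₀ ≢ u₀ → Joins k v₀ u₀ → ∀ b t v A T D →
    All (v₀ ≢_) A → All (v₀ ≢_) T → All (v₀ ≢_) D → (v ≡ v₀ → All (u₀ ≢_) T) →
    explore t (x [ k ]≔ b) v A T D ≡ explore t x v A T D
  explore-update x k v₀ u₀ v₀≢u₀ kj b t v A (u ∷ T) D hA (hu ∷ hT) hD h
    rewrite adj-update x k v₀ u₀ v₀≢u₀ kj b v u (λ e → hu (sym e)) (λ e → All.head (h e)) with adj x v u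
  ... | true = explore-update x k v₀ u₀ v₀≢u₀ kj b t v (u ∷ A) T D (hu ∷ hA) hT hD (λ e → All.tail (h e))
  ... | false = explore-update x k v₀ u₀ v₀≢u₀ kj b t v A T (u ∷ D) hA hT (hu ∷ hD) (λ e → All.tail (h e))
  explore-update x k v₀ u₀ v₀≢u₀ kj b zero v A [] D hA hT hD h = refl
  explore-update x k v₀ u₀ v₀≢u₀ kj b (suc t) v [] [] D hA hT hD h = refl
  explore-update x k v₀ u₀ v₀≢u₀ kj b (suc t) v (a ∷ A) [] D (ha ∷ hA) hT hD h =
    explore-update x k v₀ u₀ v₀≢u₀ kj b t a A D [] hA hD [] (λ e → ⊥-elim (ha (sym e)))

  Unique-↭ : ∀ {xs ys : List (Fin n)} → xs ↭ ys → Unique xs → Unique ys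
  Unique-↭ p = ↭ₛ.Unique-resp-↭ (setoid (Fin n)) (↭⇒↭ₛ p)

  discover : ∀ (v u : Fin n) A T D P → v ∷ A ++ (u ∷ T) ++ D ++ P ↭ v ∷ (u ∷ A) ++ T ++ D ++ P
  discover v u A T D P = prep v (shift u A (T ++ D ++ P))

  reject : ∀ (v u : Fin n) A T D P → v ∷ A ++ (u ∷ T) ++ D ++ P ↭ v ∷ A ++ T ++ (u ∷ D) ++ P
  reject v u A T D P = prep v (++⁺ˡ A (↭-sym (shift u T (D ++ P))))

  pop : ∀ (v a : Fin n) A D P → v ∷ (a ∷ A) ++ [] ++ D ++ P ↭ a ∷ A ++ D ++ [] ++ (v ∷ P)
  pop v a A D P = ↭-trans (↭-reflexive (cong (v ∷_) (sym (Listₚ.++-assoc (a ∷ A) D P))))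
    (↭-trans (↭-sym (shift v ((a ∷ A) ++ D) P)) (↭-reflexive (Listₚ.++-assoc (a ∷ A) D (v ∷ P))))

  -- `P` holds the vertices already processed. `explore` does not carry them, but every move of the
  -- exploration is a permutation of this concatenation, so distinctness persists.
  Distinct : Fin n → (A T D P : List (Fin n)) → Set
  Distinct v A T D P = Unique (v ∷ A ++ T ++ D ++ P)

  explore-step : ∀ p t v u A T D P → Distinct v A (u ∷ T) D P → ∀ (f : Bool → ℚ) →
    E p (λ x → f (explore t x v A (u ∷ T) D)) ≡ mix p (E p (λ x → f (explore t x v (u ∷ A) T D))) (E p (λ x → f (explore t x v A T (u ∷ D))))
  explore-step p t v u A T D P (v∉ ∷ uniq) f = trans (E-resample p k (λ x → f (explore t x v A (u ∷ T) D)))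
      (cong₂ (mix p) (E-cong p λ x → cong f (trans (on x) (explore-update x k v u v≢u kj true t v (u ∷ A) T D (v≢u ∷ vA) vT vD (λ _ → uT))))
                     (E-cong p λ x → cong f (trans (off x) (explore-update x k v u v≢u kj false t v A T (u ∷ D) vA vT (v≢u ∷ vD) (λ _ → uT)))))
    where
    vA = Allₚ.++⁻ˡ A v∉
    v≢u = All.head (Allₚ.++⁻ʳ A v∉)
    vT = Allₚ.++⁻ˡ T (All.tail (Allₚ.++⁻ʳ A v∉))
    vD = Allₚ.++⁻ˡ D (Allₚ.++⁻ʳ T (All.tail (Allₚ.++⁻ʳ A v∉)))
    k = edge v u v≢u
    kj = edge-ends v u v≢u
    uT : All (u ≢_) T
    uT = go A uniq
      where
      go : ∀ A → Unique (A ++ (u ∷ T) ++ D ++ P) → All (u ≢_) T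
      go [] (h ∷ _) = Allₚ.++⁻ˡ T h
      go (_ ∷ A) (_ ∷ h) = go A h
    on : ∀ x → explore t (x [ k ]≔ true) v A (u ∷ T) D ≡ explore t (x [ k ]≔ true) v (u ∷ A) T D
    on x rewrite adj-edge (x [ k ]≔ true) k v u kj | Vecₚ.lookup∘update k x true = refl
    off : ∀ x → explore t (x [ k ]≔ false) v A (u ∷ T) D ≡ explore t (x [ k ]≔ false) v A T (u ∷ D)
    off x rewrite adj-edge (x [ k ]≔ false) k v u kj | Vecₚ.lookup∘update k x false = refl

  explore-many : ∀ t x v A T D → t ℕ.≤ length A → explore t x v A T D ≡ true
  explore-many t x v A (u ∷ T) D h with adj x v u
  ... | true = explore-many t x v (u ∷ A) T D (ℕₚ.m≤n⇒m≤1+n h)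
  ... | false = explore-many t x v A T (u ∷ D) h
  explore-many zero x v A [] D h = refl
  explore-many (suc t) x v (a ∷ A) [] D (ℕ.s≤s h) = explore-many t x a A D [] h

  module Potential {p h} (pr : IsProb p) (0≤h : 0ℚ ≤ h) (h≤1 : h ≤ 1ℚ) where
    θ s : ℚ
    θ = 1ℚ - h
    s = 1ℚ - p * h

    0≤θ : 0ℚ ≤ θ
    0≤θ = 0≤-diff h≤1
    θ≤1 : θ ≤ 1ℚ
    θ≤1 = ≤-by h 0≤h (solve 1 (λ h → con 1ℚ := (con 1ℚ :- h) :+ h) refl h)
    0≤s : 0ℚ ≤ s
    0≤s = 0≤-diff (*≤1 (IsProb.0≤p pr) (IsProb.p≤1 pr) h≤1)
    s≤1 : s ≤ 1ℚ
    s≤1 = ≤-by (p * h) (0≤* (IsProb.0≤p pr) 0≤h) (solve 1 (λ h → con 1ℚ := (con 1ℚ :- h) :+ h) refl (p * h))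

    -- A guess for the extinction probability: a factor `θ` for each waiting vertex and, for each
    -- pair still to be tested, `s = p θ + (1 - p)`.
    weight : ℕ → ℕ → ℚ
    weight a t = pow θ a * pow s t

    0≤weight : ∀ a t → 0ℚ ≤ weight a t
    0≤weight a t = 0≤* (pow-0≤ 0≤θ a) (pow-0≤ 0≤s t)

    weight≤1 : ∀ a t → weight a t ≤ 1ℚ
    weight≤1 a t = *≤1 (pow-0≤ 0≤θ a) (pow-≤1 0≤θ θ≤1 a) (pow-≤1 0≤s s≤1 t)

    -- The weight is a martingale for the test of one pair.
    weight-step : ∀ a t → mix p (weight (suc a) t) (weight a t) ≡ weight a (suc t)
    weight-step a t = solve 4 (λ p h x y → p :* ((con 1ℚ :- h) :* x :* y) :+ (con 1ℚ :- p) :* (x :* y) := x :* ((con 1ℚ :- p :* h) :* y)) refl p h (pow θ a) (pow s t)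

    -- Popping a vertex removes a factor `θ` and puts `pow s (length D)` in its place, since the
    -- rejected vertices form the next list to be tested. Either the waiting vertices alone
    -- guarantee survival, or the invariant on lengths leaves at least `M` vertices in `D` and the
    -- new factor is at most `θ`. So the weight never grows at a pop.
    die-≤ : ∀ M → pow s M ≤ θ → ∀ t v A T D P → Distinct v A T D P → M ℕ.+ t ℕ.≤ length A ℕ.+ (length T ℕ.+ length D) →
      E p (λ x → 𝟙 (not (explore t x v A T D))) ≤ weight (length A) (length T)
    die-≤ M sM≤θ t v A (u ∷ T) D P uniq len = ≤-trans (≤-reflexive (explore-step p t v u A T D P uniq (λ b → 𝟙 (not b))))
      (≤-trans (mix-mono pr
          (die-≤ M sM≤θ t v (u ∷ A) T D P (Unique-↭ (discover v u A T D P) uniq) (ℕₚ.≤-trans len (ℕₚ.≤-reflexive (ℕₚ.+-suc (length A) _))))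
          (die-≤ M sM≤θ t v A T (u ∷ D) P (Unique-↭ (reject v u A T D P) uniq) (ℕₚ.≤-trans len (ℕₚ.≤-reflexive (cong (length A ℕ.+_) (sym (ℕₚ.+-suc (length T) (length D))))))))
        (≤-reflexive (weight-step (length A) (length T))))
    die-≤ M sM≤θ zero v A [] D P uniq len = ≤-trans (≤-reflexive (E-const p #pairs 0ℚ)) (0≤weight (length A) 0)
    die-≤ M sM≤θ (suc t) v [] [] D P uniq len = ≤-reflexive (E-const p #pairs 1ℚ)
    die-≤ M sM≤θ (suc t) v (a ∷ A) [] D P uniq len with ℕₚ.≤-total t (length A)
    ... | inj₁ many = ≤-trans (≤-reflexive (trans (E-cong p λ x → cong (𝟙 ∘ not) (explore-many t x a A D [] many)) (E-const p #pairs 0ℚ))) (0≤weight (suc (length A)) 0)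
    ... | inj₂ few = begin
      E p (λ x → 𝟙 (not (explore t x a A D [])))
        ≤⟨ die-≤ M sM≤θ t a A D [] (v ∷ P) (Unique-↭ (pop v a A D P) uniq) len′ ⟩
      pow θ (length A) * pow s (length D)
        ≤⟨ *-monoʳ (pow θ (length A)) (pow-0≤ 0≤θ (length A)) (≤-trans (pow-anti 0≤s s≤1 M≤D) sM≤θ) ⟩
      pow θ (length A) * θ
        ≡⟨ solve 2 (λ x y → x :* y := y :* x :* con 1ℚ) refl (pow θ (length A)) θ ⟩
      weight (suc (length A)) 0 ∎
      where
      open ℚₚ.≤-Reasoning
      len₁ : M ℕ.+ t ℕ.≤ length A ℕ.+ length D
      len₁ = ℕₚ.≤-pred (ℕₚ.≤-trans (ℕₚ.≤-reflexive (sym (ℕₚ.+-suc M t))) len)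
      len′ = ℕₚ.≤-trans len₁ (ℕₚ.≤-reflexive (cong (length A ℕ.+_) (sym (ℕₚ.+-identityʳ (length D)))))
      M≤D : M ℕ.≤ length D
      M≤D = ℕₚ.+-cancelˡ-≤ t M (length D) (ℕₚ.≤-trans (ℕₚ.≤-reflexive (ℕₚ.+-comm t M)) (ℕₚ.≤-trans len₁ (ℕₚ.+-monoˡ-≤ (length D) few)))

    -- Now the weight before a pop is at most `ρ` times the weight after it. This gain turns the
    -- error `pow ρ t` for the rest into `pow ρ (suc t)`; the error term is the allowance for
    -- explorations that last long and still die out.
    survive-≤ : ∀ {ρ} N → 0ℚ ≤ ρ → ρ ≤ 1ℚ → θ ≤ ρ * pow s N → ∀ t v A T D P → Distinct v A T D P → length A ℕ.+ (length T ℕ.+ length D) ℕ.≤ N →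
      E p (λ x → 𝟙 (explore t x v A T D)) ≤ (1ℚ - weight (length A) (length T)) + pow ρ t
    survive-≤ {ρ} N 0≤ρ ρ≤1 hyp t v A (u ∷ T) D P uniq len = ≤-trans (≤-reflexive (explore-step p t v u A T D P uniq 𝟙))
      (≤-trans (mix-mono pr
          (survive-≤ N 0≤ρ ρ≤1 hyp t v (u ∷ A) T D P (Unique-↭ (discover v u A T D P) uniq) (ℕₚ.≤-trans (ℕₚ.≤-reflexive (sym (ℕₚ.+-suc (length A) _))) len))
          (survive-≤ N 0≤ρ ρ≤1 hyp t v A T (u ∷ D) P (Unique-↭ (reject v u A T D P) uniq) (ℕₚ.≤-trans (ℕₚ.≤-reflexive (cong (length A ℕ.+_) (ℕₚ.+-suc (length T) (length D)))) len)))
        (≤-reflexive (trans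
          (solve 4 (λ p a b r → p :* (con 1ℚ :- a :+ r) :+ (con 1ℚ :- p) :* (con 1ℚ :- b :+ r) := con 1ℚ :- (p :* a :+ (con 1ℚ :- p) :* b) :+ r) refl
            p (weight (suc (length A)) (length T)) (weight (length A) (length T)) (pow ρ t))
          (cong (λ z → (1ℚ - z) + pow ρ t) (weight-step (length A) (length T))))))
    survive-≤ {ρ} N 0≤ρ ρ≤1 hyp zero v A [] D P uniq len = ≤-trans (≤-reflexive (E-const p #pairs 1ℚ))
      (≤-by (1ℚ - weight (length A) 0) (0≤-diff (weight≤1 (length A) 0)) (solve 1 (λ w → (con 1ℚ :- w) :+ con 1ℚ := con 1ℚ :+ (con 1ℚ :- w)) refl (weight (length A) 0)))
    survive-≤ {ρ} N 0≤ρ ρ≤1 hyp (suc t) v [] [] D P uniq len = ≤-trans (≤-reflexive (E-const p #pairs 0ℚ))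
      (0≤+ (0≤-diff (weight≤1 0 0)) (pow-0≤ 0≤ρ (suc t)))
    survive-≤ {ρ} N 0≤ρ ρ≤1 hyp (suc t) v (a ∷ A) [] D P uniq len = diff-≤ (≤-trans pos (≤-reflexive
        (solve 6 (λ th x d r e q → (con 1ℚ :- r) :* (con 1ℚ :- e) :+ x :* (r :* d :- th) :+ r :* ((con 1ℚ :- x :* d) :+ q :- e)
           := (con 1ℚ :- th :* x :* con 1ℚ) :+ r :* q :- e) refl θ (pow θ (length A)) (pow s (length D)) ρ e (pow ρ t))))
      where
      e = E p (λ x → 𝟙 (explore t x a A D []))
      e≤1 : e ≤ 1ℚ
      e≤1 = ≤-trans (E-mono pr λ x → 𝟙≤1 (explore t x a A D [])) (≤-reflexive (E-const p #pairs 1ℚ))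
      len′ : length A ℕ.+ (length D ℕ.+ 0) ℕ.≤ N
      len′ = ℕₚ.≤-trans (ℕₚ.≤-reflexive (cong (length A ℕ.+_) (ℕₚ.+-identityʳ (length D)))) (ℕₚ.≤-trans (ℕₚ.n≤1+n _) len)
      IH = survive-≤ N 0≤ρ ρ≤1 hyp t a A D [] (v ∷ P) (Unique-↭ (pop v a A D P) uniq) len′
      D≤N : length D ℕ.≤ N
      D≤N = ℕₚ.≤-trans (ℕₚ.m≤n+m (length D) (suc (length A))) len
      pos : 0ℚ ≤ (1ℚ - ρ) * (1ℚ - e) + pow θ (length A) * (ρ * pow s (length D) - θ) + ρ * ((1ℚ - weight (length A) (length D)) + pow ρ t - e)
      pos = 0≤+ (0≤+ (0≤* (0≤-diff ρ≤1) (0≤-diff e≤1))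
                     (0≤* (pow-0≤ 0≤θ (length A)) (0≤-diff (≤-trans hyp (*-monoʳ ρ 0≤ρ (pow-anti 0≤s s≤1 D≤N))))))
                (0≤* 0≤ρ (0≤-diff IH))

  -- The current and the processed vertices are distinct and lie in the component of `r`; surviving
  -- means that `t` further vertices get processed.
  survive-size : ∀ t x r v A T D P → Distinct v A T D P →
    conn ends x v r ≡ true → All (λ w → conn ends x w r ≡ true) A → All (λ w → conn ends x w r ≡ true) P →
    explore t x v A T D ≡ true → suc (length P ℕ.+ t) ℕ.≤ size ends x r
  survive-size t x r v A (u ∷ T) D P uniq cv cA cP h with adj x v u in eq
  ... | true = survive-size t x r v (u ∷ A) T D P (Unique-↭ (discover v u A T D P) uniq) cv (cu ∷ cA) cP h
    where
    cu : conn ends x u r ≡ true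
    cu with adj-present x v u eq
    ... | k , inj₁ e , on = ≡⇒== (trans (sym (subst (λ z → lab ends x (proj₁ z) ≡ lab ends x (proj₂ z)) e (lab-respects ends x k on))) (==⇒≡ cv))
    ... | k , inj₂ e , on = ≡⇒== (trans (subst (λ z → lab ends x (proj₁ z) ≡ lab ends x (proj₂ z)) e (lab-respects ends x k on)) (==⇒≡ cv))
  ... | false = survive-size t x r v A T (u ∷ D) P (Unique-↭ (reject v u A T D P) uniq) cv cA cP h
  survive-size zero x r v A [] D P (v∉ ∷ uniq) cv cA cP h = ℕₚ.≤-trans (ℕₚ.≤-reflexive (cong suc (ℕₚ.+-identityʳ (length P))))
      (length-≤-count (Allₚ.++⁻ʳ D (Allₚ.++⁻ʳ A v∉) ∷ drop (A ++ D) (subst Unique (sym (Listₚ.++-assoc A D P)) uniq)) (cv ∷ cP))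
    where
    drop : ∀ xs {ys : List (Fin n)} → Unique (xs ++ ys) → Unique ys
    drop [] u = u
    drop (_ ∷ xs) (_ ∷ u) = drop xs u
  survive-size (suc t) x r v (a ∷ A) [] D P uniq cv (ca ∷ cA) cP h = ℕₚ.≤-trans (ℕₚ.≤-reflexive (cong suc (ℕₚ.+-suc (length P) t)))
    (survive-size t x r a A D [] (v ∷ P) (Unique-↭ (pop v a A D P) uniq) ca cA (cv ∷ cP) h)

  -- When the exploration stops, every pair between `v ∷ P` and the remaining vertices has been
  -- tested and found absent. Membership in `v ∷ P` is then an invariant of the edges, so the
  -- component of `r` lies inside.
  die-size : ∀ t x r v A T D P → (∀ w → w ∈ v ∷ A ++ T ++ D ++ P) → v ≡ r ⊎ r ∈ P →
    (∀ w z → w ∈ P → z ∈ T ⊎ z ∈ D → adj x w z ≡ false) → (∀ z → z ∈ D → adj x v z ≡ false) →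
    explore t x v A T D ≡ false → size ends x r ℕ.≤ length P ℕ.+ t
  die-size t x r v A (u ∷ T) D P cover root closed tested h with adj x v u in eq
  ... | true = die-size t x r v (u ∷ A) T D P (λ w → ∈-resp-↭ (discover v u A T D P) (cover w)) root
                 (λ { w z w∈ (inj₁ z∈) → closed w z w∈ (inj₁ (there z∈)) ; w z w∈ (inj₂ z∈) → closed w z w∈ (inj₂ z∈) }) tested h
  ... | false = die-size t x r v A T (u ∷ D) P (λ w → ∈-resp-↭ (reject v u A T D P) (cover w)) root
                 (λ { w z w∈ (inj₁ z∈) → closed w z w∈ (inj₁ (there z∈)) ; w z w∈ (inj₂ (here refl)) → closed w z w∈ (inj₁ (here refl)) ; w z w∈ (inj₂ (there z∈)) → closed w z w∈ (inj₂ z∈) })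
                 (λ { z (here refl) → eq ; z (there z∈) → tested z z∈ }) h
  die-size (suc t) x r v (a ∷ A) [] D P cover root closed tested h = ℕₚ.≤-trans
    (die-size t x r a A D [] (v ∷ P) (λ w → ∈-resp-↭ (pop v a A D P) (cover w)) (inj₂ (root′ root))
      (λ { w z (here refl) (inj₁ z∈) → tested z z∈ ; w z (there w∈) (inj₁ z∈) → closed w z w∈ (inj₂ z∈) ; w z w∈ (inj₂ ()) }) (λ { z () }) h)
    (ℕₚ.≤-reflexive (sym (ℕₚ.+-suc (length P) t)))
    where
    root′ : v ≡ r ⊎ r ∈ P → r ∈ v ∷ P
    root′ (inj₁ e) = here (sym e)
    root′ (inj₂ p) = there p
  die-size (suc t) x r v [] [] D P cover root closed tested h = ℕₚ.≤-trans
      (ℕₚ.≤-trans (count-mono {Q = φ} λ w e → trans (lab-least ends x φ respects (==⇒≡ e)) (∈⇒memb (root′ root))) (count-memb (v ∷ P)))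
      (ℕₚ.≤-trans (ℕ.s≤s (ℕₚ.m≤m+n (length P) t)) (ℕₚ.≤-reflexive (sym (ℕₚ.+-suc (length P) t))))
    where
    φ : Fin n → Bool
    φ w = memb w (v ∷ P)
    root′ : v ≡ r ⊎ r ∈ P → r ∈ v ∷ P
    root′ (inj₁ e) = here (sym e)
    root′ (inj₂ p) = there p
    outside : ∀ z → φ z ≡ false → z ∈ D
    outside z e with cover z
    ... | here refl with trans (sym e) (∈⇒memb {xs = v ∷ P} (here refl))
    ...   | ()
    outside z e | there p with ∈-++⁻ D p
    ...   | inj₁ q = q
    ...   | inj₂ q with trans (sym e) (∈⇒memb {xs = v ∷ P} (there q))
    ...     | ()
    no-edge : ∀ w z → φ w ≡ true → φ z ≡ false → adj x w z ≡ false
    no-edge w z ew ez with memb⇒∈ (v ∷ P) ew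
    ... | here refl = tested z (outside z ez)
    ... | there w∈P = closed w z w∈P (inj₂ (outside z ez))
    respects : Respects ends x φ
    respects k on with φ (proj₁ (ends k)) in e₁ | φ (proj₂ (ends k)) in e₂
    ... | true | true = refl
    ... | false | false = refl
    ... | true | false with trans (sym on) (trans (sym (adj-edge x k _ _ (inj₁ refl))) (no-edge _ _ e₁ e₂))
    ...   | ()
    respects k on | false | true with trans (sym on) (trans (sym (adj-edge x k _ _ (inj₂ refl))) (no-edge _ _ e₂ e₁))
    ...   | ()

module Start (n : ℕ) (v : Fin (suc n)) where
  open Pairs (suc n)
  open Exploration (suc n)

  others : List (Fin (suc n))
  others = List.tabulate (punchIn v)

  length-others : length others ≡ n
  length-others = Listₚ.length-tabulate (punchIn v)

  distinct : Distinct v [] others [] []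
  distinct = Allₚ.++⁺ (Allₚ.tabulate⁺ (λ i e → Finₚ.punchInᵢ≢i v i (sym e))) [] ∷ subst Unique (sym (Listₚ.++-identityʳ others)) (tabulate⁺ (Finₚ.punchIn-injective v _ _))

  cover : ∀ w → w ∈ v ∷ [] ++ others ++ [] ++ []
  cover w with v Finₚ.≟ w
  ... | yes refl = here refl
  ... | no v≢w = there (∈-++⁺ˡ (subst (_∈ others) (Finₚ.punchIn-punchOut v≢w) (∈-tabulate⁺ (punchOut v≢w))))

  big-explore : ∀ t x → big ends (suc t) x v ≡ explore t x v [] others []
  big-explore t x with explore t x v [] others [] in eq
  ... | true = ≤⇒leb (survive-size t x v v [] others [] [] distinct (≡⇒== {i = lab ends x v} refl) [] [] eq)
  ... | false = <⇒leb (ℕ.s≤s (die-size t x v v [] others [] [] cover (inj₁ refl) (λ _ _ ()) (λ _ ()) eq))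

ι-bit : ∀ b → ι (bit b) ≡ 𝟙 b
ι-bit true = ι1
ι-bit false = ι0

ι-sum : ∀ {n} (f : Fin n → ℕ) → ι (sum f) ≡ Σ (λ i → ι (f i))
ι-sum {zero} f = ι0
ι-sum {suc n} f = trans (ι-+ (f zero) _) (cong (ι (f zero) +_) (ι-sum (f ∘ suc)))

Σ-cong : ∀ {n} {f g : Fin n → ℚ} → (∀ i → f i ≡ g i) → Σ f ≡ Σ g
Σ-cong {zero} h = refl
Σ-cong {suc n} h = cong₂ _+_ (h zero) (Σ-cong (h ∘ suc))

ι-count : ∀ {n} (P : Fin n → Bool) → ι (count P) ≡ Σ (λ i → 𝟙 (P i))
ι-count P = trans (cong ι (count-def P)) (trans (ι-sum (λ i → bit (P i))) (Σ-cong λ i → ι-bit (P i)))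

Σ-const : ∀ n c → Σ {n} (λ _ → c) ≡ ι n * c
Σ-const zero c = sym (trans (cong (_* c) ι0) (ℚₚ.*-zeroˡ c))
Σ-const (suc n) c = trans (cong (c +_) (Σ-const n c)) (trans (solve 2 (λ n c → c :+ n :* c := (con 1ℚ :+ n) :* c) refl (ι n) c) (cong (_* c) (sym (ι-suc n))))

E-count : ∀ p {m n} (P : Fin n → Vec Bool m → Bool) → E p (λ x → ι (count (λ i → P i x))) ≡ Σ (λ i → E p (λ x → 𝟙 (P i x)))
E-count p {m} {n} P = trans (E-cong p λ x → ι-count (λ i → P i x)) (E-Σ p n (λ i x → 𝟙 (P i x)))

E-not : ∀ p {m} (P : Vec Bool m → Bool) → E p (λ x → 𝟙 (P x)) ≡ 1ℚ - E p (λ x → 𝟙 (not (P x)))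
E-not p {m} P = trans (E-cong p λ x → lem (P x)) (trans (E-- p (λ _ → 1ℚ) (λ x → 𝟙 (not (P x)))) (cong (_- E p (λ x → 𝟙 (not (P x)))) (E-const p m 1ℚ)))
  where
  lem : ∀ b → 𝟙 b ≡ 1ℚ - 𝟙 (not b)
  lem true = refl
  lem false = refl

bernoulli : ∀ {a} → 0ℚ ≤ a → a ≤ 1ℚ → ∀ n → 1ℚ - ι n * a ≤ pow (1ℚ - a) n
bernoulli {a} 0≤a a≤1 zero = ≤-by (ι 0 * a) (≤-reflexive (sym (trans (cong (_* a) ι0) (ℚₚ.*-zeroˡ a)))) (solve 1 (λ x → con 1ℚ := (con 1ℚ :- x) :+ x) refl (ι 0 * a))
bernoulli {a} 0≤a a≤1 (suc n) = ≤-trans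
  (≤-by (ι n * (a * a)) (0≤* (0≤ι n) (0≤² a)) (trans (solve 2 (λ n a → (con 1ℚ :- a) :* (con 1ℚ :- n :* a) := (con 1ℚ :- (con 1ℚ :+ n) :* a) :+ n :* (a :* a)) refl (ι n) a)
    (cong (λ z → (1ℚ - z * a) + ι n * (a * a)) (sym (ι-suc n)))))
  (*-monoʳ (1ℚ - a) (0≤-diff a≤1) (bernoulli 0≤a a≤1 n))

-- A rational stand-in for `(1 - a)^n ≤ exp(-n a)`; the growth of the linear factor is all that is
-- used.
pow-decay : ∀ {a} → 0ℚ ≤ a → a ≤ 1ℚ → ∀ n → pow (1ℚ - a) n * (1ℚ + ι n * a) ≤ 1ℚ
pow-decay {a} 0≤a a≤1 zero = ≤-reflexive (trans (cong (λ z → 1ℚ * (1ℚ + z * a)) ι0) (solve 1 (λ a → con 1ℚ :* (con 1ℚ :+ con 0ℚ :* a) := con 1ℚ) refl a))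
pow-decay {a} 0≤a a≤1 (suc n) = ≤-trans
  (≤-by (pow (1ℚ - a) n * ((1ℚ + ι n) * (a * a))) (0≤* (pow-0≤ (0≤-diff a≤1) n) (0≤* (0≤+ 0≤1 (0≤ι n)) (0≤² a)))
    (trans (solve 3 (λ x n a → x :* (con 1ℚ :+ n :* a) := (con 1ℚ :- a) :* x :* (con 1ℚ :+ (con 1ℚ :+ n) :* a) :+ x :* ((con 1ℚ :+ n) :* (a :* a))) refl (pow (1ℚ - a) n) (ι n) a)
      (cong (λ z → pow (1ℚ - a) (suc n) * (1ℚ + z * a) + pow (1ℚ - a) n * ((1ℚ + ι n) * (a * a))) (sym (ι-suc n)))))
  (pow-decay 0≤a a≤1 n)

pow-small : ∀ {a e} → 0ℚ < a → a ≤ 1ℚ → 0ℚ < e → ∃ λ t → pow (1ℚ - a) t ≤ e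
pow-small {a} {e} 0<a a≤1 0<e = t , *-cancelˡ {x} {e} (a * ι t) 0<at (begin
  a * ι t * x          ≤⟨ ≤-by x (pow-0≤ (0≤-diff a≤1) t) (solve 3 (λ x n a → x :* (con 1ℚ :+ n :* a) := a :* n :* x :+ x) refl x (ι t) a) ⟩
  x * (1ℚ + ι t * a)   ≤⟨ pow-decay (<⇒≤ 0<a) a≤1 t ⟩
  1ℚ                   ≤⟨ 1≤eat ⟩
  e * a * ι t          ≡⟨ solve 3 (λ e a n → e :* a :* n := a :* n :* e) refl e a (ι t) ⟩
  a * ι t * e ∎)
  where
  open ℚₚ.≤-Reasoning
  large = eventually-≤ 1ℚ (e * a) (0<* 0<e 0<a)
  t = proj₁ large
  x = pow (1ℚ - a) t
  1≤eat : 1ℚ ≤ e * a * ι t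
  1≤eat = proj₂ large t ℕₚ.≤-refl
  0<t : 0ℚ < ι t
  0<t = ℚₚ.≰⇒> λ t≤0 → ℚₚ.<-irrefl refl (ℚₚ.<-≤-trans 0<1 (≤-trans 1≤eat
          (≤-trans (*-monoʳ (e * a) (<⇒≤ (0<* 0<e 0<a)) t≤0) (≤-reflexive (ℚₚ.*-zeroʳ (e * a))))))
  0<at : 0ℚ < a * ι t
  0<at = 0<* 0<a 0<t

-- Moments of component counts and of the distance

module RandomGraph (n : ℕ) where
  open Pairs (suc n) public
  open Exploration (suc n) public using (module Potential)

  N : ℚ
  N = ι (suc n)

  0≤N : 0ℚ ≤ N
  0≤N = 0≤ι (suc n)

  0<N : 0ℚ < N
  0<N = 0<ι-suc n

  ι#pairs-≤ : ι #pairs ≤ N * N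
  ι#pairs-≤ = ≤-trans (ι-mono #pairs-≤) (≤-reflexive (ι-* (suc n) (suc n)))

  module _ {p h} (pr : IsProb p) (0≤h : 0ℚ ≤ h) (h≤1 : h ≤ 1ℚ) where
    open Potential pr 0≤h h≤1

    E-#big-≥ : ∀ M t → pow s M ≤ θ → M ℕ.+ t ℕ.≤ n → N * h ≤ E p (λ x → ι (#big ends (suc t) x))
    E-#big-≥ M t hyp len = ≤-trans (≤-reflexive (sym (Σ-const (suc n) h))) (≤-trans (Σ-mono each) (≤-reflexive (sym (E-count p (λ v x → big ends (suc t) x v)))))
      where
      each : ∀ v → h ≤ E p (λ x → 𝟙 (big ends (suc t) x v))
      each v = ≤-trans (≤-by (1ℚ - h - e) (0≤-diff die) (solve 2 (λ h e → con 1ℚ :- e := h :+ (con 1ℚ :- h :- e)) refl h e))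
                 (≤-reflexive (trans (sym (E-not p (λ x → Exploration.explore (suc n) t x v [] others []))) (E-cong p λ x → cong 𝟙 (sym (big-explore t x)))))
        where
        open Start n v
        e = E p (λ x → 𝟙 (not (Exploration.explore (suc n) t x v [] others [])))
        len′ : M ℕ.+ t ℕ.≤ length others ℕ.+ 0
        len′ = ℕₚ.≤-trans len (ℕₚ.≤-reflexive (sym (trans (ℕₚ.+-identityʳ _) length-others)))
        die : e ≤ θ
        die = ≤-trans (die-≤ M hyp t v [] others [] [] distinct len′)
          (≤-trans (≤-reflexive (trans (ℚₚ.*-identityˡ _) (cong (pow s) length-others))) (≤-trans (pow-anti 0≤s s≤1 (ℕₚ.≤-trans (ℕₚ.m≤m+n M t) len)) hyp))

    E-#big-≤ : ∀ {ρ} t → 0ℚ ≤ ρ → ρ ≤ 1ℚ → θ ≤ ρ * pow s n → E p (λ x → ι (#big ends (suc t) x)) ≤ N * (h + pow ρ t)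
    E-#big-≤ {ρ} t 0≤ρ ρ≤1 hyp = ≤-trans (≤-reflexive (E-count p (λ v x → big ends (suc t) x v))) (≤-trans (Σ-mono each) (≤-reflexive (Σ-const (suc n) (h + pow ρ t))))
      where
      each : ∀ v → E p (λ x → 𝟙 (big ends (suc t) x v)) ≤ h + pow ρ t
      each v = begin
        E p (λ x → 𝟙 (big ends (suc t) x v))
          ≡⟨ E-cong p (λ x → cong 𝟙 (big-explore t x)) ⟩
        E p (λ x → 𝟙 (Exploration.explore (suc n) t x v [] others []))
          ≤⟨ survive-≤ n 0≤ρ ρ≤1 hyp t v [] others [] [] distinct (ℕₚ.≤-reflexive (trans (ℕₚ.+-identityʳ _) length-others)) ⟩
        (1ℚ - weight 0 (length others)) + pow ρ t
          ≡⟨ cong (λ k → (1ℚ - weight 0 k) + pow ρ t) length-others ⟩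
        (1ℚ - weight 0 n) + pow ρ t
          ≤⟨ ≤-by (S - θ) (0≤-diff θ≤S) (solve 3 (λ h s r → h :+ r := (con 1ℚ :- con 1ℚ :* s) :+ r :+ (s :- (con 1ℚ :- h))) refl h S (pow ρ t)) ⟩
        h + pow ρ t ∎
        where
        open ℚₚ.≤-Reasoning
        open Start n v
        S = pow s n
        θ≤S : θ ≤ S
        θ≤S = ≤-trans hyp (≤-trans (*-monoˡ S (pow-0≤ 0≤s n) ρ≤1) (≤-reflexive (ℚₚ.*-identityˡ S)))

  #big-Δ-≤ : ∀ L k x → Δ (λ x → ι (#big ends L x)) k x ≤ ι (L ℕ.+ L)
  #big-Δ-≤ L k x = diff-≤ (≤-trans (0≤-diff (≤-trans (ι-mono (Toggle.#big-Lipschitz ends x k L)) (≤-reflexive (ι-+ _ (L ℕ.+ L)))))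
    (≤-reflexive (solve 3 (λ a b c → (a :+ c) :- b := c :- (b :- a)) refl (ι (#big ends L (x [ k ]≔ false))) (ι (#big ends L (x [ k ]≔ true))) (ι (L ℕ.+ L)))))

  #big-Δ-≥ : ∀ L k x → - ι (L ℕ.+ L) ≤ Δ (λ x → ι (#big ends L x)) k x
  #big-Δ-≥ L k x = ≤-trans (≤-by (ι (L ℕ.+ L)) (0≤ι (L ℕ.+ L)) (sym (ℚₚ.+-inverseˡ (ι (L ℕ.+ L))))) (0≤-diff (ι-mono (Toggle.#big-mono ends x k L)))

  #big-variance : ∀ {p} → IsProb p → ∀ L → let X = λ x → ι (#big ends L x) in
    E p (λ x → X x * X x) ≤ E p X * E p X + ι #pairs * (p * (ι (L ℕ.+ L) * ι (L ℕ.+ L)))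
  #big-variance pr L = efron-stein pr (λ x → ι (#big ends L x)) (ι (L ℕ.+ L)) (#big-Δ-≤ L) (#big-Δ-≥ L)

  D : Vec Bool #pairs → ℚ
  D x = ι (distBP {suc n} x)

  0≤D : ∀ x → 0ℚ ≤ D x
  0≤D x = 0≤ι (distBP {suc n} x)

  distBP-mono : ∀ k x → distBP {suc n} (x [ k ]≔ false) ℕ.≤ distBP {suc n} (x [ k ]≔ true)
  distBP-mono k x with distBP-attained (x [ k ]≔ true)
  ... | σ , h = ℕₚ.≤-trans (distBP-≤ (x [ k ]≔ false) σ) (ℕₚ.≤-trans (Toggle.viol-mono ends x k σ) h)

  joined : Fin #pairs → Vec Bool #pairs → Bool
  joined k x = conn ends x (proj₁ (ends k)) (proj₂ (ends k))

  distBP-toggle : ∀ k x → distBP {suc n} (x [ k ]≔ true) ℕ.≤ distBP {suc n} (x [ k ]≔ false) ℕ.+ bit (joined k (x [ k ]≔ false))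
  distBP-toggle k x with distBP-attained (x [ k ]≔ false)
  ... | σ , h with Toggle.viol-toggle ends x k σ
  ... | τ , h′ = ℕₚ.≤-trans (distBP-≤ (x [ k ]≔ true) τ) (ℕₚ.≤-trans h′ (ℕₚ.+-monoˡ-≤ _ h))

  𝟙-mono : ∀ {a b} → (a ≡ true → b ≡ true) → 𝟙 a ≤ 𝟙 b
  𝟙-mono {true} h rewrite h refl = ≤-refl
  𝟙-mono {false} {b} h = 0≤𝟙 b

  joined-mono : ∀ k x y → x ⊑ y → 𝟙 (joined k x) ≤ 𝟙 (joined k y)
  joined-mono k x y x⊑y = 𝟙-mono λ e → ≡⇒== (lab-mono ends x y x⊑y (==⇒≡ e))

  D-Monotone : Monotone D
  D-Monotone k x = ι-mono (distBP-mono k x)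

  -- The increment is bounded in terms of `x` itself and not of `x` without the edge: this bound is
  -- monotone in the graph, as the interpolation requires, and sums to connected pairs of `x`.
  D-Δ : ∀ k x → Δ D k x ≤ 𝟙 (joined k x)
  D-Δ k x = begin
    D x₁ - D x₀
      ≤⟨ ℚₚ.+-monoˡ-≤ (- D x₀) (ι-mono (distBP-toggle k x)) ⟩
    ι (distBP {suc n} x₀ ℕ.+ bit J) - D x₀
      ≡⟨ cong (_- D x₀) (trans (ι-+ (distBP {suc n} x₀) (bit J)) (cong (D x₀ +_) (ι-bit J))) ⟩
    (D x₀ + 𝟙 J) - D x₀
      ≡⟨ solve 2 (λ a c → (a :+ c) :- a := c) refl (D x₀) (𝟙 J) ⟩
    𝟙 J
      ≤⟨ joined-mono k x₀ x (false⊑ x k) ⟩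
    𝟙 (joined k x) ∎
    where
    open ℚₚ.≤-Reasoning
    x₀ = x [ k ]≔ false
    x₁ = x [ k ]≔ true
    J = joined k x₀

  D-variance : ∀ {p} → IsProb p → E p (λ x → D x * D x) ≤ E p D * E p D + ι #pairs * (p * (1ℚ * 1ℚ))
  D-variance pr = efron-stein pr D 1ℚ (λ k x → ≤-trans (D-Δ k x) (𝟙≤1 (joined k x)))
    (λ k x → ≤-trans (≤-by 1ℚ 0≤1 refl) (0≤-diff (D-Monotone k x)))

  E-joined : ∀ {p} → IsProb p → Σ (λ k → E p (λ x → 𝟙 (joined k x))) ≤ E p (λ x → ι (#conn ends x))
  E-joined {p} pr = ≤-trans (≤-reflexive (sym (E-count p joined))) (E-mono pr λ x → ι-mono (ℕₚ.≤-trans (count-pairs-≤ (λ e → conn ends x (proj₁ e) (proj₂ e))) ℕₚ.≤-refl))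

  E-D-interpolate : ∀ {p p′} → IsProb p → IsProb p′ → p′ ≤ p → E p D ≤ E p′ D + (p - p′) * E p (λ x → ι (#conn ends x))
  E-D-interpolate {p} {p′} pr pr′ p′≤p = ≤-trans (E-interpolate pr pr′ p′≤p D (λ k x → 𝟙 (joined k x)) D-Δ (λ k j x → joined-mono k (x [ j ]≔ false) (x [ j ]≔ true) (false⊑true x j)))
    (ℚₚ.+-monoʳ-≤ (E p′ D) (*-monoʳ (p - p′) (0≤-diff p′≤p) (E-joined pr)))

  E-0 : ∀ {m} (f : Vec Bool m → ℚ) → E 0ℚ f ≡ f (replicate m false)
  E-0 {zero} f = refl
  E-0 {suc m} f = trans (cong (mix 0ℚ (E 0ℚ (λ v → f (true ∷ v)))) (E-0 (λ v → f (false ∷ v))))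
    (solve 2 (λ a b → con 0ℚ :* a :+ (con 1ℚ :- con 0ℚ) :* b := b) refl (E 0ℚ (λ v → f (true ∷ v))) (f (false ∷ replicate m false)))

  E-D-0 : E 0ℚ D ≡ 0ℚ
  E-D-0 = trans (E-0 D) (trans (cong ι (ℕₚ.n≤0⇒n≡0 (ℕₚ.≤-trans (distBP-≤ (replicate #pairs false) (λ _ → true))
    (ℕₚ.≤-reflexive (count-none λ k → cong (_∧ agree (λ _ → true) (ends k)) (Vecₚ.lookup-replicate k false)))))) ι0)

  isProb-0 : IsProb 0ℚ
  isProb-0 = isProb ≤-refl 0≤1

  E-D-≤ : ∀ {p} → IsProb p → E p D ≤ p * E p (λ x → ι (#conn ends x))
  E-D-≤ {p} pr = ≤-trans (E-D-interpolate pr isProb-0 (IsProb.0≤p pr)) (≤-reflexive (trans (cong (_+ (p - 0ℚ) * C) E-D-0) (solve 2 (λ p c → con 0ℚ :+ (p :- con 0ℚ) :* c := p :* c) refl p C)))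
    where C = E p (λ x → ι (#conn ends x))

-- Upper bound on the expected distance

8ℚ = toℚ 8
82ℚ = toℚ 82

0≤8 : 0ℚ ≤ 8ℚ
0≤8 = ℚₚ.nonNegative⁻¹ 8ℚ

module SparseConnections (n : ℕ) {ε p : ℚ} (0<ε : 0ℚ < ε) (8ε≤1 : 8ℚ * ε ≤ 1ℚ) (pr : IsProb p) (pN : p * ι (suc n) ≡ 1ℚ + ε) where
  open RandomGraph n

  0≤ε : 0ℚ ≤ ε
  0≤ε = <⇒≤ 0<ε

  -- `h` is an upper guess for the probability of lying in a large component. The factor 8 makes the
  -- quadratic gain `h²/4 = 16 ε²` in `b * b` exceed the loss `ε h = 8 ε²`; `ρ` spends the surplus.
  h ρ b : ℚ
  h = 8ℚ * ε
  ρ = 1ℚ - 8ℚ * (ε * ε)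
  b = 1ℚ - ½ * (1ℚ + ε) * h

  0≤h : 0ℚ ≤ h
  0≤h = 0≤* 0≤8 0≤ε

  ε≤1 : ε ≤ 1ℚ
  ε≤1 = ≤-trans (≤-by (toℚ 7 * ε) (0≤* (0≤toℚ 7) 0≤ε) (solve 1 (λ e → con 8ℚ :* e := e :+ con (toℚ 7) :* e) refl ε)) 8ε≤1

  open Potential pr 0≤h 8ε≤1

  0≤8ε² : 0ℚ ≤ 8ℚ * (ε * ε)
  0≤8ε² = 0≤* 0≤8 (0≤² ε)

  8ε²≤1 : 8ℚ * (ε * ε) ≤ 1ℚ
  8ε²≤1 = ≤-trans (≤-by (h * (1ℚ - ε)) (0≤* 0≤h (0≤-diff ε≤1)) (solve 1 (λ e → con 8ℚ :* e := con 8ℚ :* (e :* e) :+ con 8ℚ :* e :* (con 1ℚ :- e)) refl ε)) 8ε≤1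

  0≤b : 0ℚ ≤ b
  0≤b = ≤-trans (0≤+ (0≤-diff 8ε≤1) (0≤* (0≤* 0≤½ 0≤h) (0≤-diff ε≤1))) (≤-reflexive (solve 1 (λ e → (con 1ℚ :- con 8ℚ :* e) :+ con ½ :* (con 8ℚ :* e) :* (con 1ℚ :- e) := con 1ℚ :- con ½ :* (con 1ℚ :+ e) :* (con 8ℚ :* e)) refl ε))

  b≤1 : b ≤ 1ℚ
  b≤1 = ≤-by (½ * (1ℚ + ε) * h) (0≤* (0≤* 0≤½ (0≤+ 0≤1 0≤ε)) 0≤h) (solve 1 (λ x → con 1ℚ := (con 1ℚ :- x) :+ x) refl (½ * (1ℚ + ε) * h))

  M : ℕ
  M = ⌊ suc n /2⌋

  2M≤N : ι M + ι M ≤ N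
  2M≤N = ≤-trans (≤-reflexive (sym (ι-+ M M))) (ι-mono (ℕₚ.≤-trans (ℕₚ.+-monoʳ-≤ M (ℕₚ.⌊n/2⌋≤⌈n/2⌉ (suc n))) (ℕₚ.≤-reflexive (ℕₚ.⌊n/2⌋+⌈n/2⌉≡n (suc n)))))

  n≤2M : n ℕ.≤ M ℕ.+ M
  n≤2M = ℕₚ.≤-trans (ℕₚ.≤-reflexive (sym (ℕₚ.⌊n/2⌋+⌈n/2⌉≡n n))) (ℕₚ.+-monoˡ-≤ M (ℕₚ.⌊n/2⌋-mono (ℕₚ.n≤1+n n)))

  b≤pow : b ≤ pow s M
  b≤pow = ≤-trans (≤-by (½ * (p * h) * (N - (ι M + ι M))) (0≤* (0≤* 0≤½ (0≤* (IsProb.0≤p pr) 0≤h)) (0≤-diff 2M≤N))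
      (trans (solve 4 (λ p h N M → con 1ℚ :- M :* (p :* h) := con 1ℚ :- con ½ :* (p :* N) :* h :+ con ½ :* (p :* h) :* (N :- (M :+ M))) refl p h N (ι M))
        (cong (λ z → 1ℚ - ½ * z * h + ½ * (p * h) * (N - (ι M + ι M))) pN)))
    (bernoulli (0≤* (IsProb.0≤p pr) 0≤h) (*≤1 (IsProb.0≤p pr) (IsProb.p≤1 pr) 8ε≤1) M)

  -- Bernoulli at the full exponent would lose the quadratic term that `θ≤ρpow` needs. At half the
  -- exponent, followed by squaring, a quarter of `(p N h)²` survives. `M` is rounded so that both
  -- `M + M ≤ n + 1` and `n ≤ M + M` hold.
  b²≤pow : b * b ≤ pow s n
  b²≤pow = ≤-trans (*-mono 0≤b (pow-0≤ 0≤s M) b≤pow b≤pow) (≤-trans (≤-reflexive (sym (pow-+ s M M))) (pow-anti 0≤s s≤1 n≤2M))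

  0≤ρ : 0ℚ ≤ ρ
  0≤ρ = 0≤-diff 8ε²≤1

  ρ≤1 : ρ ≤ 1ℚ
  ρ≤1 = ≤-by (8ℚ * (ε * ε)) 0≤8ε² (solve 1 (λ x → con 1ℚ := (con 1ℚ :- x) :+ x) refl (8ℚ * (ε * ε)))

  -- With c = 1 + ε, (1 - ch/2)² exceeds 1 - h by a multiple of ε² because of its quadratic term.
  θ≤ρpow : θ ≤ ρ * pow s n
  θ≤ρpow = ≤-trans (≤-by (8ℚ * (ε * ε) * (1ℚ - b * b) + toℚ 32 * (ε * ε * ε) + toℚ 16 * (ε * ε * (ε * ε)))
      (0≤+ (0≤+ (0≤* 0≤8ε² (0≤-diff (*≤1 0≤b b≤1 b≤1)))
                (0≤* (0≤toℚ 32) (0≤* (0≤² ε) 0≤ε)))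
           (0≤* (0≤toℚ 16) (0≤² (ε * ε))))
      (solve 1 (λ e → let b = con 1ℚ :- con ½ :* (con 1ℚ :+ e) :* (con 8ℚ :* e) in
         (con 1ℚ :- con 8ℚ :* (e :* e)) :* (b :* b) := (con 1ℚ :- con 8ℚ :* e) :+ (con 8ℚ :* (e :* e) :* (con 1ℚ :- b :* b) :+ con (toℚ 32) :* (e :* e :* e) :+ con (toℚ 16) :* (e :* e :* (e :* e)))) refl ε))
    (*-monoʳ ρ 0≤ρ b²≤pow)

  module _ (t : ℕ) (ρᵗ≤ε : pow ρ t ≤ ε) (large : 8ℚ * (ι (suc t) * ι (suc t)) + ι (suc t) ≤ ε * ε * N) where
    private
      L = suc t
      l = ι L
      X = λ x → ι (#big ends L x)

    EX≤ : E p X ≤ N * (toℚ 9 * ε)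
    EX≤ = ≤-trans (E-#big-≤ pr 0≤h 8ε≤1 t 0≤ρ ρ≤1 θ≤ρpow) (*-monoʳ N 0≤N (≤-trans (ℚₚ.+-monoʳ-≤ h ρᵗ≤ε) (≤-reflexive (solve 1 (λ e → con 8ℚ :* e :+ e := con (toℚ 9) :* e) refl ε))))

    0≤EX : 0ℚ ≤ E p X
    0≤EX = 0≤E pr (λ x → 0≤ι (#big ends L x))

    noise : ι #pairs * (p * (ι (L ℕ.+ L) * ι (L ℕ.+ L))) ≤ N * (8ℚ * (l * l))
    noise = begin
      ι #pairs * (p * (ι (L ℕ.+ L) * ι (L ℕ.+ L)))
        ≤⟨ *-monoˡ (p * (ι (L ℕ.+ L) * ι (L ℕ.+ L))) (0≤* (IsProb.0≤p pr) (0≤² (ι (L ℕ.+ L)))) ι#pairs-≤ ⟩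
      N * N * (p * (ι (L ℕ.+ L) * ι (L ℕ.+ L)))
        ≡⟨ cong (λ z → N * N * (p * (z * z))) (ι-+ L L) ⟩
      N * N * (p * ((l + l) * (l + l)))
        ≡⟨ solve 3 (λ N p l → N :* N :* (p :* ((l :+ l) :* (l :+ l))) := N :* (p :* N :* (con (toℚ 4) :* (l :* l)))) refl N p l ⟩
      N * (p * N * (toℚ 4 * (l * l)))
        ≡⟨ cong (λ z → N * (z * (toℚ 4 * (l * l)))) pN ⟩
      N * ((1ℚ + ε) * (toℚ 4 * (l * l)))
        ≤⟨ *-monoʳ N 0≤N (≤-by ((1ℚ - ε) * (toℚ 4 * (l * l))) (0≤* (0≤-diff ε≤1) (0≤* (0≤toℚ 4) (0≤² l)))
             (solve 2 (λ e l → con 8ℚ :* (l :* l) := (con 1ℚ :+ e) :* (con (toℚ 4) :* (l :* l)) :+ (con 1ℚ :- e) :* (con (toℚ 4) :* (l :* l))) refl ε l)) ⟩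
      N * (8ℚ * (l * l)) ∎
      where open ℚₚ.≤-Reasoning

    -- The mean of `X` is at most `9 ε N`, whose square gives `81 ε² N²`. For large `N` the variance
    -- and the pairs in small components together fit into one further `ε² N²`.
    E-#conn-small : E p (λ x → ι (#conn ends x)) ≤ 82ℚ * (ε * ε) * (N * N)
    E-#conn-small = begin
      E p (λ x → ι (#conn ends x))
        ≤⟨ E-mono pr (λ x → ≤-trans (ι-mono (#conn-≤ ends L x)) (≤-reflexive (trans (ι-+ (#big ends L x ℕ.* #big ends L x) (suc n ℕ.* L)) (cong₂ _+_ (ι-* (#big ends L x) (#big ends L x)) (ι-* (suc n) L))))) ⟩
      E p (λ x → X x * X x + N * l)
        ≡⟨ trans (E-+ p (λ x → X x * X x) (λ _ → N * l)) (cong (λ z → E p (λ x → X x * X x) + z) (E-const p #pairs (N * l))) ⟩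
      E p (λ x → X x * X x) + N * l
        ≤⟨ ℚₚ.+-monoˡ-≤ (N * l) (≤-trans (#big-variance pr L) (+-mono-≤ (*-mono 0≤EX (≤-trans 0≤EX EX≤) EX≤ EX≤) noise)) ⟩
      N * (toℚ 9 * ε) * (N * (toℚ 9 * ε)) + N * (8ℚ * (l * l)) + N * l
        ≡⟨ solve 3 (λ N e l → N :* (con (toℚ 9) :* e) :* (N :* (con (toℚ 9) :* e)) :+ N :* (con 8ℚ :* (l :* l)) :+ N :* l
             := con (toℚ 81) :* (e :* e) :* (N :* N) :+ N :* (con 8ℚ :* (l :* l) :+ l)) refl N ε l ⟩
      toℚ 81 * (ε * ε) * (N * N) + N * (8ℚ * (l * l) + l)
        ≤⟨ ℚₚ.+-monoʳ-≤ (toℚ 81 * (ε * ε) * (N * N)) (*-monoʳ N 0≤N large) ⟩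
      toℚ 81 * (ε * ε) * (N * N) + N * (ε * ε * N)
        ≡⟨ solve 2 (λ N e → con (toℚ 81) :* (e :* e) :* (N :* N) :+ N :* (e :* e :* N) := con 82ℚ :* (e :* e) :* (N :* N)) refl N ε ⟩
      82ℚ * (ε * ε) * (N * N) ∎
      where open ℚₚ.≤-Reasoning

E-#conn-≤ : ∀ ε → 0ℚ < ε → ∃ λ n₀ → ∀ n → suc n ℕ.≥ n₀ → ∀ p → IsProb p → p * ι (suc n) ≡ 1ℚ + ε →
  let open RandomGraph n in E p (λ x → ι (#conn ends x)) ≤ 82ℚ * (ε * ε) * (N * N)
E-#conn-≤ ε 0<ε with ℚₚ.≤-total (8ℚ * ε) 1ℚ
-- Here `8ε` may exceed 1 and cannot serve as a guessed probability, but the trivial bound by all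
-- pairs suffices because `64 ε² ≥ 1`.
... | inj₂ 1≤8ε = 0 , λ n _ p pr pN → let open RandomGraph n in begin
    E p (λ x → ι (#conn ends x))
      ≤⟨ E-mono pr (λ x → ≤-trans (ι-mono (sum-≤ {suc n} (size ends x) (suc n) (λ u → count-≤ (λ w → conn ends x w u)))) (≤-reflexive (ι-* (suc n) (suc n)))) ⟩
    E p {#pairs} (λ x → N * N)
      ≡⟨ E-const p #pairs (N * N) ⟩
    N * N
      ≤⟨ ≤-by ((8ℚ * ε * (8ℚ * ε) - 1ℚ * 1ℚ) * (N * N) + toℚ 18 * (ε * ε) * (N * N))
           (0≤+ (0≤* (0≤-diff (*-mono 0≤1 (≤-trans 0≤1 1≤8ε) 1≤8ε 1≤8ε)) (0≤² N)) (0≤* (0≤* (0≤toℚ 18) (0≤² ε)) (0≤² N)))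
           (solve 2 (λ e N → con 82ℚ :* (e :* e) :* (N :* N) := N :* N :+ ((con 8ℚ :* e :* (con 8ℚ :* e) :- con 1ℚ :* con 1ℚ) :* (N :* N) :+ con (toℚ 18) :* (e :* e) :* (N :* N))) refl ε N) ⟩
    82ℚ * (ε * ε) * (N * N) ∎
  where open ℚₚ.≤-Reasoning
... | inj₁ 8ε≤1 = proj₁ big-n , λ n n≥ p pr pN → let open SparseConnections n 0<ε 8ε≤1 pr pN in
    E-#conn-small t ρᵗ≤ε (proj₂ big-n (suc n) n≥)
  where
  0<8 : 0ℚ < 8ℚ
  0<8 = ℚₚ.positive⁻¹ 8ℚ
  ε²-small : 8ℚ * (ε * ε) ≤ 1ℚ
  ε²-small = ≤-trans (≤-by (8ℚ * ε * (1ℚ - 8ℚ * ε) + toℚ 56 * (ε * ε)) (0≤+ (0≤* (0≤* 0≤8 (<⇒≤ 0<ε)) (0≤-diff 8ε≤1)) (0≤* (0≤toℚ 56) (0≤² ε)))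
     (solve 1 (λ e → con 8ℚ :* e := con 8ℚ :* (e :* e) :+ (con 8ℚ :* e :* (con 1ℚ :- con 8ℚ :* e) :+ con (toℚ 56) :* (e :* e))) refl ε)) 8ε≤1
  decay = pow-small {8ℚ * (ε * ε)} {ε} (0<* 0<8 (0<* 0<ε 0<ε)) ε²-small 0<ε
  t = proj₁ decay
  ρᵗ≤ε : pow (1ℚ - 8ℚ * (ε * ε)) t ≤ ε
  ρᵗ≤ε = proj₂ decay
  big-n = eventually-≤ (8ℚ * (ι (suc t) * ι (suc t)) + ι (suc t)) (ε * ε) (0<* 0<ε 0<ε)

-- Below density 1 + ε² there is hardly any excess; the remaining edges close cycles only inside large components.
E-D-upper : ∀ ε → 0ℚ < ε → ε < 1ℚ → ∃ λ n₀ → ∀ n → suc n ℕ.≥ n₀ → ∀ p → IsProb p → p * ι (suc n) ≡ 1ℚ + ε →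
  let open RandomGraph n in E p D ≤ toℚ 246 * (ε * ε * ε) * N
E-D-upper ε 0<ε ε<1 with E-#conn-≤ ε 0<ε | E-#conn-≤ (ε * ε) (0<* 0<ε 0<ε)
... | n₁ , bound₁ | n₂ , bound₂ = n₁ ℕ.+ n₂ , go
  where
  go : ∀ n → suc n ℕ.≥ n₁ ℕ.+ n₂ → ∀ p → IsProb p → p * ι (suc n) ≡ 1ℚ + ε → let open RandomGraph n in E p D ≤ toℚ 246 * (ε * ε * ε) * N
  go n n≥ p pr pN = begin
    E p D
      ≤⟨ E-D-interpolate pr pr′ p′≤p ⟩
    E p′ D + (p - p′) * E p C
      ≤⟨ +-mono-≤ (≤-trans (E-D-≤ pr′) (*-monoʳ p′ (IsProb.0≤p pr′) (bound₂ n (ℕₚ.≤-trans (ℕₚ.m≤n+m n₂ n₁) n≥) p′ pr′ p′N)))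
                  (*-monoʳ (p - p′) (0≤-diff p′≤p) (bound₁ n (ℕₚ.≤-trans (ℕₚ.m≤m+n n₁ n₂) n≥) p pr pN)) ⟩
    p′ * (82ℚ * (e² * e²) * (N * N)) + (p - p′) * (82ℚ * e² * (N * N))
      ≡⟨ solve 4 (λ p q e N → q :* (con 82ℚ :* (e :* e) :* (N :* N)) :+ (p :- q) :* (con 82ℚ :* e :* (N :* N))
           := con 82ℚ :* N :* ((q :* N) :* (e :* e) :+ (p :* N :- q :* N) :* e)) refl p p′ e² N ⟩
    82ℚ * N * ((p′ * N) * (e² * e²) + (p * N - p′ * N) * e²)
      ≡⟨ cong₂ (λ y z → 82ℚ * N * (z * (e² * e²) + (y - z) * e²)) pN p′N ⟩
    82ℚ * N * ((1ℚ + e²) * (e² * e²) + ((1ℚ + ε) - (1ℚ + e²)) * e²)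
      -- The terms of order `ε⁴` cancel and leave `ε³ + ε⁶`, which is within `3 ε³`; hence
      -- `246 = 3 · 82`.
      ≤⟨ *-monoʳ (82ℚ * N) (0≤* (ℚₚ.nonNegative⁻¹ 82ℚ) 0≤N)
           (≤-by (e² * ε * ((1ℚ - ε * (ε * ε)) + 1ℚ)) (0≤* (0≤* (0≤² ε) 0≤ε) (0≤+ (0≤-diff ε³≤1) 0≤1))
             (solve 1 (λ e → con (toℚ 3) :* (e :* e :* e) := (con 1ℚ :+ e :* e) :* (e :* e :* (e :* e)) :+ ((con 1ℚ :+ e) :- (con 1ℚ :+ e :* e)) :* (e :* e)
                :+ e :* e :* e :* ((con 1ℚ :- e :* (e :* e)) :+ con 1ℚ)) refl ε)) ⟩
    82ℚ * N * (toℚ 3 * (ε * ε * ε))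
      ≡⟨ solve 2 (λ e N → con 82ℚ :* N :* (con (toℚ 3) :* (e :* e :* e)) := con (toℚ 246) :* (e :* e :* e) :* N) refl ε N ⟩
    toℚ 246 * (ε * ε * ε) * N ∎
    where
    open ℚₚ.≤-Reasoning
    open RandomGraph n
    C = λ x → ι (#conn ends x)
    e² = ε * ε
    0≤ε = <⇒≤ 0<ε
    ε≤1 = <⇒≤ ε<1
    ε²≤1 : e² ≤ 1ℚ
    ε²≤1 = *≤1 0≤ε ε≤1 ε≤1
    ε³≤1 : ε * (ε * ε) ≤ 1ℚ
    ε³≤1 = *≤1 0≤ε ε≤1 ε²≤1
    p′ = (1ℚ + e²) * (ℤ.+ 1 / suc n)
    p′N : p′ * N ≡ 1ℚ + e²
    p′N = trans (solve 3 (λ a r N → a :* r :* N := a :* (N :* r)) refl (1ℚ + e²) (ℤ.+ 1 / suc n) N) (trans (cong ((1ℚ + e²) *_) (*-recip n)) (ℚₚ.*-identityʳ (1ℚ + e²)))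
    p′≤p : p′ ≤ p
    p′≤p = *-cancelˡ {p′} {p} N 0<N (≤-trans (≤-reflexive (trans (ℚₚ.*-comm N p′) p′N)) (≤-trans (ℚₚ.+-monoʳ-≤ 1ℚ (≤-trans (*-monoʳ ε 0≤ε ε≤1) (≤-reflexive (ℚₚ.*-identityʳ ε)))) (≤-reflexive (sym (trans (ℚₚ.*-comm N p) pN)))))
    pr′ : IsProb p′
    pr′ = isProb (0≤* (0≤+ 0≤1 (0≤² ε)) (<⇒≤ (0<recip n))) (≤-trans p′≤p (IsProb.p≤1 pr))

-- Union bound over partial colourings

3ℚ 24ℚ ¼ℚ ⅛ℚ : ℚ
3ℚ = toℚ 3
24ℚ = toℚ 24
¼ℚ = ½ * ½
⅛ℚ = ½ * ¼ℚ

pow-* : ∀ a b n → pow (a * b) n ≡ pow a n * pow b n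
pow-* a b zero = refl
pow-* a b (suc n) = trans (cong (a * b *_) (pow-* a b n)) (solve 4 (λ a b x y → a :* b :* (x :* y) := a :* x :* (b :* y)) refl a b (pow a n) (pow b n))

pow-pow : ∀ a m n → pow a (m ℕ.* n) ≡ pow (pow a n) m
pow-pow a zero n = refl
pow-pow a (suc m) n = trans (pow-+ a n (m ℕ.* n)) (cong (pow a n *_) (pow-pow a m n))

pow-mono : ∀ {a b} → 0ℚ ≤ a → a ≤ b → ∀ n → pow a n ≤ pow b n
pow-mono 0≤a a≤b zero = ≤-refl
pow-mono 0≤a a≤b (suc n) = *-mono 0≤a (pow-0≤ (≤-trans 0≤a a≤b) n) a≤b (pow-mono 0≤a a≤b n)

0<pow : ∀ {a} → 0ℚ < a → ∀ n → 0ℚ < pow a n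
0<pow 0<a zero = 0<1
0<pow 0<a (suc n) = 0<* 0<a (0<pow 0<a n)

-- The sum over all partial colourings of J blocks.
Σπ : (J : ℕ) → (Vec (Maybe Bool) J → ℚ) → ℚ
Σπ zero f = f []
Σπ (suc J) f = Σπ J (λ π → f (nothing ∷ π)) + Σπ J (λ π → f (just true ∷ π)) + Σπ J (λ π → f (just false ∷ π))

Σπ-≤ : ∀ J (f : Vec (Maybe Bool) J → ℚ) c → (∀ π → f π ≤ c) → Σπ J f ≤ pow 3ℚ J * c
Σπ-≤ zero f c h = ≤-trans (h []) (≤-reflexive (sym (ℚₚ.*-identityˡ c)))
Σπ-≤ (suc J) f c h = ≤-trans (+-mono-≤ (+-mono-≤ (Σπ-≤ J _ c (λ π → h (nothing ∷ π))) (Σπ-≤ J _ c (λ π → h (just true ∷ π)))) (Σπ-≤ J _ c (λ π → h (just false ∷ π))))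
  (≤-reflexive (solve 2 (λ x c → x :* c :+ x :* c :+ x :* c := con 3ℚ :* x :* c) refl (pow 3ℚ J) c))

0≤Σπ : ∀ J (f : Vec (Maybe Bool) J → ℚ) → (∀ π → 0ℚ ≤ f π) → 0ℚ ≤ Σπ J f
0≤Σπ zero f h = h []
0≤Σπ (suc J) f h = 0≤+ (0≤+ (0≤Σπ J _ (λ π → h (nothing ∷ π))) (0≤Σπ J _ (λ π → h (just true ∷ π)))) (0≤Σπ J _ (λ π → h (just false ∷ π)))

Σπ-single : ∀ J (f : Vec (Maybe Bool) J → ℚ) → (∀ π → 0ℚ ≤ f π) → ∀ π → f π ≤ Σπ J f
Σπ-single zero f h [] = ≤-refl
Σπ-single (suc J) f h (m ∷ π) = choose m (Σπ-single J (λ π → f (m ∷ π)) (λ π → h (m ∷ π)) π)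
  where
  A = Σπ J (λ π → f (nothing ∷ π))
  B = Σπ J (λ π → f (just true ∷ π))
  C = Σπ J (λ π → f (just false ∷ π))
  0≤A = 0≤Σπ J (λ π → f (nothing ∷ π)) (λ π → h (nothing ∷ π))
  0≤B = 0≤Σπ J (λ π → f (just true ∷ π)) (λ π → h (just true ∷ π))
  0≤C = 0≤Σπ J (λ π → f (just false ∷ π)) (λ π → h (just false ∷ π))
  choose : ∀ m {y} → y ≤ Σπ J (λ π → f (m ∷ π)) → y ≤ A + B + C
  choose nothing y≤ = ≤-trans y≤ (≤-by (B + C) (0≤+ 0≤B 0≤C) (ℚₚ.+-assoc A B C))
  choose (just true) y≤ = ≤-trans y≤ (≤-by (A + C) (0≤+ 0≤A 0≤C) (solve 3 (λ a b c → a :+ b :+ c := b :+ (a :+ c)) refl A B C))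
  choose (just false) y≤ = ≤-trans y≤ (≤-by (A + B) (0≤+ 0≤A 0≤B) (solve 3 (λ a b c → a :+ b :+ c := c :+ (a :+ b)) refl A B C))

E-Σπ : ∀ p {m} J (f : Vec (Maybe Bool) J → Vec Bool m → ℚ) → E p (λ y → Σπ J (λ π → f π y)) ≡ Σπ J (λ π → E p (f π))
E-Σπ p zero f = refl
E-Σπ p (suc J) f = trans (E-+ p (λ y → S nothing y + S (just true) y) (S (just false)))
  (cong₂ _+_ (trans (E-+ p (S nothing) (S (just true))) (cong₂ _+_ (E-Σπ p J (λ π → f (nothing ∷ π))) (E-Σπ p J (λ π → f (just true ∷ π))))) (E-Σπ p J (λ π → f (just false ∷ π))))
  where
  S : Maybe Bool → _ → ℚ
  S m y = Σπ J (λ π → f (m ∷ π) y)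

nth : ∀ {J} → Vec (Maybe Bool) J → ℕ → Maybe Bool
nth [] j = nothing
nth (m ∷ π) zero = m
nth (m ∷ π) (suc j) = nth π j

tab : ∀ J → (ℕ → Maybe Bool) → Vec (Maybe Bool) J
tab zero f = []
tab (suc J) f = f 0 ∷ tab J (f ∘ suc)

nth-tab : ∀ {J} (f : ℕ → Maybe Bool) {j} → j ℕ.< J → nth (tab J f) j ≡ f j
nth-tab {suc J} f {zero} _ = refl
nth-tab {suc J} f {suc j} (ℕ.s≤s h) = nth-tab (f ∘ suc) h

-- By independence each marked pair contributes the factor `½ q + (1 - q) = 1 - ½ q`. This is the
-- exponential moment of a binomial variable, obtained as an identity.
E-½ : ∀ q {m} (S : Fin m → Bool) → E q (λ y → pow ½ (count (λ k → lookup y k ∧ S k))) ≡ pow (1ℚ - ½ * q) (count S)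
E-½ q {zero} S = trans (cong (pow ½) (count-none {0} (λ ()))) (cong (pow (1ℚ - ½ * q)) (sym (count-none {0} {S} (λ ()))))
E-½ q {suc m} S = trans (cong₂ (mix q) (trans (E-cong q (λ y → cong (pow ½) (count-suc (λ k → lookup (true ∷ y) k ∧ S k)))) (first (S zero)))
                                        (trans (E-cong q (λ y → cong (pow ½) (count-suc (λ k → lookup (false ∷ y) k ∧ S k)))) (E-½ q (S ∘ suc))))
  (trans (combine (S zero)) (cong (pow (1ℚ - ½ * q)) (sym (count-suc S))))
  where
  R = pow (1ℚ - ½ * q) (count (S ∘ suc))
  occupied : Vec Bool m → ℕ
  occupied y = count (λ k → lookup y k ∧ S (suc k))
  first : ∀ b → E q (λ y → pow ½ (bit b ℕ.+ occupied y)) ≡ pow ½ (bit b) * R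
  first b = trans (E-cong q λ y → pow-+ ½ (bit b) (occupied y)) (trans (E-* q (pow ½ (bit b)) (λ y → pow ½ (occupied y))) (cong (pow ½ (bit b) *_) (E-½ q (S ∘ suc))))
  combine : ∀ b → mix q (pow ½ (bit b) * R) R ≡ pow (1ℚ - ½ * q) (bit b ℕ.+ count (S ∘ suc))
  combine true = solve 2 (λ q r → q :* (con ½ :* con 1ℚ :* r) :+ (con 1ℚ :- q) :* r := (con 1ℚ :- con ½ :* q) :* r) refl q R
  combine false = solve 2 (λ q r → q :* (con 1ℚ :* r) :+ (con 1ℚ :- q) :* r := r) refl q R

sameM : Maybe Bool → Maybe Bool → Bool
sameM (just a) (just b) = not (a xor b)
sameM (just _) nothing = false
sameM nothing _ = false

sameM-comm : ∀ a b → sameM a b ≡ sameM b a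
sameM-comm (just a) (just b) = cong not (𝔹ₚ.xor-comm a b)
sameM-comm (just _) nothing = refl
sameM-comm nothing (just _) = refl
sameM-comm nothing nothing = refl

membℕ : ℕ → List ℕ → Bool
membℕ a [] = false
membℕ a (b ∷ bs) = (a ≡? b) ∨ membℕ a bs

membℕ⇒∉ : ∀ {a} bs → membℕ a bs ≡ false → a ∉ bs
membℕ⇒∉ {a} (b ∷ bs) h (here refl) rewrite ≡⇒≡? {a} refl with h
... | ()
membℕ⇒∉ {a} (b ∷ bs) h (there q) with a ≡? b
membℕ⇒∉ {a} (b ∷ bs) () (there q) | true
... | false = membℕ⇒∉ bs h q

-- The colour classes of sizes a and b give a² + b² ≥ (a + b)² / 2 ordered monochromatic pairs, n of which may be diagonal.
monochromatic : ∀ n (χ : Fin n → Maybe Bool) → let open Pairs n ; d = count (is-just ∘ χ) ; S = count (λ k → sameM (χ (proj₁ (ends k))) (χ (proj₂ (ends k)))) in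
  d ℕ.* d ℕ.≤ 4 ℕ.* S ℕ.+ 2 ℕ.* n
monochromatic n χ = begin
  d ℕ.* d
    ≤⟨ ℕₚ.*-mono-≤ d≤ d≤ ⟩
  (a ℕ.+ b) ℕ.* (a ℕ.+ b)
    ≤⟨ square a b ⟩
  2 ℕ.* (a ℕ.* a ℕ.+ b ℕ.* b)
    ≤⟨ ℕₚ.*-monoʳ-≤ 2 (ℕₚ.≤-trans (ℕₚ.≤-reflexive total) (count-pairs-≥ (λ e → sameM (χ (proj₁ e)) (χ (proj₂ e))) (λ i j → sameM-comm (χ i) (χ j)))) ⟩
  2 ℕ.* (S ℕ.+ S ℕ.+ n)
    ≡⟨ (λ S n → arith S n) S n ⟩
  4 ℕ.* S ℕ.+ 2 ℕ.* n ∎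
  where
  open ℕₚ.≤-Reasoning
  open Pairs n
  has : Bool → Fin n → Bool
  has b i = sameM (just b) (χ i)
  d = count (is-just ∘ χ)
  a = count (has true)
  b = count (has false)
  S = count (λ k → sameM (χ (proj₁ (ends k))) (χ (proj₂ (ends k))))
  arith : ∀ S n → 2 ℕ.* (S ℕ.+ S ℕ.+ n) ≡ 4 ℕ.* S ℕ.+ 2 ℕ.* n
  arith = ℕ-Solver.solve-∀
  d≤ : d ℕ.≤ a ℕ.+ b
  d≤ = ℕₚ.≤-trans (count-mono pw) (count-∨ (has true) (has false))
    where
    pw : ∀ i → is-just (χ i) ≡ true → has true i ∨ has false i ≡ true
    pw i h with χ i
    ... | just true = refl
    ... | just false = refl
  Mean : ℕ → ℕ → Set
  Mean a b = (a ℕ.+ b) ℕ.* (a ℕ.+ b) ℕ.≤ 2 ℕ.* (a ℕ.* a ℕ.+ b ℕ.* b)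
  complete : ∀ a c → (a ℕ.+ (a ℕ.+ c)) ℕ.* (a ℕ.+ (a ℕ.+ c)) ℕ.+ c ℕ.* c ≡ 2 ℕ.* (a ℕ.* a ℕ.+ (a ℕ.+ c) ℕ.* (a ℕ.+ c))
  complete = ℕ-Solver.solve-∀
  sorted : ∀ a b → a ℕ.≤ b → Mean a b
  sorted a b a≤b = subst (Mean a) (ℕₚ.m+[n∸m]≡n a≤b) (ℕₚ.≤-trans (ℕₚ.m≤m+n _ ((b ℕ.∸ a) ℕ.* (b ℕ.∸ a))) (ℕₚ.≤-reflexive (complete a (b ℕ.∸ a))))
  square : ∀ a b → Mean a b
  square a b with ℕₚ.≤-total a b
  ... | inj₁ a≤b = sorted a b a≤b
  ... | inj₂ b≤a = subst₂ ℕ._≤_ (cong (λ t → t ℕ.* t) (ℕₚ.+-comm b a)) (cong (2 ℕ.*_) (ℕₚ.+-comm (b ℕ.* b) (a ℕ.* a))) (sorted b a b≤a)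
  row : ∀ m → count (λ i → sameM (χ i) m) ≡ bit (sameM (just true) m) ℕ.* a ℕ.+ bit (sameM (just false) m) ℕ.* b
  row nothing = count-none λ i → sameM-comm (χ i) nothing
  row (just true) = trans (trans (count-cong (λ i → sameM-comm (χ i) (just true))) (sym (ℕₚ.+-identityʳ a))) (sym (ℕₚ.+-identityʳ (a ℕ.+ 0)))
  row (just false) = trans (count-cong (λ i → sameM-comm (χ i) (just false))) (sym (ℕₚ.+-identityʳ b))
  total : a ℕ.* a ℕ.+ b ℕ.* b ≡ sum (λ j → count (λ i → sameM (χ i) (χ j)))
  total = sym (trans (sum-cong-≗ {n} (λ j → row (χ j))) (trans (∑-distrib-+ (λ j → bit (has true j) ℕ.* a) (λ j → bit (has false j) ℕ.* b))
    (cong₂ ℕ._+_ (trans (sym (sum-*ʳ (bit ∘ has true) a)) (cong (ℕ._* a) (sym (count-def (has true)))))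
                 (trans (sym (sum-*ʳ (bit ∘ has false) b)) (cong (ℕ._* b) (sym (count-def (has false))))))))

⊑-∨ˡ : ∀ {m} (x y : Vec Bool m) → x ⊑ zipWith _∨_ x y
⊑-∨ˡ x y j h = trans (Vecₚ.lookup-zipWith _∨_ j x y) (cong (_∨ lookup y j) h)

⊑-∨ʳ : ∀ {m} (x y : Vec Bool m) → y ⊑ zipWith _∨_ x y
⊑-∨ʳ x y j h = trans (Vecₚ.lookup-zipWith _∨_ j x y) (trans (cong (lookup x j ∨_) h) (𝔹ₚ.∨-zeroʳ (lookup x j)))

viol-⊑ : ∀ {n m} (ends : Ends {n} m) y y′ → y ⊑ y′ → ∀ σ → viol ends y σ ℕ.≤ viol ends y′ σ
viol-⊑ ends y y′ h σ = count-mono λ j e → let p , r = ∧-elim {lookup y j} e in ∧-introˡ (h j p) r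

module UnionBound (n : ℕ) (K : ℕ) (1<K : 1 ℕ.< K) (x : Vec Bool (length (pairs n))) where
  open Pairs n
  open Decomposition ends x K 1<K

  χ : Vec (Maybe Bool) J → Fin n → Maybe Bool
  χ π v = if covered v then Maybe.map (τ v xor_) (nth π (loc v ℕ.∸ n)) else nothing

  marked : Vec (Maybe Bool) J → Fin #pairs → Bool
  marked π k = sameM (χ π (proj₁ (ends k))) (χ π (proj₂ (ends k)))

  defined : Vec (Maybe Bool) J → ℕ
  defined π = count (is-just ∘ χ π)

  -- The index of the union bound that serves a given `σ`: `π` records one bit per block and leaves
  -- bad blocks undecided. Then `χ π` is a restriction of `σ` that misses at most `K + K` covered
  -- vertices per bad block.
  module Pattern (σ : Fin n → Bool) where
    c = proj₁ (recolour σ)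
    Bad = proj₁ (proj₂ (recolour σ))
    Bad≤viol = proj₁ (proj₂ (proj₂ (recolour σ)))
    rule = proj₂ (proj₂ (proj₂ (recolour σ)))

    at : ℕ → Maybe Bool
    at a = if membℕ a Bad then nothing else just (c a)

    π : Vec (Maybe Bool) J
    π = tab J (λ j → at (n ℕ.+ j))

    shifted : ∀ v → Maybe Bool
    shifted v = Maybe.map (τ v xor_) (nth π (loc v ℕ.∸ n))

    shifted-value : ∀ v → covered v ≡ true → shifted v ≡ (if membℕ (loc v) Bad then nothing else just (σ v))
    shifted-value v cov = trans (cong (Maybe.map (τ v xor_)) (trans (nth-tab (λ j → at (n ℕ.+ j)) d<J) (cong at (ℕₚ.m+[n∸m]≡n (leb⇒≤ cov))))) value
      where
      d<J : loc v ℕ.∸ n ℕ.< J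
      d<J = ℕₚ.+-cancelˡ-< n (loc v ℕ.∸ n) J (ℕₚ.≤-trans (ℕ.s≤s (ℕₚ.≤-reflexive (ℕₚ.m+[n∸m]≡n (leb⇒≤ cov)))) (B.range v))
      cases : ∀ b → membℕ (loc v) Bad ≡ b → Maybe.map (τ v xor_) (if b then nothing else just (c (loc v))) ≡ (if b then nothing else just (σ v))
      cases true _ = refl
      cases false e = cong just (sym (rule v (membℕ⇒∉ Bad e)))
      value : Maybe.map (τ v xor_) (at (loc v)) ≡ (if membℕ (loc v) Bad then nothing else just (σ v))
      value = cases (membℕ (loc v) Bad) refl

    χ-value : ∀ v → covered v ≡ true → χ π v ≡ (if membℕ (loc v) Bad then nothing else just (σ v))
    χ-value v cov = trans (cong (λ b → if b then shifted v else nothing) cov) (shifted-value v cov)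

    χ-σ : ∀ v b → χ π v ≡ just b → b ≡ σ v
    χ-σ v b h = go (covered v) refl
      where
      pick : ∀ m → (if m then nothing else just (σ v)) ≡ just b → b ≡ σ v
      pick false refl = refl
      go : ∀ cov → covered v ≡ cov → b ≡ σ v
      go true e = pick (membℕ (loc v) Bad) (trans (sym (χ-value v e)) h)
      go false e = absurd (trans (sym (cong (λ b → if b then shifted v else nothing) e)) h)
        where
        absurd : nothing ≡ just b → b ≡ σ v
        absurd ()

    marked⇒agree : ∀ k → marked π k ≡ true → agree σ (ends k) ≡ true
    marked⇒agree k = go (χ π (proj₁ (ends k))) (χ π (proj₂ (ends k))) refl refl
      where
      go : ∀ a b → χ π (proj₁ (ends k)) ≡ a → χ π (proj₂ (ends k)) ≡ b → sameM a b ≡ true → agree σ (ends k) ≡ true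
      go (just a) (just b) e₁ e₂ h = trans (cong₂ (λ a b → not (a xor b)) (sym (χ-σ (proj₁ (ends k)) a e₁)) (sym (χ-σ (proj₂ (ends k)) b e₂))) h

    count-bad : ∀ bs → count (λ v → membℕ (loc v) bs) ℕ.≤ length bs ℕ.* (K ℕ.+ K)
    count-bad [] = ℕₚ.≤-reflexive (count-none {n} (λ _ → refl))
    count-bad (b ∷ bs) = ℕₚ.≤-trans (count-∨ (λ v → loc v ≡? b) (λ v → membℕ (loc v) bs)) (ℕₚ.+-mono-≤ (block-≤ b) (count-bad bs))

    covered-≤ : #covered ℕ.≤ defined π ℕ.+ length Bad ℕ.* (K ℕ.+ K)
    covered-≤ = ℕₚ.≤-trans (count-mono pw) (ℕₚ.≤-trans (count-∨ (is-just ∘ χ π) (λ v → membℕ (loc v) Bad)) (ℕₚ.+-monoʳ-≤ (defined π) (count-bad Bad)))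
      where
      pick : ∀ m {a : Bool} → is-just (if m then nothing else just a) ∨ m ≡ true
      pick true = refl
      pick false = refl
      pw : ∀ v → covered v ≡ true → is-just (χ π v) ∨ membℕ (loc v) Bad ≡ true
      pw v cov = trans (cong (λ χv → is-just χv ∨ membℕ (loc v) Bad) (χ-value v cov)) (pick (membℕ (loc v) Bad))

  module _ (k B′ : ℕ) {q : ℚ} (pr : IsProb q) (k-small : 4 ℕ.* (K ℕ.* k) ℕ.≤ #covered) (B-small : 32 ℕ.* B′ ℕ.≤ K ℕ.* #covered)
           (n-small : 16 ℕ.* suc n ℕ.≤ #covered ℕ.* #covered) (decay : pow (1ℚ - ½ * q) B′ * 24ℚ ≤ 1ℚ) where
    private
      T = #covered
      z = 1ℚ - ½ * q

    0≤½q : 0ℚ ≤ ½ * q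
    0≤½q = 0≤* 0≤½ (IsProb.0≤p pr)

    0≤z : 0ℚ ≤ z
    0≤z = ≤-trans (0≤+ (IsProb.0≤1-p pr) 0≤½q) (≤-reflexive (solve 1 (λ q → (con 1ℚ :- q) :+ con ½ :* q := con 1ℚ :- con ½ :* q) refl q))

    z≤1 : z ≤ 1ℚ
    z≤1 = ≤-by (½ * q) 0≤½q (solve 1 (λ q → con 1ℚ := (con 1ℚ :- q) :+ q) refl (½ * q))

    large : Vec (Maybe Bool) J → Bool
    large π = leb T (2 ℕ.* defined π)

    -- An exponential test of one partial colouring: it is large on sprinklings that hit few of its
    -- monochromatic pairs. Only colourings of at least half of the covered vertices can arise from
    -- a small distance.
    weightOf : Vec (Maybe Bool) J → Vec Bool #pairs → ℚ
    weightOf π y = 𝟙 (large π) * pow ½ (count (λ k → lookup y k ∧ marked π k))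

    0≤pow½ : ∀ i → 0ℚ ≤ pow ½ i
    0≤pow½ = pow-0≤ 0≤½

    0≤weightOf : ∀ π y → 0ℚ ≤ weightOf π y
    0≤weightOf π y = 0≤* (0≤𝟙 (large π)) (0≤pow½ (count (λ k → lookup y k ∧ marked π k)))

    -- Half of the `T` covered vertices are coloured, so `monochromatic` gives `T² ≤ 16 S + 8 n`;
    -- doubling and absorbing `16 n` into `T²` leaves `T² ≤ 32 S`. With `J K ≤ T`, this is at least
    -- `B′` marked pairs per block.
    marked-≥ : ∀ π → large π ≡ true → J ℕ.* B′ ℕ.≤ count (marked π)
    marked-≥ π h = ℕₚ.*-cancelˡ-≤ 32 (begin
      32 ℕ.* (J ℕ.* B′)          ≡⟨ (λ J B → comm32 J B) J B′ ⟩
      J ℕ.* (32 ℕ.* B′)          ≤⟨ ℕₚ.*-monoʳ-≤ J B-small ⟩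
      J ℕ.* (K ℕ.* T)            ≡⟨ sym (ℕₚ.*-assoc J K T) ⟩
      J ℕ.* K ℕ.* T              ≤⟨ ℕₚ.*-monoˡ-≤ T J*K≤#covered ⟩
      T ℕ.* T                    ≤⟨ ℕₚ.+-cancelʳ-≤ (T ℕ.* T) (T ℕ.* T) (32 ℕ.* S) twice ⟩
      32 ℕ.* S ∎)
      where
      open ℕₚ.≤-Reasoning
      S = count (marked π)
      d = defined π
      comm32 : ∀ J B → 32 ℕ.* (J ℕ.* B) ≡ J ℕ.* (32 ℕ.* B)
      comm32 = ℕ-Solver.solve-∀
      two : ∀ d → (2 ℕ.* d) ℕ.* (2 ℕ.* d) ≡ 4 ℕ.* (d ℕ.* d)
      two = ℕ-Solver.solve-∀
      dist : ∀ S n → 2 ℕ.* (4 ℕ.* (4 ℕ.* S ℕ.+ 2 ℕ.* n)) ≡ 32 ℕ.* S ℕ.+ 16 ℕ.* n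
      dist = ℕ-Solver.solve-∀
      double : ∀ t → t ℕ.+ t ≡ 2 ℕ.* t
      double = ℕ-Solver.solve-∀
      twice : T ℕ.* T ℕ.+ T ℕ.* T ℕ.≤ 32 ℕ.* S ℕ.+ T ℕ.* T
      twice = begin
        T ℕ.* T ℕ.+ T ℕ.* T                           ≡⟨ double (T ℕ.* T) ⟩
        2 ℕ.* (T ℕ.* T)                               ≤⟨ ℕₚ.*-monoʳ-≤ 2 (ℕₚ.*-mono-≤ (leb⇒≤ h) (leb⇒≤ h)) ⟩
        2 ℕ.* ((2 ℕ.* d) ℕ.* (2 ℕ.* d))               ≡⟨ cong (2 ℕ.*_) (two d) ⟩
        2 ℕ.* (4 ℕ.* (d ℕ.* d))                       ≤⟨ ℕₚ.*-monoʳ-≤ 2 (ℕₚ.*-monoʳ-≤ 4 (monochromatic n (χ π))) ⟩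
        2 ℕ.* (4 ℕ.* (4 ℕ.* S ℕ.+ 2 ℕ.* n))           ≡⟨ dist S n ⟩
        32 ℕ.* S ℕ.+ 16 ℕ.* n                         ≤⟨ ℕₚ.+-monoʳ-≤ (32 ℕ.* S) (ℕₚ.≤-trans (ℕₚ.*-monoʳ-≤ 16 (ℕₚ.n≤1+n n)) n-small) ⟩
        32 ℕ.* S ℕ.+ T ℕ.* T ∎

    E-weight : ∀ π → E q (weightOf π) ≤ pow z (J ℕ.* B′)
    E-weight π = ≤-trans (≤-reflexive (trans (E-* q (𝟙 (large π)) (λ y → pow ½ (count (λ k → lookup y k ∧ marked π k)))) (cong (𝟙 (large π) *_) (E-½ q (marked π))))) (cases (large π) refl)
      where
      cases : ∀ b → large π ≡ b → 𝟙 b * pow z (count (marked π)) ≤ pow z (J ℕ.* B′)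
      cases true e = ≤-trans (≤-reflexive (ℚₚ.*-identityˡ _)) (pow-anti 0≤z z≤1 (marked-≥ π e))
      cases false e = ≤-trans (≤-reflexive (ℚₚ.*-zeroˡ (pow z (count (marked π))))) (pow-0≤ 0≤z (J ℕ.* B′))

    few : Vec Bool #pairs → Bool
    few y = leb (distBP {n} (zipWith _∨_ x y)) k

    2k≤J : 2 ℕ.* k ℕ.≤ J
    2k≤J = ℕₚ.*-cancelʳ-≤ (2 ℕ.* k) J (K ℕ.+ K) ⦃ ℕ.>-nonZero (ℕₚ.≤-trans (ℕ.s≤s ℕ.z≤n) (ℕₚ.≤-trans 1<K (ℕₚ.m≤m+n K K))) ⦄
      (ℕₚ.≤-trans (ℕₚ.≤-reflexive (re k K)) (ℕₚ.≤-trans k-small #covered≤2JK))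
      where
      re : ∀ k K → 2 ℕ.* k ℕ.* (K ℕ.+ K) ≡ 4 ℕ.* (K ℕ.* k)
      re = ℕ-Solver.solve-∀

    few-weight : ∀ y → few y ≡ true → pow ½ k ≤ Σπ J (λ π → weightOf π y)
    few-weight y h = ≤-trans main (Σπ-single J (λ π → weightOf π y) (λ π → 0≤weightOf π y) π)
      where
      att = distBP-attained (zipWith _∨_ x y)
      σ = proj₁ att
      open Pattern σ
      viol≤k : viol ends (zipWith _∨_ x y) σ ℕ.≤ k
      viol≤k = ℕₚ.≤-trans (proj₂ att) (leb⇒≤ h)
      Bad≤k : length Bad ℕ.≤ k
      Bad≤k = ℕₚ.≤-trans Bad≤viol (ℕₚ.≤-trans (viol-⊑ ends x (zipWith _∨_ x y) (⊑-∨ˡ x y) σ) viol≤k)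
      hits : count (λ k → lookup y k ∧ marked π k) ℕ.≤ k
      hits = ℕₚ.≤-trans (count-mono λ j e → let p , r = ∧-elim {lookup y j} e in ∧-introˡ p (marked⇒agree j r)) (ℕₚ.≤-trans (viol-⊑ ends y (zipWith _∨_ x y) (⊑-∨ʳ x y) σ) viol≤k)
      re : ∀ k K → 2 ℕ.* (k ℕ.* (K ℕ.+ K)) ≡ 4 ℕ.* (K ℕ.* k)
      re = ℕ-Solver.solve-∀
      double : ∀ t → t ℕ.+ t ≡ 2 ℕ.* t
      double = ℕ-Solver.solve-∀
      is-large : large π ≡ true
      is-large = ≤⇒leb (ℕₚ.+-cancelʳ-≤ T T (2 ℕ.* defined π) (ℕₚ.≤-trans (ℕₚ.≤-reflexive (double T))
        (ℕₚ.≤-trans (ℕₚ.*-monoʳ-≤ 2 (ℕₚ.≤-trans covered-≤ (ℕₚ.+-monoʳ-≤ (defined π) (ℕₚ.*-monoˡ-≤ (K ℕ.+ K) Bad≤k))))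
          (ℕₚ.≤-trans (ℕₚ.≤-reflexive (trans (ℕₚ.*-distribˡ-+ 2 (defined π) (k ℕ.* (K ℕ.+ K))) (cong (2 ℕ.* defined π ℕ.+_) (re k K)))) (ℕₚ.+-monoʳ-≤ (2 ℕ.* defined π) k-small)))))
      main : pow ½ k ≤ weightOf π y
      main = ≤-trans (pow-anti 0≤½ ½≤1 hits) (≤-reflexive (sym (trans (cong (λ b → 𝟙 b * pow ½ (count (λ k → lookup y k ∧ marked π k))) is-large) (ℚₚ.*-identityˡ _))))

    1≤J : 1 ℕ.≤ J
    1≤J = ℕₚ.≮⇒≥ λ J<1 → ℕₚ.<⇒≱ (ℕ.s≤s (ℕ.z≤n {0})) (ℕₚ.≤-trans (ℕₚ.≤-trans (ℕₚ.≤-trans (ℕₚ.m≤m*n 1 16) (ℕₚ.*-monoʳ-≤ 16 (ℕ.s≤s (ℕ.z≤n {n})))) n-small)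
      (ℕₚ.≤-reflexive (cong (λ t → t ℕ.* t) (ℕₚ.n≤0⇒n≡0 (ℕₚ.≤-trans #covered≤2JK (ℕₚ.≤-reflexive (cong (ℕ._* (K ℕ.+ K)) (ℕₚ.n≤0⇒n≡0 (ℕₚ.≤-pred J<1)))))))))

    k≤J : k ℕ.≤ J
    k≤J = ℕₚ.≤-trans (ℕₚ.m≤m+n k (k ℕ.+ 0)) 2k≤J

    -- Markov's inequality for the total weight. A sprinkling of distance at most `k` has total
    -- weight at least `pow ½ k`, hence at least `pow ½ J`, whereas the mean total weight is at most
    -- `pow ⅛ℚ J`. The quotient is a power of `¼ℚ` with exponent `J ≥ 1`.
    E-few : E q (λ y → 𝟙 (few y)) ≤ ¼ℚ
    E-few = *-cancelˡ (pow ½ J) (0<pow (ℚₚ.positive⁻¹ ½) J) (begin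
      pow ½ J * P
        ≤⟨ *-monoˡ P 0≤P (pow-anti 0≤½ ½≤1 k≤J) ⟩
      pow ½ k * P
        ≡⟨ sym (E-* q (pow ½ k) (λ y → 𝟙 (few y))) ⟩
      E q (λ y → pow ½ k * 𝟙 (few y))
        ≤⟨ E-mono pr (λ y → pointwise y (few y) refl) ⟩
      E q (λ y → Σπ J (λ π → weightOf π y))
        ≡⟨ E-Σπ q J weightOf ⟩
      Σπ J (λ π → E q (weightOf π))
        ≤⟨ Σπ-≤ J (λ π → E q (weightOf π)) (pow z (J ℕ.* B′)) E-weight ⟩
      pow 3ℚ J * pow z (J ℕ.* B′)
        ≡⟨ trans (cong (pow 3ℚ J *_) (pow-pow z J B′)) (sym (pow-* 3ℚ w J)) ⟩
      pow (3ℚ * w) J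
        ≤⟨ pow-mono (0≤* (ℚₚ.nonNegative⁻¹ 3ℚ) (pow-0≤ 0≤z B′)) 3w≤⅛ J ⟩
      pow ⅛ℚ J
        ≡⟨ pow-* ½ ¼ℚ J ⟩
      pow ½ J * pow ¼ℚ J
        ≤⟨ *-monoʳ (pow ½ J) (0≤pow½ J) (≤-trans (pow-anti (ℚₚ.nonNegative⁻¹ ¼ℚ) ¼≤1 1≤J) (≤-reflexive (ℚₚ.*-identityʳ ¼ℚ))) ⟩
      pow ½ J * ¼ℚ ∎)
      where
      open ℚₚ.≤-Reasoning
      P = E q (λ y → 𝟙 (few y))
      0≤P : 0ℚ ≤ P
      0≤P = 0≤E pr (λ y → 0≤𝟙 (few y))
      w = pow z B′
      3w≤⅛ : 3ℚ * w ≤ ⅛ℚ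
      3w≤⅛ = ≤-trans (≤-reflexive (solve 1 (λ w → con 3ℚ :* w := con ⅛ℚ :* (w :* con 24ℚ)) refl w))
               (≤-trans (*-monoʳ ⅛ℚ (ℚₚ.nonNegative⁻¹ ⅛ℚ) decay) (≤-reflexive (ℚₚ.*-identityʳ ⅛ℚ)))
      ¼≤1 : ¼ℚ ≤ 1ℚ
      ¼≤1 = ≤-by (3ℚ * ¼ℚ) (ℚₚ.nonNegative⁻¹ (3ℚ * ¼ℚ)) refl
      pointwise : ∀ y b → few y ≡ b → pow ½ k * 𝟙 b ≤ Σπ J (λ π → weightOf π y)
      pointwise y true e = ≤-trans (≤-reflexive (ℚₚ.*-identityʳ (pow ½ k))) (few-weight y e)
      pointwise y false e = ≤-trans (≤-reflexive (ℚₚ.*-zeroʳ (pow ½ k))) (0≤Σπ J (λ π → weightOf π y) (λ π → 0≤weightOf π y))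

-- Lower bound on the expected distance

floor : ∀ q → 0ℚ ≤ q → ∃ λ k → ι k ≤ q × q ≤ 1ℚ + ι k
floor q 0≤q = go (proj₁ (archimedean q)) (proj₂ (archimedean q))
  where
  go : ∀ M → q ≤ ι M → ∃ λ k → ι k ≤ q × q ≤ 1ℚ + ι k
  go zero h = 0 , ≤-trans (≤-reflexive ι0) 0≤q , ≤-trans h (≤-by 1ℚ 0≤1 (ℚₚ.+-comm 1ℚ (ι 0)))
  go (suc M) h with ℚₚ.≤-total q (ι M)
  ... | inj₁ q≤M = go M q≤M
  ... | inj₂ M≤q = M , M≤q , ≤-trans h (≤-reflexive (ι-suc M))

chebyshev : ∀ {p} → IsProb p → ∀ {m} (X : Vec Bool m → ℚ) (bad : Vec Bool m → Bool) a V →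
  E p (λ x → X x * X x) ≤ E p X * E p X + V → (∀ x → bad x ≡ true → a * a ≤ (X x - E p X) * (X x - E p X)) →
  a * a * E p (λ x → 𝟙 (bad x)) ≤ V
chebyshev {p} pr {m} X bad a V var far = begin
  a * a * E p (λ x → 𝟙 (bad x))
    ≡⟨ sym (E-* p (a * a) (λ x → 𝟙 (bad x))) ⟩
  E p (λ x → a * a * 𝟙 (bad x))
    ≤⟨ E-mono pr (λ x → pointwise x (bad x) refl) ⟩
  E p (λ x → X x * X x + (μ * μ + (- (μ + μ)) * X x))
    ≡⟨ trans (E-+ p (λ x → X x * X x) (λ x → μ * μ + (- (μ + μ)) * X x))
         (cong (λ z → E p (λ x → X x * X x) + z) (trans (E-+ p (λ _ → μ * μ) (λ x → (- (μ + μ)) * X x)) (cong₂ _+_ (E-const p m (μ * μ)) (E-* p (- (μ + μ)) X)))) ⟩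
  E p (λ x → X x * X x) + (μ * μ + (- (μ + μ)) * μ)
    ≤⟨ ℚₚ.+-monoˡ-≤ (μ * μ + (- (μ + μ)) * μ) var ⟩
  μ * μ + V + (μ * μ + (- (μ + μ)) * μ)
    ≡⟨ solve 2 (λ u v → u :* u :+ v :+ (u :* u :+ (:- (u :+ u)) :* u) := v) refl μ V ⟩
  V ∎
  where
  open ℚₚ.≤-Reasoning
  μ = E p X
  expand : ∀ y → (y - μ) * (y - μ) ≡ y * y + (μ * μ + (- (μ + μ)) * y)
  expand y = solve 2 (λ y u → (y :- u) :* (y :- u) := y :* y :+ (u :* u :+ (:- (u :+ u)) :* y)) refl y μ
  pointwise : ∀ x b → bad x ≡ b → a * a * 𝟙 b ≤ X x * X x + (μ * μ + (- (μ + μ)) * X x)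
  pointwise x true e = ≤-trans (≤-reflexive (ℚₚ.*-identityʳ (a * a))) (≤-trans (far x e) (≤-reflexive (expand (X x))))
  pointwise x false e = ≤-trans (≤-reflexive (ℚₚ.*-zeroʳ (a * a))) (≤-trans (0≤² (X x - μ)) (≤-reflexive (expand (X x))))

-- Inclusion-exclusion stopped after the second term. The quadratic term is explicit so that it can
-- be weighed against the linear excess `ε` of the density.
bonferroni : ∀ {a} → 0ℚ ≤ a → a ≤ 1ℚ → ∀ n → pow (1ℚ - a) n ≤ 1ℚ - ι n * a + ½ * ((ι n * a) * (ι n * a))
bonferroni {a} 0≤a a≤1 zero = ≤-reflexive (sym (trans (cong (λ z → 1ℚ - z * a + ½ * ((z * a) * (z * a))) ι0) (solve 1 (λ a → con 1ℚ :- con 0ℚ :* a :+ con ½ :* ((con 0ℚ :* a) :* (con 0ℚ :* a)) := con 1ℚ) refl a)))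
bonferroni {a} 0≤a a≤1 (suc n) = ≤-trans (*-monoʳ (1ℚ - a) (0≤-diff a≤1) (bonferroni 0≤a a≤1 n))
  (≤-by (½ * (a * a) + ½ * (a * ((ι n * a) * (ι n * a)))) (0≤+ (0≤* 0≤½ (0≤² a)) (0≤* 0≤½ (0≤* 0≤a (0≤² (ι n * a)))))
    (trans (cong (λ z → 1ℚ - z * a + ½ * ((z * a) * (z * a))) (ι-suc n))
      (solve 2 (λ n a → con 1ℚ :- (con 1ℚ :+ n) :* a :+ con ½ :* (((con 1ℚ :+ n) :* a) :* ((con 1ℚ :+ n) :* a))
        := (con 1ℚ :- a) :* (con 1ℚ :- n :* a :+ con ½ :* ((n :* a) :* (n :* a))) :+ (con ½ :* (a :* a) :+ con ½ :* (a :* ((n :* a) :* (n :* a))))) refl (ι n) a)))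

opaque
  _≤ᵇ_ : ℚ → ℚ → Bool
  a ≤ᵇ b = does (a ≤? b)

  ≤ᵇ⇒≤ : ∀ {a b} → (a ≤ᵇ b) ≡ true → a ≤ b
  ≤ᵇ⇒≤ {a} {b} = does-true (a ≤? b)

  ≤ᵇ⇒≥ : ∀ {a b} → (a ≤ᵇ b) ≡ false → b ≤ a
  ≤ᵇ⇒≥ {a} {b} e = <⇒≤ (ℚₚ.≰⇒> (does-false (a ≤? b) e))

-- The blocks have about C₀/ε² vertices, where C₀ = 24 · 8⁴ pays for the factor 24 = 3 · 2 · 4: three states per block in the union bound,
-- one ½ per violated edge, and ¼ to spare.
C₀ C₁ C₂ 8⁻⁴ 2⁻¹⁰ : ℚ
C₀ = toℚ 98304
C₁ = toℚ 98306
C₂ = toℚ 1024 * C₁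
8⁻⁴ = pow ⅛ℚ 4
2⁻¹⁰ = pow ½ 10

module Sprinkling (n k₀ : ℕ) {ε p : ℚ} (0<ε : 0ℚ < ε) (ε≤1 : ε ≤ 1ℚ) (pr : IsProb p) (pN : p * ι (suc n) ≡ 1ℚ + ε)
    (K-large : C₀ ≤ ε * ε * ι (suc (suc k₀))) (K-small : ε * ε * ι (suc (suc k₀)) ≤ C₁)
    (e₁ : toℚ 8 * ι (suc (suc k₀) ℕ.+ suc (suc k₀)) ≤ ε * ι (suc n))
    (e₂ : toℚ 16384 * (ι (suc (suc k₀)) * ι (suc (suc k₀))) ≤ ε * ε * ι (suc n))
    (e₃ : toℚ 32768 ≤ ε * ε * ι (suc n))
    (e₄ : toℚ 256 * C₁ ≤ ε * ε * ε * ι (suc n)) where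
  open RandomGraph n
  open ℚₚ.≤-Reasoning

  K t : ℕ
  K = suc (suc k₀)
  -- `suc t` is definitionally `K + K`, so the exploration bounds vertices in components of exactly
  -- the size that `Decomposition` handles.
  t = suc k₀ ℕ.+ K

  1<K : 1 ℕ.< K
  1<K = ℕ.s≤s (ℕ.s≤s ℕ.z≤n)

  -- `h = ε/8` is a lower guess for the probability that a vertex lies in a component of at least
  -- `K + K` vertices at density `p₁`; `a = ε N / 16` is half of the resulting mean, which leaves
  -- room for Chebyshev.
  l r q p₁ h a : ℚ
  l = ι K
  r = ℤ.+ 1 / suc n
  p₁ = (1ℚ + ½ * ε) * r
  q = ½ * ε * r
  h = ⅛ℚ * ε
  a = N * (½ * h)

  0≤ε : 0ℚ ≤ ε
  0≤ε = <⇒≤ 0<ε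

  0≤l : 0ℚ ≤ l
  0≤l = 0≤ι K

  0≤r : 0ℚ ≤ r
  0≤r = <⇒≤ (0<recip n)

  Nr : N * r ≡ 1ℚ
  Nr = *-recip n

  0≤⅛ : 0ℚ ≤ ⅛ℚ
  0≤⅛ = ℚₚ.nonNegative⁻¹ ⅛ℚ

  0≤h : 0ℚ ≤ h
  0≤h = 0≤* 0≤⅛ 0≤ε

  h≤1 : h ≤ 1ℚ
  h≤1 = ≤-trans (≤-by (toℚ 7 * ⅛ℚ * ε) (0≤* (ℚₚ.nonNegative⁻¹ (toℚ 7 * ⅛ℚ)) 0≤ε) (solve 1 (λ e → e := con ⅛ℚ :* e :+ con (toℚ 7 * ⅛ℚ) :* e) refl ε)) ε≤1

  0≤½ε : 0ℚ ≤ ½ * ε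
  0≤½ε = 0≤* 0≤½ 0≤ε

  0≤q : 0ℚ ≤ q
  0≤q = 0≤* 0≤½ε 0≤r

  0≤p₁ : 0ℚ ≤ p₁
  0≤p₁ = 0≤* (0≤+ 0≤1 0≤½ε) 0≤r

  p₁N : N * p₁ ≡ 1ℚ + ½ * ε
  p₁N = trans (solve 3 (λ N c r → N :* (c :* r) := c :* (N :* r)) refl N (1ℚ + ½ * ε) r) (trans (cong ((1ℚ + ½ * ε) *_) Nr) (ℚₚ.*-identityʳ (1ℚ + ½ * ε)))

  p₁+q≤p : p₁ + q ≤ p
  p₁+q≤p = *-cancelˡ N 0<N (≤-reflexive (trans
    (solve 3 (λ N e r → N :* ((con 1ℚ :+ con ½ :* e) :* r :+ con ½ :* e :* r) := (con 1ℚ :+ e) :* (N :* r)) refl N ε r)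
    (trans (cong ((1ℚ + ε) *_) Nr) (trans (ℚₚ.*-identityʳ (1ℚ + ε)) (trans (sym pN) (ℚₚ.*-comm p N))))))

  p₁+q≤1 : p₁ + q ≤ 1ℚ
  p₁+q≤1 = ≤-trans p₁+q≤p (IsProb.p≤1 pr)

  pr₁ : IsProb p₁
  pr₁ = isProb 0≤p₁ (≤-trans (≤-by q 0≤q refl) p₁+q≤1)

  prq : IsProb q
  prq = isProb 0≤q (≤-trans (≤-by p₁ 0≤p₁ (ℚₚ.+-comm p₁ q)) p₁+q≤1)

  ⊕≤ : p₁ ⊕ q ≤ p₁ + q
  ⊕≤ = ≤-by (p₁ * q) (0≤* 0≤p₁ 0≤q) (solve 2 (λ p q → p :+ q := (p :+ q :- p :* q) :+ p :* q) refl p₁ q)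

  pr⊕ : IsProb (p₁ ⊕ q)
  pr⊕ = isProb (≤-trans (0≤+ (0≤* 0≤p₁ (IsProb.0≤1-p prq)) 0≤q) (≤-reflexive (solve 2 (λ p q → p :* (con 1ℚ :- q) :+ q := p :+ q :- p :* q) refl p₁ q))) (≤-trans ⊕≤ p₁+q≤1)

  open Potential pr₁ 0≤h h≤1

  εN≤N : ε * N ≤ N
  εN≤N = ≤-trans (*-monoˡ N 0≤N ε≤1) (≤-reflexive (ℚₚ.*-identityˡ N))

  2K≤n : suc t ℕ.≤ suc n
  2K≤n = ι-cancel (≤-trans (≤-by (toℚ 7 * ι (suc t)) (0≤* (0≤toℚ 7) (0≤ι (suc t))) (solve 1 (λ x → con (toℚ 8) :* x := x :+ con (toℚ 7) :* x) refl (ι (suc t)))) (≤-trans e₁ εN≤N))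

  M : ℕ
  M = n ℕ.∸ t

  M+t : M ℕ.+ t ≡ n
  M+t = ℕₚ.m∸n+n≡m (ℕₚ.≤-pred 2K≤n)

  N≡ : N ≡ ι M + ι (suc t)
  N≡ = trans (cong ι (trans (cong suc (sym M+t)) (sym (ℕₚ.+-suc M t)))) (ι-+ M (suc t))

  b : ℚ
  b = ι M * p₁

  b-split : b + ι (suc t) * p₁ ≡ 1ℚ + ½ * ε
  b-split = trans (solve 3 (λ m s p → m :* p :+ s :* p := (m :+ s) :* p) refl (ι M) (ι (suc t)) p₁) (trans (cong (_* p₁) (sym N≡)) p₁N)

  lost : ι (suc t) * p₁ ≤ ¼ℚ * ε
  lost = begin
    ι (suc t) * p₁
      ≤⟨ ≤-by (ι (suc t) * r * ((1ℚ - ε) + ½ * ε)) (0≤* (0≤* (0≤ι (suc t)) 0≤r) (0≤+ (0≤-diff ε≤1) 0≤½ε))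
           (solve 3 (λ s e r → s :* r :* con (toℚ 2) := s :* ((con 1ℚ :+ con ½ :* e) :* r) :+ s :* r :* ((con 1ℚ :- e) :+ con ½ :* e)) refl (ι (suc t)) ε r) ⟩
    ι (suc t) * r * toℚ 2
      ≡⟨ solve 2 (λ s r → s :* r :* con (toℚ 2) := con ¼ℚ :* r :* (con (toℚ 8) :* s)) refl (ι (suc t)) r ⟩
    ¼ℚ * r * (toℚ 8 * ι (suc t))
      ≤⟨ *-monoʳ (¼ℚ * r) (0≤* (ℚₚ.nonNegative⁻¹ ¼ℚ) 0≤r) e₁ ⟩
    ¼ℚ * r * (ε * N)
      ≡⟨ solve 4 (λ c r e N → c :* r :* (e :* N) := c :* e :* (N :* r)) refl ¼ℚ r ε N ⟩
    ¼ℚ * ε * (N * r)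
      ≡⟨ trans (cong (¼ℚ * ε *_) Nr) (ℚₚ.*-identityʳ (¼ℚ * ε)) ⟩
    ¼ℚ * ε ∎

  0≤b : 0ℚ ≤ b
  0≤b = 0≤* (0≤ι M) 0≤p₁

  b≥ : 0ℚ ≤ b - 1ℚ - ¼ℚ * ε
  b≥ = ≤-trans (0≤-diff lost) (≤-reflexive (trans (solve 3 (λ e s b → con ¼ℚ :* e :- s := (con 1ℚ :+ con ½ :* e) :- s :- con 1ℚ :- con ¼ℚ :* e) refl ε (ι (suc t) * p₁) b)
    (trans (cong (λ z → z - ι (suc t) * p₁ - 1ℚ - ¼ℚ * ε) (sym b-split)) (solve 3 (λ b s e → (b :+ s) :- s :- con 1ℚ :- con ¼ℚ :* e := b :- con 1ℚ :- con ¼ℚ :* e) refl b (ι (suc t) * p₁) ε))))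

  b≤2 : 0ℚ ≤ toℚ 2 - b
  b≤2 = ≤-trans (0≤+ (0≤+ (0≤-diff ε≤1) 0≤½ε) (0≤* (0≤ι (suc t)) 0≤p₁))
    (≤-reflexive (trans (solve 3 (λ e s b → (con 1ℚ :- e) :+ con ½ :* e :+ s := con (toℚ 2) :- (con 1ℚ :+ con ½ :* e) :+ s) refl ε (ι (suc t) * p₁) b)
      (trans (cong (λ z → toℚ 2 - z + ι (suc t) * p₁) (sym b-split)) (solve 2 (λ b s → con (toℚ 2) :- (b :+ s) :+ s := con (toℚ 2) :- b) refl b (ι (suc t) * p₁)))))

  -- The bound `1 - b h + (b h)²/2` is at most `1 - h` once `b - 1 ≥ b² h / 2`. Reserving `K + K`
  -- vertices leaves `b ≥ 1 + ε/4`, and `b ≤ 2` bounds the right side by `2 h`; this is where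
  -- `h = ε/8` comes from.
  powM≤θ : pow s M ≤ θ
  powM≤θ = ≤-trans (bonferroni (0≤* 0≤p₁ 0≤h) (*≤1 0≤p₁ (IsProb.p≤1 pr₁) h≤1) M)
    (≤-by (h * ((b - 1ℚ - ¼ℚ * ε) + ½ * ⅛ℚ * ε * ((toℚ 2 - b) * (toℚ 2 + b))))
       (0≤* 0≤h (0≤+ b≥ (0≤* (0≤* (ℚₚ.nonNegative⁻¹ (½ * ⅛ℚ)) 0≤ε) (0≤* b≤2 (0≤+ (0≤toℚ 2) 0≤b)))))
       (solve 3 (λ m p e → let h = con ⅛ℚ :* e in let b = m :* p in con 1ℚ :- h
          := (con 1ℚ :- m :* (p :* h) :+ con ½ :* ((m :* (p :* h)) :* (m :* (p :* h)))) :+ h :* ((b :- con 1ℚ :- con ¼ℚ :* e) :+ con ½ :* con ⅛ℚ :* e :* ((con (toℚ 2) :- b) :* (con (toℚ 2) :+ b)))) refl (ι M) p₁ ε))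

  X : Vec Bool #pairs → ℚ
  X x = ι (#big ends (K ℕ.+ K) x)

  EX≥ : N * h ≤ E p₁ X
  EX≥ = E-#big-≥ pr₁ 0≤h h≤1 M t powM≤θ (ℕₚ.≤-reflexive M+t)

  bad : Vec Bool #pairs → Bool
  bad x = not (a ≤ᵇ X x)

  0≤a : 0ℚ ≤ a
  0≤a = 0≤* 0≤N (0≤* 0≤½ 0≤h)

  0<a : 0ℚ < a
  0<a = 0<* 0<N (0<* (ℚₚ.positive⁻¹ ½) (0<* (ℚₚ.positive⁻¹ ⅛ℚ) 0<ε))

  w V : ℚ
  w = ι ((K ℕ.+ K) ℕ.+ (K ℕ.+ K))
  V = ι #pairs * (p₁ * (w * w))

  -- The variance is at most `32 K² N`, because an edge moves `X` by at most `4 K` and `p₁ N ≤ 2`.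
  -- Since `a²/2 = ε² N² / 512`, the constant in `e₂` is `32 · 512`.
  V≤ : V ≤ a * a * ½
  V≤ = begin
    V
      ≤⟨ *-monoˡ (p₁ * (w * w)) (0≤* 0≤p₁ (0≤² (w))) ι#pairs-≤ ⟩
    N * N * (p₁ * (w * w))
      ≡⟨ cong (λ z → N * N * (p₁ * (z * z))) (trans (ι-+ (K ℕ.+ K) (K ℕ.+ K)) (cong₂ _+_ (ι-+ K K) (ι-+ K K))) ⟩
    N * N * (p₁ * ((l + l + (l + l)) * (l + l + (l + l))))
      ≡⟨ solve 3 (λ N p l → N :* N :* (p :* ((l :+ l :+ (l :+ l)) :* (l :+ l :+ (l :+ l)))) := N :* (N :* p :* (con (toℚ 16) :* (l :* l)))) refl N p₁ l ⟩
    N * (N * p₁ * (toℚ 16 * (l * l)))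
      ≡⟨ cong (λ z → N * (z * (toℚ 16 * (l * l)))) p₁N ⟩
    N * ((1ℚ + ½ * ε) * (toℚ 16 * (l * l)))
      ≤⟨ *-monoʳ N 0≤N (≤-by (((1ℚ - ε) + ½ * ε) * (toℚ 16 * (l * l))) (0≤* (0≤+ (0≤-diff ε≤1) 0≤½ε) (0≤* (0≤toℚ 16) (0≤² l)))
           (solve 2 (λ e l → con (toℚ 32) :* (l :* l) := (con 1ℚ :+ con ½ :* e) :* (con (toℚ 16) :* (l :* l)) :+ ((con 1ℚ :- e) :+ con ½ :* e) :* (con (toℚ 16) :* (l :* l))) refl ε l)) ⟩
    N * (toℚ 32 * (l * l))
      ≡⟨ solve 2 (λ N l → N :* (con (toℚ 32) :* (l :* l)) := N :* (con ⅛ℚ :* con ⅛ℚ :* con ⅛ℚ) :* (con (toℚ 16384) :* (l :* l))) refl N l ⟩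
    N * (⅛ℚ * ⅛ℚ * ⅛ℚ) * (toℚ 16384 * (l * l))
      ≤⟨ *-monoʳ (N * (⅛ℚ * ⅛ℚ * ⅛ℚ)) (0≤* 0≤N (ℚₚ.nonNegative⁻¹ (⅛ℚ * ⅛ℚ * ⅛ℚ))) e₂ ⟩
    N * (⅛ℚ * ⅛ℚ * ⅛ℚ) * (ε * ε * N)
      ≡⟨ solve 2 (λ N e → N :* (con ⅛ℚ :* con ⅛ℚ :* con ⅛ℚ) :* (e :* e :* N) := (N :* (con ½ :* (con ⅛ℚ :* e))) :* (N :* (con ½ :* (con ⅛ℚ :* e))) :* con ½) refl N ε ⟩
    a * a * ½ ∎

  far : ∀ x → bad x ≡ true → a * a ≤ (X x - E p₁ X) * (X x - E p₁ X)
  far x e = ≤-trans (*-mono 0≤a (≤-trans 0≤a gap) gap gap) (≤-reflexive (solve 2 (λ x u → (u :- x) :* (u :- x) := (x :- u) :* (x :- u)) refl (X x) (E p₁ X)))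
    where
    flip : ∀ b → not b ≡ true → b ≡ false
    flip false _ = refl
    X≤a : X x ≤ a
    X≤a = ≤ᵇ⇒≥ (flip (a ≤ᵇ X x) e)
    gap : a ≤ E p₁ X - X x
    gap = ≤-by ((E p₁ X - N * h) + (a - X x)) (0≤+ (0≤-diff EX≥) (0≤-diff X≤a))
      (solve 4 (λ u x N h → u :- x := N :* (con ½ :* h) :+ ((u :- N :* h) :+ (N :* (con ½ :* h) :- x))) refl (E p₁ X) (X x) N h)

  P-bad : E p₁ (λ x → 𝟙 (bad x)) ≤ ½
  P-bad = *-cancelˡ (a * a) (0<* 0<a 0<a) (≤-trans (chebyshev pr₁ X bad a V (#big-variance pr₁ (K ℕ.+ K)) far) V≤)

  inv-l = inverse l (0<ι-suc (suc k₀))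
  l⁻¹ = proj₁ inv-l
  0≤l⁻¹ : 0ℚ ≤ l⁻¹
  0≤l⁻¹ = <⇒≤ (proj₁ (proj₂ inv-l))
  ll⁻¹ : l * l⁻¹ ≡ 1ℚ
  ll⁻¹ = proj₂ (proj₂ inv-l)

  -- On a good `x` at least `a/2` vertices are covered. `κ` and `β` are the values for which `4 K κ`
  -- and `32 β / K` equal `a/2`, as the union bound demands of `k` and `B′`.
  κ β : ℚ
  κ = ⅛ℚ * a * l⁻¹
  β = ⅛ℚ * ⅛ℚ * (l * a)

  floor-κ = floor κ (0≤* (0≤* 0≤⅛ 0≤a) 0≤l⁻¹)
  floor-β = floor β (0≤* (ℚₚ.nonNegative⁻¹ (⅛ℚ * ⅛ℚ)) (0≤* 0≤l 0≤a))

  k B′ : ℕ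
  k = proj₁ floor-κ
  B′ = proj₁ floor-β

  k≤κ : ι k ≤ κ
  k≤κ = proj₁ (proj₂ floor-κ)
  κ≤ : κ ≤ 1ℚ + ι k
  κ≤ = proj₂ (proj₂ floor-κ)
  B≤β : ι B′ ≤ β
  B≤β = proj₁ (proj₂ floor-β)
  β≤ : β ≤ 1ℚ + ι B′
  β≤ = proj₂ (proj₂ floor-β)

  0≤½q : 0ℚ ≤ ½ * q
  0≤½q = 0≤* 0≤½ 0≤q

  ½q≤1 : ½ * q ≤ 1ℚ
  ½q≤1 = *≤1 0≤½ ½≤1 (IsProb.p≤1 prq)

  -- The product `β (q/2)` equals `ε² K / 8⁴`, which is at least 24 by the choice of `C₀`. The unit
  -- lost in rounding `β` down is covered by the leading 1, since `q/2 ≤ 1`.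
  24≤ : 24ℚ ≤ 1ℚ + ι B′ * (½ * q)
  24≤ = begin
    24ℚ
      ≡⟨ refl ⟩
    8⁻⁴ * C₀
      ≤⟨ *-monoʳ 8⁻⁴ (ℚₚ.nonNegative⁻¹ 8⁻⁴) K-large ⟩
    8⁻⁴ * (ε * ε * l)
      ≡⟨ sym (trans (cong (8⁻⁴ * (ε * ε * l) *_) Nr) (ℚₚ.*-identityʳ _)) ⟩
    8⁻⁴ * (ε * ε * l) * (N * r)
      ≡⟨ solve 4 (λ e l N r → con 8⁻⁴ :* (e :* e :* l) :* (N :* r)
           := con ⅛ℚ :* con ⅛ℚ :* (l :* (N :* (con ½ :* (con ⅛ℚ :* e)))) :* (con ½ :* (con ½ :* e :* r))) refl ε l N r ⟩
    β * (½ * q)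
      ≤⟨ *-monoˡ (½ * q) 0≤½q β≤ ⟩
    (1ℚ + ι B′) * (½ * q)
      ≤⟨ ≤-by (1ℚ - ½ * q) (0≤-diff ½q≤1) (solve 2 (λ b q → con 1ℚ :+ b :* q := (con 1ℚ :+ b) :* q :+ (con 1ℚ :- q)) refl (ι B′) (½ * q)) ⟩
    1ℚ + ι B′ * (½ * q) ∎

  decay : pow (1ℚ - ½ * q) B′ * 24ℚ ≤ 1ℚ
  decay = ≤-trans (*-monoʳ (pow (1ℚ - ½ * q) B′) (pow-0≤ (0≤-diff ½q≤1) B′) 24≤) (pow-decay 0≤½q ½q≤1 B′)

  module Good (x : Vec Bool #pairs) (good : a ≤ X x) where
    open Decomposition ends x K 1<K using (#covered; #big-≤)

    T : ℚ
    T = ι #covered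

    ½a≤T : ½ * a ≤ T
    ½a≤T = ≤-trans (*-monoʳ ½ 0≤½ (≤-trans good (≤-trans (ι-mono #big-≤) (≤-reflexive (ι-+ #covered #covered))))) (≤-reflexive (solve 1 (λ t → con ½ :* (t :+ t) := t) refl T))

    k-small : 4 ℕ.* (K ℕ.* k) ℕ.≤ #covered
    k-small = ι-cancel (begin
      ι (4 ℕ.* (K ℕ.* k))       ≡⟨ trans (ι-* 4 (K ℕ.* k)) (cong₂ _*_ (ι-def 4) (ι-* K k)) ⟩
      toℚ 4 * (l * ι k)         ≤⟨ *-monoʳ (toℚ 4) (0≤toℚ 4) (*-monoʳ l 0≤l k≤κ) ⟩
      toℚ 4 * (l * κ)           ≡⟨ solve 3 (λ l a i → con (toℚ 4) :* (l :* (con ⅛ℚ :* a :* i)) := con ½ :* a :* (l :* i)) refl l a l⁻¹ ⟩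
      ½ * a * (l * l⁻¹)         ≡⟨ trans (cong (½ * a *_) ll⁻¹) (ℚₚ.*-identityʳ (½ * a)) ⟩
      ½ * a                     ≤⟨ ½a≤T ⟩
      T ∎)

    B-small : 32 ℕ.* B′ ℕ.≤ K ℕ.* #covered
    B-small = ι-cancel (begin
      ι (32 ℕ.* B′)             ≡⟨ trans (ι-* 32 B′) (cong (_* ι B′) (ι-def 32)) ⟩
      toℚ 32 * ι B′             ≤⟨ *-monoʳ (toℚ 32) (0≤toℚ 32) B≤β ⟩
      toℚ 32 * β                ≡⟨ solve 2 (λ l a → con (toℚ 32) :* (con ⅛ℚ :* con ⅛ℚ :* (l :* a)) := l :* (con ½ :* a)) refl l a ⟩
      l * (½ * a)               ≤⟨ *-monoʳ l 0≤l ½a≤T ⟩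
      l * T                     ≡⟨ sym (ι-* K #covered) ⟩
      ι (K ℕ.* #covered) ∎)

    -- Through `16 (N + 1) ≤ 32 N ≤ (a/2)²`. As `(a/2)² = ε² N² / 1024`, the constant in `e₃` is
    -- `32 · 1024`.
    n-small : 16 ℕ.* suc (suc n) ℕ.≤ #covered ℕ.* #covered
    n-small = ι-cancel (begin
      ι (16 ℕ.* suc (suc n))    ≡⟨ trans (ι-* 16 (suc (suc n))) (cong₂ _*_ (ι-def 16) (ι-suc (suc n))) ⟩
      toℚ 16 * (1ℚ + N)         ≤⟨ ≤-by (toℚ 16 * (N - 1ℚ)) (0≤* (0≤toℚ 16) (0≤-diff (1≤ι-suc n))) (solve 1 (λ N → con (toℚ 32) :* N := con (toℚ 16) :* (con 1ℚ :+ N) :+ con (toℚ 16) :* (N :- con 1ℚ)) refl N) ⟩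
      toℚ 32 * N                ≡⟨ solve 1 (λ N → con (toℚ 32) :* N := con 2⁻¹⁰ :* N :* con (toℚ 32768)) refl N ⟩
      2⁻¹⁰ * N * toℚ 32768
                                ≤⟨ *-monoʳ (2⁻¹⁰ * N) (0≤* (ℚₚ.nonNegative⁻¹ 2⁻¹⁰) 0≤N) e₃ ⟩
      2⁻¹⁰ * N * (ε * ε * N)
                                ≡⟨ solve 2 (λ N e → con 2⁻¹⁰ :* N :* (e :* e :* N) := (con ½ :* (N :* (con ½ :* (con ⅛ℚ :* e)))) :* (con ½ :* (N :* (con ½ :* (con ⅛ℚ :* e))))) refl N ε ⟩
      (½ * a) * (½ * a)         ≤⟨ *-mono (0≤* 0≤½ 0≤a) (0≤ι #covered) ½a≤T ½a≤T ⟩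
      T * T                     ≡⟨ sym (ι-* #covered #covered) ⟩
      ι (#covered ℕ.* #covered) ∎)

    few : Vec Bool #pairs → Bool
    few y = leb (distBP {suc n} (zipWith _∨_ x y)) k

    E-D-good : ι k * (1ℚ - ¼ℚ) ≤ E q (λ y → D (zipWith _∨_ x y))
    E-D-good = begin
      ι k * (1ℚ - ¼ℚ)
        ≤⟨ *-monoʳ (ι k) (0≤ι k) (ℚₚ.+-monoʳ-≤ 1ℚ (ℚₚ.neg-antimono-≤ (UnionBound.E-few (suc n) K 1<K x k B′ prq k-small B-small n-small decay))) ⟩
      ι k * (1ℚ - E q (λ y → 𝟙 (few y)))
        ≡⟨ cong (ι k *_) (trans (cong (_- E q (λ y → 𝟙 (few y))) (sym (E-const q #pairs 1ℚ))) (sym (E-- q (λ _ → 1ℚ) (λ y → 𝟙 (few y))))) ⟩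
      ι k * E q (λ y → 1ℚ - 𝟙 (few y))
        ≡⟨ sym (E-* q (ι k) (λ y → 1ℚ - 𝟙 (few y))) ⟩
      E q (λ y → ι k * (1ℚ - 𝟙 (few y)))
        ≤⟨ E-mono prq (λ y → pointwise y (few y) refl) ⟩
      E q (λ y → D (zipWith _∨_ x y)) ∎
      where
      pointwise : ∀ y b → few y ≡ b → ι k * (1ℚ - 𝟙 b) ≤ D (zipWith _∨_ x y)
      pointwise y true e = ≤-trans (≤-reflexive (ℚₚ.*-zeroʳ (ι k))) (0≤D (zipWith _∨_ x y))
      pointwise y false e = ≤-trans (≤-reflexive (ℚₚ.*-identityʳ (ι k))) (ι-mono (ℕₚ.<⇒≤ (leb⇒> e)))

  E-D-k : ι k * ¼ℚ ≤ E p D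
  E-D-k = begin
    ι k * ¼ℚ
      -- Both stages succeed with probability at least `½ · ¾ = 3/8`, rounded down to a quarter.
      ≤⟨ ≤-by (ι k * ⅛ℚ) (0≤* (0≤ι k) 0≤⅛) (solve 1 (λ k → k :* (con 1ℚ :- con ¼ℚ) :* (con 1ℚ :- con ½) := k :* con ¼ℚ :+ k :* con ⅛ℚ) refl (ι k)) ⟩
    c * (1ℚ - ½)
      ≤⟨ *-monoʳ c 0≤c (ℚₚ.+-monoʳ-≤ 1ℚ (ℚₚ.neg-antimono-≤ P-bad)) ⟩
    c * (1ℚ - E p₁ (λ x → 𝟙 (bad x)))
      ≡⟨ cong (c *_) (trans (cong (_- E p₁ (λ x → 𝟙 (bad x))) (sym (E-const p₁ #pairs 1ℚ))) (sym (E-- p₁ (λ _ → 1ℚ) (λ x → 𝟙 (bad x))))) ⟩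
    c * E p₁ (λ x → 1ℚ - 𝟙 (bad x))
      ≡⟨ sym (E-* p₁ c (λ x → 1ℚ - 𝟙 (bad x))) ⟩
    E p₁ (λ x → c * (1ℚ - 𝟙 (bad x)))
      ≤⟨ E-mono pr₁ (λ x → pointwise x (a ≤ᵇ X x) refl) ⟩
    E p₁ (λ x → E q (λ y → D (zipWith _∨_ x y)))
      ≡⟨ sym (E-⊕ p₁ q D) ⟩
    E (p₁ ⊕ q) D
      ≤⟨ E-mono-p pr pr⊕ (≤-trans ⊕≤ p₁+q≤p) D D-Monotone ⟩
    E p D ∎
    where
    c = ι k * (1ℚ - ¼ℚ)
    0≤c : 0ℚ ≤ c
    0≤c = 0≤* (0≤ι k) (ℚₚ.nonNegative⁻¹ (1ℚ - ¼ℚ))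
    pointwise : ∀ x b → (a ≤ᵇ X x) ≡ b → c * (1ℚ - 𝟙 (not b)) ≤ E q (λ y → D (zipWith _∨_ x y))
    pointwise x true e = ≤-trans (≤-reflexive (ℚₚ.*-identityʳ c)) (Good.E-D-good x (≤ᵇ⇒≤ e))
    pointwise x false e = ≤-trans (≤-reflexive (ℚₚ.*-zeroʳ c)) (0≤E prq (λ y → 0≤D (zipWith _∨_ x y)))

  -- Up to the bounded factor `ε² K ≤ C₁`, `κ` is `ε³ N / 128`. The hypothesis `e₄` absorbs the unit
  -- lost in rounding `κ` down at the cost of a factor 2, and the quarter from `E-D-k` turns 256
  -- into 1024.
  E-D-large : ε * ε * ε * N ≤ C₂ * E p D
  E-D-large = begin
    G
      ≤⟨ ≤-by (toℚ 2 * (C₁ * toℚ 128 * (1ℚ + ι k) - G) + (G - toℚ 256 * C₁)) (0≤+ (0≤* (0≤toℚ 2) (0≤-diff G≤)) (0≤-diff e₄))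
           (solve 2 (λ g k → con (toℚ 256) :* con C₁ :* k := g :+ (con (toℚ 2) :* (con C₁ :* con (toℚ 128) :* (con 1ℚ :+ k) :- g) :+ (g :- con (toℚ 256) :* con C₁))) refl G (ι k)) ⟩
    toℚ 256 * C₁ * ι k
      ≡⟨ solve 1 (λ k → con (toℚ 256) :* con C₁ :* k := con (toℚ 1024) :* con C₁ :* (k :* con ¼ℚ)) refl (ι k) ⟩
    C₂ * (ι k * ¼ℚ)
      ≤⟨ *-monoʳ C₂ (ℚₚ.nonNegative⁻¹ C₂) E-D-k ⟩
    C₂ * E p D ∎
    where
    G = ε * ε * ε * N
    G≤ : G ≤ C₁ * toℚ 128 * (1ℚ + ι k)
    G≤ = begin
      G
        ≡⟨ sym (trans (cong (G *_) ll⁻¹) (ℚₚ.*-identityʳ G)) ⟩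
      G * (l * l⁻¹)
        ≡⟨ solve 4 (λ e N l i → e :* e :* e :* N :* (l :* i) := (e :* e :* l) :* (e :* N :* i)) refl ε N l l⁻¹ ⟩
      (ε * ε * l) * (ε * N * l⁻¹)
        ≤⟨ *-monoˡ (ε * N * l⁻¹) (0≤* (0≤* 0≤ε 0≤N) 0≤l⁻¹) K-small ⟩
      C₁ * (ε * N * l⁻¹)
        ≡⟨ solve 3 (λ e N i → con C₁ :* (e :* N :* i) := con C₁ :* con (toℚ 128) :* (con ⅛ℚ :* (N :* (con ½ :* (con ⅛ℚ :* e))) :* i)) refl ε N l⁻¹ ⟩
      C₁ * toℚ 128 * κ
        ≤⟨ *-monoʳ (C₁ * toℚ 128) (ℚₚ.nonNegative⁻¹ (C₁ * toℚ 128)) κ≤ ⟩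
      C₁ * toℚ 128 * (1ℚ + ι k) ∎

-- Concentration

E-D-lower : ∀ ε → 0ℚ < ε → ε < 1ℚ → ∃ λ n₀ → ∀ n → suc n ≥ n₀ → ∀ p → IsProb p → p * ι (suc n) ≡ 1ℚ + ε →
  let open RandomGraph n in ε * ε * ε * N ≤ C₂ * E p D
E-D-lower ε 0<ε ε<1 = n₁ ℕ.+ (n₂ ℕ.+ (n₃ ℕ.+ n₄)) , λ n n≥ p pr pN →
    Sprinkling.E-D-large n k₀ 0<ε ε≤1 pr pN K-large K-small
      (proj₂ ev₁ (suc n) (ℕₚ.≤-trans (ℕₚ.m≤m+n n₁ _) n≥))
      (proj₂ ev₂ (suc n) (ℕₚ.≤-trans (ℕₚ.≤-trans (ℕₚ.m≤m+n n₂ (n₃ ℕ.+ n₄)) (ℕₚ.m≤n+m _ n₁)) n≥))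
      (proj₂ ev₃ (suc n) (ℕₚ.≤-trans (ℕₚ.≤-trans (ℕₚ.m≤m+n n₃ n₄) (ℕₚ.≤-trans (ℕₚ.m≤n+m _ n₂) (ℕₚ.m≤n+m _ n₁))) n≥))
      (proj₂ ev₄ (suc n) (ℕₚ.≤-trans (ℕₚ.≤-trans (ℕₚ.m≤n+m n₄ n₃) (ℕₚ.≤-trans (ℕₚ.m≤n+m _ n₂) (ℕₚ.m≤n+m _ n₁))) n≥))
  where
  ε≤1 : ε ≤ 1ℚ
  ε≤1 = <⇒≤ ε<1
  0<ε² : 0ℚ < ε * ε
  0<ε² = 0<* 0<ε 0<ε
  ε²≤1 : ε * ε ≤ 1ℚ
  ε²≤1 = *≤1 (<⇒≤ 0<ε) ε≤1 ε≤1
  inv = inverse (ε * ε) 0<ε²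
  r = proj₁ inv
  0≤r : 0ℚ ≤ r
  0≤r = <⇒≤ (proj₁ (proj₂ inv))
  ε²r : ε * ε * r ≡ 1ℚ
  ε²r = proj₂ (proj₂ inv)
  fl = floor (C₀ * r) (0≤* (ℚₚ.nonNegative⁻¹ C₀) 0≤r)
  k₀ = proj₁ fl
  -- Adding 2 to the rounded value of `C₀ / ε²` makes `K` exceed 1 and raises `ε² K` above `C₀` by
  -- at most 2, hence `C₁ = C₀ + 2`.
  K = suc (suc k₀)
  ιK : ι K ≡ 1ℚ + (1ℚ + ι k₀)
  ιK = trans (ι-suc (suc k₀)) (cong (λ z → 1ℚ + z) (ι-suc k₀))
  K-large : C₀ ≤ ε * ε * ι K
  K-large = begin
    C₀                               ≡⟨ sym (ℚₚ.*-identityʳ C₀) ⟩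
    C₀ * 1ℚ                          ≡⟨ cong (C₀ *_) (sym ε²r) ⟩
    C₀ * (ε * ε * r)                 ≡⟨ solve 3 (λ c e r → c :* (e :* r) := e :* (c :* r)) refl C₀ (ε * ε) r ⟩
    ε * ε * (C₀ * r)                 ≤⟨ *-monoʳ (ε * ε) (<⇒≤ 0<ε²) (≤-trans (proj₂ (proj₂ fl)) (≤-by 1ℚ 0≤1 (ℚₚ.+-comm 1ℚ (1ℚ + ι k₀)))) ⟩
    ε * ε * (1ℚ + (1ℚ + ι k₀))       ≡⟨ cong (ε * ε *_) (sym ιK) ⟩
    ε * ε * ι K ∎
    where open ℚₚ.≤-Reasoning
  K-small : ε * ε * ι K ≤ C₁
  K-small = begin
    ε * ε * ι K                      ≡⟨ cong (ε * ε *_) ιK ⟩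
    ε * ε * (1ℚ + (1ℚ + ι k₀))       ≤⟨ *-monoʳ (ε * ε) (<⇒≤ 0<ε²) (ℚₚ.+-monoʳ-≤ 1ℚ (ℚₚ.+-monoʳ-≤ 1ℚ (proj₁ (proj₂ fl)))) ⟩
    ε * ε * (1ℚ + (1ℚ + C₀ * r))     ≡⟨ solve 3 (λ c e r → e :* (con 1ℚ :+ (con 1ℚ :+ c :* r)) := e :+ e :+ c :* (e :* r)) refl C₀ (ε * ε) r ⟩
    ε * ε + ε * ε + C₀ * (ε * ε * r) ≡⟨ cong (λ z → ε * ε + ε * ε + C₀ * z) ε²r ⟩
    ε * ε + ε * ε + C₀ * 1ℚ          ≤⟨ ℚₚ.+-monoˡ-≤ (C₀ * 1ℚ) (+-mono-≤ ε²≤1 ε²≤1) ⟩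
    1ℚ + 1ℚ + C₀ * 1ℚ                ≡⟨ refl ⟩
    C₁ ∎
    where open ℚₚ.≤-Reasoning
  ev₁ = eventually-≤ (toℚ 8 * ι (K ℕ.+ K)) ε 0<ε
  ev₂ = eventually-≤ (toℚ 16384 * (ι K * ι K)) (ε * ε) 0<ε²
  ev₃ = eventually-≤ (toℚ 32768) (ε * ε) 0<ε²
  ev₄ = eventually-≤ (toℚ 256 * C₁) (ε * ε * ε) (0<* 0<ε² 0<ε)
  n₁ = proj₁ ev₁
  n₂ = proj₁ ev₂
  n₃ = proj₁ ev₃
  n₄ = proj₁ ev₄

opaque
  inv-C₂ : ∃ λ r → 0ℚ < r × C₂ * r ≡ 1ℚ
  inv-C₂ = inverse C₂ (ℚₚ.positive⁻¹ C₂)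

C₂⁻¹ : ℚ
C₂⁻¹ = proj₁ inv-C₂

-- The mean lies between `2 c₁ ε³ N` and `246 ε³ N`. Halving below and adding one unit above leaves
-- a margin of at least `c₁ ε³ N` on either side, because `c₁ ≤ 1`.
c₁ c₂ : ℚ
c₁ = ½ * C₂⁻¹
c₂ = toℚ 247

0<C₂⁻¹ : 0ℚ < C₂⁻¹
0<C₂⁻¹ = proj₁ (proj₂ inv-C₂)

0<c₁ : 0ℚ < c₁
0<c₁ = 0<* (ℚₚ.positive⁻¹ ½) 0<C₂⁻¹

C₂⁻¹≤1 : C₂⁻¹ ≤ 1ℚ
C₂⁻¹≤1 = ≤-trans (≤-by ((C₂ - 1ℚ) * C₂⁻¹) (0≤* (ℚₚ.nonNegative⁻¹ (C₂ - 1ℚ)) (<⇒≤ 0<C₂⁻¹)) (solve 2 (λ C c → C :* c := c :+ (C :- con 1ℚ) :* c) refl C₂ C₂⁻¹)) (≤-reflexive (proj₂ (proj₂ inv-C₂)))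

c₁≤1 : c₁ ≤ 1ℚ
c₁≤1 = *≤1 0≤½ ½≤1 C₂⁻¹≤1

c₁≤c₂ : c₁ ≤ c₂
c₁≤c₂ = ≤-trans c₁≤1 (≤-by (toℚ 246) (0≤toℚ 246) refl)

twice-≤ : ∀ {C c e N m} → 0ℚ ≤ c → C * c ≡ 1ℚ → e * N ≤ C * m → ½ * c * e * N + ½ * c * e * N ≤ m
twice-≤ {C} {c} {e} {N} {m} 0≤c Cc≡1 h = begin
  ½ * c * e * N + ½ * c * e * N  ≡⟨ solve 3 (λ c e N → con ½ :* c :* e :* N :+ con ½ :* c :* e :* N := c :* (e :* N)) refl c e N ⟩
  c * (e * N)                    ≤⟨ *-monoʳ c 0≤c h ⟩
  c * (C * m)                    ≡⟨ solve 3 (λ c C m → c :* (C :* m) := C :* c :* m) refl c C m ⟩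
  C * c * m                      ≡⟨ trans (cong (_* m) Cc≡1) (ℚₚ.*-identityˡ m) ⟩
  m ∎
  where open ℚₚ.≤-Reasoning

∧-fails : ∀ {P Q : Set} (P? : Dec P) (Q? : Dec Q) → not (does P? ∧ does Q?) ≡ true → does P? ≡ false ⊎ does Q? ≡ false
∧-fails P? Q? e with does P? | does Q?
... | false | _ = inj₁ refl
... | true | false = inj₂ refl

module Concentration (ε δ : ℚ) (0<ε : 0ℚ < ε) (ε<1 : ε < 1ℚ) (0<δ : 0ℚ < δ) (n₁ n₂ n₃ : ℕ)
    (upper : ∀ n → suc n ≥ n₁ → ∀ p → IsProb p → p * ι (suc n) ≡ 1ℚ + ε → E p (RandomGraph.D n) ≤ toℚ 246 * (ε * ε * ε) * ι (suc n))
    (lower : ∀ n → suc n ≥ n₂ → ∀ p → IsProb p → p * ι (suc n) ≡ 1ℚ + ε → ε * ε * ε * ι (suc n) ≤ C₂ * E p (RandomGraph.D n))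
    (rate : ∀ n → n ≥ n₃ → toℚ 2 ≤ δ * ((c₁ * (ε * ε * ε)) * (c₁ * (ε * ε * ε))) * ι n) where
  ε³ : ℚ
  ε³ = ε * ε * ε

  0<ε³ : 0ℚ < ε³
  0<ε³ = 0<* (0<* 0<ε 0<ε) 0<ε

  -- The summand 2 makes `(1 + ε)/n` a probability and excludes the graph on no vertices.
  threshold : ℕ
  threshold = 2 ℕ.+ (n₁ ℕ.+ (n₂ ℕ.+ n₃))

  Event : (n : ℕ) → Graph n → Bool
  Event n G = does (c₁ * (ε * ε * ε) * toℚ n ≤? toℚ (distBP {n} G)) ∧ does (toℚ (distBP {n} G) ≤? c₂ * (ε * ε * ε) * toℚ n)

  module _ (n : ℕ) (n≥ : suc n ≥ threshold) where
    open RandomGraph n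
    open ℚₚ.≤-Reasoning

    p : ℚ
    p = pEdge ε (suc n)

    pN : p * N ≡ 1ℚ + ε
    pN = trans (solve 3 (λ c r N → c :* r :* N := c :* (N :* r)) refl (1ℚ + ε) (ℤ.+ 1 / suc n) N) (trans (cong ((1ℚ + ε) *_) (*-recip n)) (ℚₚ.*-identityʳ (1ℚ + ε)))

    2≤N : toℚ 2 ≤ N
    2≤N = ≤-trans (≤-reflexive (sym (ι-def 2))) (ι-mono (ℕₚ.≤-trans (ℕₚ.m≤m+n 2 _) n≥))

    1+ε≤2 : 1ℚ + ε ≤ toℚ 2
    1+ε≤2 = ℚₚ.+-monoʳ-≤ 1ℚ (<⇒≤ ε<1)

    pr : IsProb p
    pr = isProb (0≤* (0≤+ 0≤1 (<⇒≤ 0<ε)) (<⇒≤ (0<recip n)))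
      (*-cancelˡ N 0<N (≤-trans (≤-reflexive (trans (ℚₚ.*-comm N p) pN)) (≤-trans (≤-trans 1+ε≤2 2≤N) (≤-reflexive (sym (ℚₚ.*-identityʳ N))))))

    μ a : ℚ
    μ = E p D
    a = c₁ * ε³ * N

    0≤a : 0ℚ ≤ a
    0≤a = 0≤* (0≤* (<⇒≤ 0<c₁) (<⇒≤ 0<ε³)) 0≤N

    0<a : 0ℚ < a
    0<a = 0<* (0<* 0<c₁ 0<ε³) 0<N

    above : ∀ {i} → i ℕ.≤ n₁ ℕ.+ (n₂ ℕ.+ n₃) → suc n ≥ threshold → i ℕ.≤ suc n
    above h k = ℕₚ.≤-trans h (ℕₚ.≤-trans (ℕₚ.m≤n+m (n₁ ℕ.+ (n₂ ℕ.+ n₃)) 2) k)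

    μ-upper : μ ≤ toℚ 246 * ε³ * N
    μ-upper = upper n (above (ℕₚ.m≤m+n n₁ (n₂ ℕ.+ n₃)) n≥) p pr pN

    μ-lower : a + a ≤ μ
    μ-lower = twice-≤ {C₂} {C₂⁻¹} {ε³} {N} {μ} (<⇒≤ 0<C₂⁻¹) (proj₂ (proj₂ inv-C₂)) (lower n (above (ℕₚ.≤-trans (ℕₚ.m≤m+n n₂ n₃) (ℕₚ.m≤n+m (n₂ ℕ.+ n₃) n₁)) n≥) p pr pN)

    bad : Graph (suc n) → Bool
    bad G = not (Event (suc n) G)

    square : ∀ {d} → a ≤ d → a * a ≤ d * d
    square h = *-mono 0≤a (≤-trans 0≤a h) h h

    far-below : ∀ d → d ≤ a → a * a ≤ (d - μ) * (d - μ)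
    far-below d d≤a = ≤-trans (square gap) (≤-reflexive (solve 2 (λ d u → (u :- d) :* (u :- d) := (d :- u) :* (d :- u)) refl d μ))
      where
      gap : a ≤ μ - d
      gap = ≤-by ((μ - (a + a)) + (a - d)) (0≤+ (0≤-diff μ-lower) (0≤-diff d≤a)) (solve 3 (λ u a d → u :- d := a :+ ((u :- (a :+ a)) :+ (a :- d))) refl μ a d)

    far-above : ∀ d → c₂ * ε³ * N ≤ d → a * a ≤ (d - μ) * (d - μ)
    far-above d d≥ = square gap
      where
      gap : a ≤ d - μ
      gap = ≤-by ((d - c₂ * ε³ * N) + (toℚ 246 * ε³ * N - μ) + (1ℚ - c₁) * (ε³ * N))
        (0≤+ (0≤+ (0≤-diff d≥) (0≤-diff μ-upper)) (0≤* (0≤-diff c₁≤1) (0≤* (<⇒≤ 0<ε³) 0≤N)))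
        (solve 5 (λ d u c e N → d :- u := c :* e :* N :+ ((d :- con c₂ :* e :* N) :+ (con (toℚ 246) :* e :* N :- u) :+ (con 1ℚ :- c) :* (e :* N))) refl d μ c₁ ε³ N)

    far : ∀ G → bad G ≡ true → a * a ≤ (D G - μ) * (D G - μ)
    far G e = split (∧-fails lower? upper? e)
      where
      d = distBP {suc n} G
      lower? = c₁ * (ε * ε * ε) * toℚ (suc n) ≤? toℚ d
      upper? = toℚ d ≤? c₂ * (ε * ε * ε) * toℚ (suc n)
      split : does lower? ≡ false ⊎ does upper? ≡ false → a * a ≤ (D G - μ) * (D G - μ)
      split (inj₁ small) = far-below (D G) (subst₂ _≤_ (sym (ι-def d)) (cong (λ z → c₁ * ε³ * z) (sym (ι-def (suc n)))) (<⇒≤ (ℚₚ.≰⇒> (does-false lower? small))))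
      split (inj₂ large) = far-above (D G) (subst₂ _≤_ (cong (λ z → c₂ * ε³ * z) (sym (ι-def (suc n)))) (sym (ι-def d)) (<⇒≤ (ℚₚ.≰⇒> (does-false upper? large))))

    -- The variance of the distance is at most `2 N`, while `a²` is quadratic in `N`; `rate` asks
    -- for `N` so large that the quotient falls below `δ`.
    V≤ : ι #pairs * (p * (1ℚ * 1ℚ)) ≤ a * a * δ
    V≤ = begin
      ι #pairs * (p * (1ℚ * 1ℚ))
        ≤⟨ *-monoˡ (p * (1ℚ * 1ℚ)) (0≤* (IsProb.0≤p pr) (ℚₚ.nonNegative⁻¹ (1ℚ * 1ℚ))) ι#pairs-≤ ⟩
      N * N * (p * (1ℚ * 1ℚ))
        ≡⟨ trans (solve 2 (λ N p → N :* N :* (p :* (con 1ℚ :* con 1ℚ)) := N :* (p :* N)) refl N p) (cong (N *_) pN) ⟩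
      N * (1ℚ + ε)
        ≤⟨ *-monoʳ N 0≤N (≤-trans 1+ε≤2 (rate (suc n) (above (ℕₚ.≤-trans (ℕₚ.m≤n+m n₃ n₂) (ℕₚ.m≤n+m (n₂ ℕ.+ n₃) n₁)) n≥))) ⟩
      N * (δ * ((c₁ * ε³) * (c₁ * ε³)) * N)
        ≡⟨ solve 4 (λ N d c e → N :* (d :* ((c :* e) :* (c :* e)) :* N) := (c :* e :* N) :* (c :* e :* N) :* d) refl N δ c₁ ε³ ⟩
      a * a * δ ∎

    P-bad : E p (λ G → 𝟙 (bad G)) ≤ δ
    P-bad = *-cancelˡ (a * a) (0<* 0<a 0<a) (≤-trans (chebyshev pr D bad a (ι #pairs * (p * (1ℚ * 1ℚ))) (D-variance pr) far) V≤)

    P-Event : 1ℚ - δ ≤ probGnp (suc n) p (Event (suc n))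
    P-Event = begin
      1ℚ - δ                               ≤⟨ ℚₚ.+-monoʳ-≤ 1ℚ (ℚₚ.neg-antimono-≤ P-bad) ⟩
      1ℚ - E p (λ G → 𝟙 (bad G))           ≡⟨ sym (E-not p (Event (suc n))) ⟩
      E p (λ G → 𝟙 (Event (suc n) G))      ≡⟨ sym (probBits-E p #pairs (Event (suc n))) ⟩
      probGnp (suc n) p (Event (suc n)) ∎

  conclusion : ∀ n → n ≥ threshold → 1ℚ - δ ≤ probGnp n (pEdge ε n) (Event n)
  conclusion (suc n) n≥ = P-Event n n≥

theorem1p1 : ∃₂ λ (c₁ c₂ : ℚ) → 0ℚ < c₁ × c₁ ≤ c₂ ×
    ((ε : ℚ) → 0ℚ < ε → ε < 1ℚ → (δ : ℚ) → 0ℚ < δ →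
    ∃ λ (N : ℕ) → (n : ℕ) → n ≥ N →
    1ℚ - δ ≤ probGnp n (pEdge ε n)
    (λ (G : Graph n) → does (c₁ * (ε * ε * ε) * toℚ n ≤? toℚ (distBP {n} G))
    ∧ does (toℚ (distBP {n} G) ≤? c₂ * (ε * ε * ε) * toℚ n)))
theorem1p1 = c₁ , c₂ , 0<c₁ , c₁≤c₂ ,
  λ ε 0<ε ε<1 δ 0<δ → let
      ε³ = ε * ε * ε
      0<c₁ε³ = 0<* 0<c₁ (0<* (0<* 0<ε 0<ε) 0<ε)
      n₁ , upper = E-D-upper ε 0<ε ε<1
      n₂ , lower = E-D-lower ε 0<ε ε<1
      n₃ , rate = eventually-≤ (toℚ 2) (δ * ((c₁ * ε³) * (c₁ * ε³))) (0<* 0<δ (0<* 0<c₁ε³ 0<c₁ε³))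
    in Concentration.threshold ε δ 0<ε ε<1 0<δ n₁ n₂ n₃ upper lower rate , Concentration.conclusion ε δ 0<ε ε<1 0<δ n₁ n₂ n₃ upper lower rate
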